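{- There exists $C'>0$ such that for all $k\in\mathbb{N}$ with $k\ge 2$, every $C'k^{2}\log k$-linked tournament contains $k$ edge-disjoint Hamilton cycles.
   Context: A tournament is an orientation of a complete graph; a Hamilton cycle is a consistently oriented cycle through all vertices. A digraph $D$ is $k$-linked if $|D|\ge 2k$ and whenever $x_1,\dots,x_k,y_1,\dots,y_k$ are $2k$ distinct vertices of $D$, there exist vertex-disjoint directed paths $P_1,\dots,P_k$ such that $P_i$ is a path from $x_i$ to $y_i$. $\log$ denotes the binary logarithm. -}

module Defs where

open import Data.Nat using (ℕ; zero; suc; _≤_; _+_; _*_)
open import Data.Nat.DivMod using (_%_; m%n<n)
open import Data.Bool using (Bool; true; false)
open import Data.Fin using (Fin; toℕ; fromℕ<)
open import Data.Fin.Permutation using (Permutation′; _⟨$⟩ʳ_)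
open import Data.List using (List; []; _∷_)
open import Data.List.Membership.Propositional using (_∈_)
open import Data.List.Relation.Unary.Unique.Propositional using (Unique)
open import Data.Sum using (_⊎_)
open import Data.Product using (Σ; _×_; _,_)
open import Relation.Binary.PropositionalEquality using (_≡_; _≢_)
open import Function.Definitions using (Injective)

record Tournament (n : ℕ) : Set where
  field
    arc        : Fin n → Fin n → Bool
    irreflexive : ∀ x → arc x x ≡ false
    oriented    : ∀ x y → x ≢ y → (arc x y ≡ true × arc y x ≡ false)
                                   ⊎ (arc y x ≡ true × arc x y ≡ false)
open Tournament public

data Walk {n : ℕ} (T : Tournament n) : Fin n → Fin n → Set where
  [_] : (x : Fin n) → Walk T x x
  step : (x : Fin n) {y z : Fin n} → arc T x y ≡ true → Walk T y z → Walk T x z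

vertices : ∀ {n} {T : Tournament n} {x y} → Walk T x y → List (Fin n)
vertices [ x ] = x ∷ []
vertices (step x _ w) = x ∷ vertices w

record Path {n : ℕ} (T : Tournament n) (x y : Fin n) : Set where
  constructor path
  field
    walk     : Walk T x y
    distinct : Unique (vertices walk)
open Path public

Linked : ∀ {n} → Tournament n → ℕ → Set
Linked {n} T ℓ =
  (ℓ + ℓ ≤ n) ×
  ((xs ys : Fin ℓ → Fin n) →
     Injective _≡_ _≡_ xs → Injective _≡_ _≡_ ys → (∀ i j → xs i ≢ ys j) →
     Σ ((i : Fin ℓ) → Path T (xs i) (ys i)) λ P →
       ∀ i j v → v ∈ vertices (walk (P i)) → v ∈ vertices (walk (P j)) → i ≡ j)

next : ∀ {n} → Fin n → Fin n
next {suc m} i = fromℕ< (m%n<n (suc (toℕ i)) (suc m))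

IsHamiltonCycle : ∀ {n} → Tournament n → Permutation′ n → Set
IsHamiltonCycle {n} T σ = ∀ (i : Fin n) → arc T (σ ⟨$⟩ʳ i) (σ ⟨$⟩ʳ next i) ≡ true

cycleArc : ∀ {n} → Permutation′ n → Fin n → Fin n × Fin n
cycleArc σ i = (σ ⟨$⟩ʳ i , σ ⟨$⟩ʳ next i)

HasEdgeDisjointHamCycles : ∀ {n} → Tournament n → ℕ → Set
HasEdgeDisjointHamCycles {n} T k =
  Σ (Fin k → Permutation′ n) λ C →
    (∀ c → IsHamiltonCycle T (C c)) ×
    (∀ c d i j → cycleArc (C c) i ≡ cycleArc (C d) j → c ≡ d)

{-# OPTIONS --safe #-}
module Submission where

open import Defs
open import Data.Nat using (ℕ; zero; suc; _≤_; _<_; _+_; _*_; _^_; z≤n; s≤s; _≤?_)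
open import Data.Nat.Properties
open import Data.Nat.DivMod using (_%_; m%n<n; m<n⇒m%n≡m; n%n≡0)
open import Data.Nat.Tactic.RingSolver using (solve-∀)
open import Data.Bool using (true; false)
import Data.Bool.Properties as Bool
open import Data.Fin using (Fin; toℕ; cast) renaming (zero to fzero; suc to fsuc)
import Data.Fin.Properties as Fin
open import Data.Fin.Permutation using (Permutation′; permutation; _⟨$⟩ʳ_)
open import Data.List using (List; []; _∷_; _++_; _∷ʳ_; length; map; concat; concatMap; filter; reverse; lookup; allFin)
  renaming ([_] to [_]ₗ)
open import Data.List.Properties
  using (++-assoc; ++-identityʳ; length-++; length-map; length-filter; length-tabulate; filter-all;
         unfold-reverse; reverse-++; reverse-involutive; map-tabulate; tabulate-lookup;
         concatMap-map; concatMap-++; concatMap-cong)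
open import Data.List.Membership.Propositional using (_∈_; _∉_; find; lose)
open import Data.List.Membership.Propositional.Properties
  using (∈-++⁺ˡ; ∈-++⁺ʳ; ∈-++⁻; ∈-∃++; ∈-filter⁺; ∈-filter⁻; ∈-allFin; ∈-lookup; ∈-concat⁺′)
open import Data.List.Relation.Unary.Any using (Any; here; there; any?; index)
open import Data.List.Relation.Unary.Any.Properties using (lookup-index)
open import Data.List.Relation.Unary.All using (All; []; _∷_)
import Data.List.Relation.Unary.All as All
import Data.List.Relation.Unary.All.Properties as AllP
open import Data.List.Relation.Unary.AllPairs using (AllPairs; []; _∷_)
open import Data.List.Relation.Unary.Unique.Propositional using (Unique)
import Data.List.Relation.Unary.Unique.Propositional.Properties as Uniq
open import Data.List.Relation.Binary.Permutation.Propositional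
  using (_↭_; ↭-sym; ↭-trans; ↭-refl; ↭-reflexive; prep; swap; ↭⇒↭ₛ)
open import Data.List.Relation.Binary.Permutation.Propositional.Properties
  using (++-commutativeMonoid; ∈-resp-↭; All-resp-↭; Any-resp-↭; ↭-length; ↭-reverse; drop-∷; shift;
         ++⁺; ++⁺ˡ; ++⁺ʳ; ++-comm)
import Data.List.Relation.Binary.Permutation.Setoid.Properties as SetoidPermutation
open import Data.Product using (Σ; _×_; _,_; proj₁; proj₂; ∃-syntax)
open import Data.Sum using (_⊎_; inj₁; inj₂; [_,_]′)
open import Data.Unit using (⊤; tt)
open import Data.Empty using (⊥; ⊥-elim)
open import Function using (_∘_; id; flip)
open import Function.Definitions using (Injective)
open import Relation.Nullary using (¬_; Dec; yes; no; ¬?; _⊎-dec_)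
open import Relation.Unary using (Decidable)
open import Relation.Binary.Definitions using (DecidableEquality)
open import Relation.Binary.PropositionalEquality
  using (_≡_; _≢_; refl; sym; trans; cong; cong₂; subst; setoid)
import Algebra.Solver.CommutativeMonoid

-- For each of the k cycles reserve 16 (d + 1) strands, where d = 4 k, all strands being disjoint.  A strand
-- is a path A ⇒ … ⇒ B in which A in-dominates and B out-dominates almost all vertices.  A starts at a vertex
-- of least out-degree among the unused ones and then halves the undominated set O(log k) times, so the
-- exceptional (undominated) vertices are few compared with the out-degree of every unreserved vertex; B is
-- symmetric.  For every v in A or B the strand also contains a covering arc x → y with x → v → y, so that v
-- can be put back into the cycle if the cycle enters A, or leaves B, in the middle.  This requires linking
-- O(k² log k) pairs of vertices, all at once.
--
-- The cycles are then built one after the other.  At each vertex at most d arcs are forbidden (used by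
-- earlier cycles or reserved for later ones), so the vertices off the strands are covered by d + 1 paths:
-- a new vertex has no forbidden arc to or from one of these paths and can be inserted there.  An end w of a
-- path is made unexceptional by choosing p in N⁺(w) such that neither p nor its predecessor is exceptional,
-- cutting p out of its path and appending it to w; starts are treated symmetrically.  Two rounds move ends
-- and starts away from the reserved vertices, two more away from the exceptional ones, and each round
-- doubles the number of ends or starts involved, giving as many of them as there are strands.  Every end
-- can now enter every A and every start can be reached from every B, and the pieces close up to a cycle.

-- What the degrees can pay for shapes the four rounds. Of a reserved vertex only the degree bound ℓ
-- is known, and no bound on the exceptional sets in terms of ℓ is available; hence two rounds avoid
-- reserved vertices only. Afterwards the exceptional vertices of all A together are at most a sixth
-- of the out-degree of an unreserved vertex, those of all B at most a sixth of its in-degree, but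
-- out- and in-degrees are not comparable; so the smaller exceptional set decides which of the last
-- two rounds is first. A cut made for an end also creates a start, and conversely, so equal numbers
-- of both double together: d + 1 become 16 (d + 1). The 15 (d + 1) cuts may hit strands, but not
-- all of them, and closing up begins at an uncut strand. Because ends, starts and strands are
-- equally many, pieces with two joints are as many as pieces with two free ends, and the two kinds
-- can alternate around the cycle. d = 4 k since a cycle still to be built reserves at most four
-- arcs at a vertex, two on strands and two for putting vertices back; a finished one uses two.

-- Consecutive, first and last elements of lists

module _ {V : Set} where

  Unique-↭ : {xs ys : List V} → xs ↭ ys → Unique xs → Unique ys
  Unique-↭ p = SetoidPermutation.Unique-resp-↭ (setoid V) (↭⇒↭ₛ p)

  unique-++ˡ : ∀ (xs : List V) {ys} → Unique (xs ++ ys) → Unique xs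
  unique-++ˡ [] _ = []
  unique-++ˡ (x ∷ xs) (px ∷ u) = AllP.++⁻ˡ xs px ∷ unique-++ˡ xs u

  unique-++ʳ : ∀ (xs : List V) {ys} → Unique (xs ++ ys) → Unique ys
  unique-++ʳ [] u = u
  unique-++ʳ (x ∷ xs) (_ ∷ u) = unique-++ʳ xs u

  unique-disjoint : ∀ (xs : List V) {ys} → Unique (xs ++ ys) → ∀ {v} → v ∈ xs → v ∉ ys
  unique-disjoint (x ∷ xs) (px ∷ u) (here refl) v∈ = All.lookup px (∈-++⁺ʳ xs v∈) refl
  unique-disjoint (x ∷ xs) (px ∷ u) (there i) = unique-disjoint xs u i

  unique-++ : ∀ {xs ys : List V} → Unique xs → Unique ys → (∀ {v} → v ∈ xs → v ∉ ys) → Unique (xs ++ ys)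
  unique-++ ux uy d = Uniq.++⁺ ux uy (λ { (i , j) → d i j })

  unique-⊆-length : ∀ {xs ys : List V} → Unique xs → (∀ {v} → v ∈ xs → v ∈ ys) → length xs ≤ length ys
  unique-⊆-length {[]} _ _ = z≤n
  unique-⊆-length {x ∷ xs} {ys} (px ∷ u) s with ∈-∃++ (s (here refl))
  ... | as , bs , refl = subst (suc (length xs) ≤_) (sym (↭-length (shift x as bs)))
          (s≤s (unique-⊆-length u λ {v} i → inside (λ { refl → All.lookup px i refl }) (∈-resp-↭ (shift x as bs) (s (there i)))))
    where
    inside : ∀ {v} → v ≢ x → v ∈ x ∷ as ++ bs → v ∈ as ++ bs
    inside ne (here e) = ⊥-elim (ne e)
    inside ne (there i) = i

  data Con (u v : V) : List V → Set where
    now   : ∀ {r} → Con u v (u ∷ v ∷ r)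
    later : ∀ {x r} → Con u v r → Con u v (x ∷ r)

  data Head (u : V) : List V → Set where
    first : ∀ {r} → Head u (u ∷ r)

  data Last (u : V) : List V → Set where
    sole  : Last u (u ∷ [])
    later : ∀ {x r} → Last u r → Last u (x ∷ r)

  IsPath : (V → V → Set) → List V → Set
  IsPath R xs = ∀ {u v} → Con u v xs → R u v

  con-++⁻ : ∀ {u v} xs {ys} → Con u v (xs ++ ys) → Con u v xs ⊎ Con u v ys ⊎ (Last u xs × Head v ys)
  con-++⁻ [] c = inj₂ (inj₁ c)
  con-++⁻ (x ∷ []) now = inj₂ (inj₂ (sole , first))
  con-++⁻ (x ∷ y ∷ xs) now = inj₁ now
  con-++⁻ (x ∷ xs) (later c) with con-++⁻ xs c
  ... | inj₁ d = inj₁ (later d)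
  ... | inj₂ (inj₁ d) = inj₂ (inj₁ d)
  ... | inj₂ (inj₂ (l , h)) = inj₂ (inj₂ (later l , h))

  con-++ˡ : ∀ {u v xs} ys → Con u v xs → Con u v (xs ++ ys)
  con-++ˡ ys now = now
  con-++ˡ ys (later c) = later (con-++ˡ ys c)

  con-++ʳ : ∀ {u v} xs {ys} → Con u v ys → Con u v (xs ++ ys)
  con-++ʳ [] c = c
  con-++ʳ (x ∷ xs) c = later (con-++ʳ xs c)

  con-++ᵐ : ∀ {u v xs ys} → Last u xs → Head v ys → Con u v (xs ++ ys)
  con-++ᵐ sole first = now
  con-++ᵐ (later l) h = later (con-++ᵐ l h)

  con∈ˡ : ∀ {u v xs} → Con u v xs → u ∈ xs
  con∈ˡ now = here refl
  con∈ˡ (later c) = there (con∈ˡ c)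

  con∈ʳ : ∀ {u v x xs} → Con u v (x ∷ xs) → v ∈ xs
  con∈ʳ now = here refl
  con∈ʳ {xs = _ ∷ _} (later c) = there (con∈ʳ c)

  con∈ : ∀ {u v xs} → Con u v xs → v ∈ xs
  con∈ {xs = _ ∷ _} c = there (con∈ʳ c)

  con∈-init : ∀ {u v} xs {z} → Con u v (xs ∷ʳ z) → u ∈ xs
  con∈-init (x ∷ []) now = here refl
  con∈-init (x ∷ y ∷ xs) now = here refl
  con∈-init (x ∷ xs) (later c) = there (con∈-init xs c)
  con∈-init [] (later ())

  last∈ : ∀ {u xs} → Last u xs → u ∈ xs
  last∈ sole = here refl
  last∈ (later l) = there (last∈ l)

  last-∷ʳ : ∀ {u} xs → Last u (xs ∷ʳ u)
  last-∷ʳ [] = sole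
  last-∷ʳ (x ∷ xs) = later (last-∷ʳ xs)

  last-∷ʳ⁻ : ∀ {u w} xs → Last u (xs ∷ʳ w) → u ≡ w
  last-∷ʳ⁻ [] sole = refl
  last-∷ʳ⁻ (x ∷ []) (later l) = last-∷ʳ⁻ [] l
  last-∷ʳ⁻ (x ∷ y ∷ xs) (later l) = last-∷ʳ⁻ (y ∷ xs) l

  last-++ : ∀ {u} xs {ys} → Last u ys → Last u (xs ++ ys)
  last-++ [] l = l
  last-++ (x ∷ xs) l = later (last-++ xs l)

  last-++⁻ : ∀ {u} xs {y ys} → Last u (xs ++ y ∷ ys) → Last u (y ∷ ys)
  last-++⁻ [] l = l
  last-++⁻ (x ∷ []) (later l) = l
  last-++⁻ (x ∷ y ∷ xs) (later l) = last-++⁻ (y ∷ xs) l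

  last-unique : ∀ {u v xs} → Last u xs → Last v xs → u ≡ v
  last-unique sole sole = refl
  last-unique (later l) (later m) = last-unique l m
  last-unique sole (later ())
  last-unique (later ()) sole

  head-++ : ∀ {u xs} ys → Head u xs → Head u (xs ++ ys)
  head-++ ys first = first

  path-++ : ∀ {R : V → V → Set} xs {ys} → IsPath R xs → IsPath R ys →
            (∀ {u v} → Last u xs → Head v ys → R u v) → IsPath R (xs ++ ys)
  path-++ xs p q r c with con-++⁻ xs c
  ... | inj₁ d = p d
  ... | inj₂ (inj₁ d) = q d
  ... | inj₂ (inj₂ (l , h)) = r l h

  -- Only sources must be distinct, so `z` may repeat an element of `xs`; with `z` the head of `xs`
  -- the lemma speaks of a cycle.
  con-succ-unique : ∀ {u v w} xs {z} → Unique xs → Con u v (xs ∷ʳ z) → Con u w (xs ∷ʳ z) → v ≡ w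
  con-succ-unique [] _ (later ()) _
  con-succ-unique (x ∷ []) _ now now = refl
  con-succ-unique (x ∷ y ∷ xs) _ now now = refl
  con-succ-unique (x ∷ []) _ (later (later ())) _
  con-succ-unique (x ∷ []) _ now (later (later ()))
  con-succ-unique (x ∷ y ∷ xs) (px ∷ u) (later c) (later d) = con-succ-unique (y ∷ xs) u c d
  con-succ-unique (x ∷ y ∷ xs) (px ∷ u) now (later d) = ⊥-elim (All.lookup px (con∈-init (y ∷ xs) d) refl)
  con-succ-unique (x ∷ y ∷ xs) (px ∷ u) (later c) now = ⊥-elim (All.lookup px (con∈-init (y ∷ xs) c) refl)

  con-pred-unique : ∀ {u v w z} xs → Unique xs → Con u w (z ∷ xs) → Con v w (z ∷ xs) → u ≡ v
  con-pred-unique (x ∷ xs) _ now now = refl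
  con-pred-unique (x ∷ xs) (px ∷ u) now (later d) = ⊥-elim (All.lookup px (con∈ʳ d) refl)
  con-pred-unique (x ∷ xs) (px ∷ u) (later c) now = ⊥-elim (All.lookup px (con∈ʳ c) refl)
  con-pred-unique (x ∷ xs) (px ∷ u) (later c) (later d) = con-pred-unique xs u c d

  con-flip : ∀ {u v} {xs : List V} → Con u v xs → Con v u (reverse xs)
  con-flip {u} {v} {.(u ∷ v ∷ r)} (now {r}) rewrite unfold-reverse u (v ∷ r) | unfold-reverse v r =
    subst (Con v u) (sym (++-assoc (reverse r) (v ∷ []) (u ∷ []))) (con-++ʳ (reverse r) now)
  con-flip {xs = x ∷ r} (later c) rewrite unfold-reverse x r = con-++ˡ _ (con-flip c)

  head-cons : ∀ {v} {xs : List V} → Head v xs → ∃[ ys ] xs ≡ v ∷ ys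
  head-cons first = _ , refl

  last-snoc : ∀ {v} {xs : List V} → Last v xs → ∃[ ys ] xs ≡ ys ∷ʳ v
  last-snoc sole = [] , refl
  last-snoc {xs = x ∷ _} (later l) with last-snoc l
  ... | ys , refl = x ∷ ys , refl

  last? : ∀ (x : V) xs → ∃[ v ] Last v (x ∷ xs)
  last? x [] = x , sole
  last? x (y ∷ xs) with last? y xs
  ... | v , l = v , later l

  filter-drops-one : ∀ {Q : V → Set} (Q? : Decidable Q) {xs} → Unique xs →
    (∀ {u v} → ¬ Q u → ¬ Q v → u ≡ v) → length xs ≤ suc (length (filter Q? xs))
  filter-drops-one Q? {[]} _ _ = z≤n
  filter-drops-one {Q} Q? {x ∷ xs} (px ∷ u) f with Q? x
  ... | yes q = s≤s (filter-drops-one Q? u f)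
  ... | no ¬q = ≤-reflexive (cong (suc ∘ length) (sym (filter-all Q? {xs} (All.tabulate other))))
    where
    other : ∀ {y} → y ∈ xs → Q y
    other {y} i with Q? y
    ... | yes q = q
    ... | no ¬r = ⊥-elim (All.lookup px i (f ¬q ¬r))

  -- Every token t of B forbids at most one element of N.
  prune : ∀ {T : Set} (C : V → T → Set) (C? : ∀ v t → Dec (C v t)) →
    (B : List T) → (∀ {u v t} → t ∈ B → C u t → C v t → u ≡ v) → (N : List V) → Unique N →
    ∃[ N′ ] Unique N′ × (∀ {p} → p ∈ N′ → p ∈ N) × length N ≤ length B + length N′ ×
            (∀ {p t} → p ∈ N′ → t ∈ B → ¬ C p t)
  prune C C? [] f N u = N , u , id , ≤-refl , λ _ ()
  prune C C? (t ∷ B) f N u with prune C C? B (λ i → f (there i)) N u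
  ... | N₁ , u₁ , s₁ , l₁ , a₁ = filter Q? N₁ , Uniq.filter⁺ Q? u₁ , (λ i → s₁ (proj₁ (∈-filter⁻ Q? {xs = N₁} i)))
      , ≤-trans l₁ (≤-trans (+-monoʳ-≤ (length B) (filter-drops-one Q? u₁ dn)) (≤-reflexive (+-suc (length B) _)))
      , λ { i (here refl) → proj₂ (∈-filter⁻ Q? {xs = N₁} i)
          ; i (there j) → a₁ (proj₁ (∈-filter⁻ Q? {xs = N₁} i)) j }
    where
    Q? = λ p → ¬? (C? p t)
    dn : ∀ {u v} → ¬ ¬ C u t → ¬ ¬ C v t → u ≡ v
    dn {u} {v} a b with C? u t | C? v t
    ... | yes c | yes d = f (here refl) c d
    ... | no c | _ = ⊥-elim (a c)
    ... | yes _ | no d = ⊥-elim (b d)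

module _ {V : Set} (_≟_ : DecidableEquality V) where

  con? : ∀ u v xs → Dec (Con {V} u v xs)
  con? u v [] = no λ ()
  con? u v (x ∷ []) = no λ { (later ()) }
  con? u v (x ∷ y ∷ xs) with u ≟ x | v ≟ y | con? u v (y ∷ xs)
  ... | yes refl | yes refl | _ = yes now
  ... | _ | _ | yes c = yes (later c)
  ... | no ne | _ | no nc = no λ { now → ne refl ; (later c) → nc c }
  ... | yes _ | no ne | no nc = no λ { now → ne refl ; (later c) → nc c }

  head? : ∀ u xs → Dec (Head {V} u xs)
  head? u [] = no λ ()
  head? u (x ∷ xs) with u ≟ x
  ... | yes refl = yes first
  ... | no ne = no λ { first → ne refl }

  lastD? : ∀ u xs → Dec (Last {V} u xs)
  lastD? u [] = no λ ()
  lastD? u (x ∷ []) with u ≟ x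
  ... | yes refl = yes sole
  ... | no ne = no λ { sole → ne refl ; (later ()) }
  lastD? u (x ∷ y ∷ xs) with lastD? u (y ∷ xs)
  ... | yes l = yes (later l)
  ... | no nl = no λ { (later l) → nl l }

  mem? : ∀ (v : V) xs → Dec (v ∈ xs)
  mem? v xs = any? (v ≟_) xs

  pick : (N B : List V) → Unique N → length B < length N → ∃[ v ] v ∈ N × v ∉ B
  pick N B u lt with prune _≡_ _≟_ B (λ { _ refl refl → refl }) N u
  ... | [] , _ , _ , l , _ = ⊥-elim (<⇒≱ lt (≤-trans l (≤-reflexive (+-identityʳ _))))
  ... | v ∷ _ , _ , s , _ , a = v , s (here refl) , λ i → a (here refl) i refl

-- Path systems with joints

module Bag {V : Set} = Algebra.Solver.CommutativeMonoid (++-commutativeMonoid {A = V})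
open Bag using (_⊕_; _⊜_) renaming (solve to bag; id to ∅)

concatMap-↭ : ∀ {A B : Set} (f : A → List B) {xs ys} → xs ↭ ys → concatMap f xs ↭ concatMap f ys
concatMap-↭ f _↭_.refl = ↭-refl
concatMap-↭ f (prep x p) = ++⁺ˡ (f x) (concatMap-↭ f p)
concatMap-↭ f (swap {xs} {ys} x y p) = ↭-trans
  (bag 3 (λ a b c → a ⊕ b ⊕ c ⊜ b ⊕ a ⊕ c) ↭-refl (f x) (f y) (concatMap f xs))
  (++⁺ˡ (f y) (++⁺ˡ (f x) (concatMap-↭ f p)))
concatMap-↭ f (_↭_.trans p q) = ↭-trans (concatMap-↭ f p) (concatMap-↭ f q)

∈-concatMap : ∀ {A B : Set} (f : A → List B) {b} xs → b ∈ concatMap f xs → ∃[ x ] x ∈ xs × b ∈ f x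
∈-concatMap f (x ∷ xs) i with ∈-++⁻ (f x) i
... | inj₁ j = x , here refl , j
... | inj₂ j with ∈-concatMap f xs j
... | y , k , l = y , there k , l

∈-concatMap⁺ : ∀ {A B : Set} (f : A → List B) {b x xs} → x ∈ xs → b ∈ f x → b ∈ concatMap f xs
∈-concatMap⁺ f (here refl) j = ∈-++⁺ˡ j
∈-concatMap⁺ f {xs = y ∷ _} (there i) j = ∈-++⁺ʳ (f y) (∈-concatMap⁺ f i j)

extract : ∀ {A : Set} {x : A} {xs} → x ∈ xs → ∃[ ys ] xs ↭ x ∷ ys
extract i with ∈-∃++ i
... | as , bs , refl = as ++ bs , shift _ as bs

-- A free end G v may be continued arbitrarily; a joint J A has the dominating set A in front of
-- (or behind) the body, and the cycle may enter (leave) A at any of its vertices.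
data Tag (V : Set) : Set where
  G : V → Tag V
  J : List V → Tag V

record Piece (V : Set) : Set where
  constructor piece
  field
    st   : Tag V
    body : List V
    en   : Tag V
open Piece public

-- F₀ enumerates V; L consists of the vertices of the joints, and cx v → cy v is the covering arc of v ∈ L.
-- Vertices outside X can enter every joint, and those outside Y can be reached from every joint.
module Pieces {V : Set} (_≟_ : DecidableEquality V) (R : V → V → Set)
  (F₀ L X Y : List V) (cx cy : V → V) where

  tagList : Tag V → List V
  tagList (G _) = []
  tagList (J xs) = xs

  free : Tag V → List V
  free (G v) = v ∷ []
  free (J _) = []

  full : Piece V → List V
  full (piece s b e) = tagList s ++ b ++ tagList e

  flat : List (Piece V) → List V
  flat = concatMap full

  starts ends : List (Piece V) → List V
  starts = concatMap (free ∘ st)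
  ends   = concatMap (free ∘ en)

  -- A piece with joints on both sides contributes one token. Counting goes through a list so that
  -- `concatMap-↭` makes it independent of the order of the pieces.
  joint₂ : Piece V → List ⊤
  joint₂ (piece (J _) _ (J _)) = tt ∷ []
  joint₂ (piece (J _) _ (G _)) = []
  joint₂ (piece (G _) _ _) = []

  joints₂ : List (Piece V) → ℕ
  joints₂ PS = length (concatMap joint₂ PS)

  StartOK : Tag V → List V → Set
  StartOK (G v) b = Head v b
  StartOK (J A) _ = (∀ {x} → x ∉ X → Any (R x) A) × (∀ {v} → v ∈ A → v ∈ L)

  EndOK : Tag V → List V → Set
  EndOK (G v) b = Last v b
  EndOK (J B) _ = (∀ {x} → x ∉ Y → Any (λ b → R b x) B) × (∀ {v} → v ∈ B → v ∈ L)

  record Ok (P : Piece V) : Set where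
    constructor ok
    field
      is-path    : IsPath R (full P)
      startOK : StartOK (st P) (body P)
      endOK   : EndOK (en P) (body P)

  Covers : List (Piece V) → V → Set
  Covers PS v = Any (λ P → Con (cx v) (cy v) (body P)) PS

  -- `lost` holds what has been taken out of the pieces: the vertex being moved during a cut, later
  -- the joint vertices that the cycle skips. Covering arcs must lie in bodies, because entering or
  -- leaving a joint drops joint vertices only.
  record Inv (PS : List (Piece V)) (lost : List V) : Set where
    constructor inv
    field
      oks  : All Ok PS
      perm : flat PS ++ lost ↭ F₀
      covs : ∀ {v} → v ∈ L → Covers PS v
  open Inv public

  inv-↭ : ∀ {PS PS′ lost} → PS ↭ PS′ → Inv PS lost → Inv PS′ lost
  inv-↭ {lost = lost} p (inv o q c) = inv (All-resp-↭ p o)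
    (↭-trans (++⁺ʳ lost (concatMap-↭ full (↭-sym p))) q) (Any-resp-↭ p ∘ c)

  covers-map : ∀ {P P′ PS v} → (Con (cx v) (cy v) (body P) → Con (cx v) (cy v) (body P′)) →
               Covers (P ∷ PS) v → Covers (P′ ∷ PS) v
  covers-map f (here c) = here (f c)
  covers-map f (there c) = there c

  module _ {s e : Tag V} {PS : List (Piece V)} {lost : List V} (xs : List V) (l p r : V) (ys : List V) where
    private
      b = xs ++ l ∷ p ∷ r ∷ ys

      left right : Piece V
      left = piece s (xs ∷ʳ l) (G l)
      right = piece (G r) (r ∷ ys) e

    -- As `p` is no end of a covering arc, every such arc in the body survives in one of the two
    -- halves.
    inv-split : (∀ {v} → v ∈ L → p ≢ cx v × p ≢ cy v) →
                Inv (piece s b e ∷ PS) lost → Inv (left ∷ right ∷ PS) (p ∷ lost)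
    inv-split np (inv (ok pa so eo ∷ os) q c) =
      inv (ok okl (startl s so) (last-∷ʳ xs) ∷ ok okr first (endr e eo) ∷ os)
        (↭-trans (bag 9 (λ s xs l p r ys e fl lo →
          ((s ⊕ (xs ⊕ l) ⊕ ∅) ⊕ (∅ ⊕ (r ⊕ ys) ⊕ e) ⊕ fl) ⊕ (p ⊕ lo) ⊜
          ((s ⊕ (xs ⊕ l ⊕ p ⊕ r ⊕ ys) ⊕ e) ⊕ fl) ⊕ lo) ↭-refl
          (tagList s) xs [ l ]ₗ [ p ]ₗ [ r ]ₗ ys (tagList e) (flat PS) lost) q)
        λ i → covl (np i) (c i)
      where
      S = tagList s
      okl : IsPath R (S ++ (xs ∷ʳ l) ++ [])
      okl c rewrite ++-identityʳ (xs ∷ʳ l) = pa (subst (Con _ _)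
        (trans (++-assoc S _ _) (cong (S ++_) (trans (++-assoc xs _ _) (sym (++-assoc xs _ _)))))
        (con-++ˡ (p ∷ r ∷ ys ++ tagList e) c))
      okr : IsPath R ((r ∷ ys) ++ tagList e)
      okr c = pa (con-++ʳ S (subst (Con _ _) (sym (++-assoc xs _ _)) (con-++ʳ xs (later (later c)))))
      startl : ∀ s → StartOK s b → StartOK s (xs ∷ʳ l)
      startl (J _) o = o
      startl (G v) o = hd xs o
        where
        hd : ∀ xs → Head v (xs ++ l ∷ p ∷ r ∷ ys) → Head v (xs ∷ʳ l)
        hd [] first = first
        hd (x ∷ xs) first = first
      endr : ∀ e → EndOK e b → EndOK e (r ∷ ys)
      endr (J _) o = o
      endr (G v) o with last-++⁻ xs o
      ... | later (later o′) = o′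
      conb : ∀ {u v} → p ≢ u → p ≢ v → Con u v b → Con u v (xs ∷ʳ l) ⊎ Con u v (r ∷ ys)
      conb nu nv c with con-++⁻ xs c
      ... | inj₁ d = inj₁ (con-++ˡ _ d)
      ... | inj₂ (inj₁ now) = ⊥-elim (nv refl)
      ... | inj₂ (inj₁ (later now)) = ⊥-elim (nu refl)
      ... | inj₂ (inj₁ (later (later d))) = inj₂ d
      ... | inj₂ (inj₂ (la , first)) = inj₁ (con-++ᵐ la first)
      covl : ∀ {v} → p ≢ cx v × p ≢ cy v → Covers (piece s b e ∷ PS) v → Covers (left ∷ right ∷ PS) v
      covl (n₁ , n₂) (there c) = there (there c)
      covl (n₁ , n₂) (here c) with conb n₁ n₂ c
      ... | inj₁ d = here d
      ... | inj₂ d = there (here d)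

  inv-append : ∀ {s b w p PS lost} → R w p → Inv (piece s b (G w) ∷ PS) (p ∷ lost) →
               Inv (piece s (b ∷ʳ p) (G p) ∷ PS) lost
  inv-append {s} {b} {w} {p} {PS} {lost} rwp (inv (ok pa so eo ∷ os) q c) =
    inv (ok pa′ (start s so) (last-∷ʳ b) ∷ os)
      (↭-trans (bag 5 (λ s b p fl lo → ((s ⊕ (b ⊕ p) ⊕ ∅) ⊕ fl) ⊕ lo ⊜ ((s ⊕ b ⊕ ∅) ⊕ fl) ⊕ p ⊕ lo) ↭-refl
         (tagList s) b [ p ]ₗ (flat PS) lost) q)
      λ i → covers-map (con-++ˡ _) (c i)
    where
    pa′ : IsPath R (tagList s ++ (b ∷ʳ p) ++ [])
    pa′ rewrite ++-identityʳ (b ∷ʳ p) | ++-identityʳ b = λ c → path-++ (tagList s ++ b) pa (λ { (later ()) })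
        (λ { {u} la first → subst (λ z → R z p) (last-unique (last-++ (tagList s) eo) la) rwp })
        (subst (Con _ _) (sym (++-assoc (tagList s) b (p ∷ []))) c)
    start : ∀ s → StartOK s b → StartOK s (b ∷ʳ p)
    start (G v) o = head-++ _ o
    start (J _) o = o

  inv-prepend : ∀ {u b e p PS lost} → R p u → Inv (piece (G u) b e ∷ PS) (p ∷ lost) →
                Inv (piece (G p) (p ∷ b) e ∷ PS) lost
  inv-prepend {u} {b} {e} {p} {PS} {lost} rpu (inv (ok pa so eo ∷ os) q c) =
    inv (ok pa′ first (end e eo) ∷ os)
      (↭-trans (bag 5 (λ e b p fl lo → (((p ⊕ b) ⊕ e) ⊕ fl) ⊕ lo ⊜ ((b ⊕ e) ⊕ fl) ⊕ p ⊕ lo) ↭-refl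
         (tagList e) b [ p ]ₗ (flat PS) lost) q)
      λ i → covers-map later (c i)
    where
    pa′ : IsPath R (p ∷ b ++ tagList e)
    pa′ c with head-cons so
    pa′ now | _ , refl = rpu
    pa′ (later c) | _ = pa c
    end : ∀ e → EndOK e b → EndOK e (p ∷ b)
    end (G v) o = later o
    end (J _) o = o

  con-flat : ∀ {PS P u v} → P ∈ PS → Con u v (full P) → Con u v (flat PS)
  con-flat (here refl) c = con-++ˡ _ c
  con-flat {Q ∷ _} (there i) c = con-++ʳ (full Q) (con-flat i c)

  con-body : ∀ {u v} P → Con u v (body P) → Con u v (full P)
  con-body (piece s b e) c = con-++ʳ (tagList s) (con-++ˡ _ c)

  head-unique : ∀ {u v} {xs : List V} → Head u xs → Head v xs → u ≡ v
  head-unique first first = refl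

  tag⊆L : ∀ {PS lost P} → Inv PS lost → P ∈ PS → ∀ {v} → v ∈ full P → v ∈ L ⊎ v ∈ body P
  tag⊆L {P = piece s b e} I i {v} j with All.lookup (oks I) i | ∈-++⁻ (tagList s) j
  ... | ok _ so _ | inj₁ k = inj₁ (t s k so)
    where
    t : ∀ s → v ∈ tagList s → StartOK s b → v ∈ L
    t (J A) k (_ , o) = o k
  ... | ok _ _ eo | inj₂ k with ∈-++⁻ b k
  ... | inj₁ m = inj₂ m
  ... | inj₂ m = inj₁ (t e m eo)
    where
    t : ∀ s → v ∈ tagList s → EndOK s b → v ∈ L
    t (J A) k (_ , o) = o k

  -- Once `p` is taken out, `l` is a new end and `r` a new start; this is why `l` avoids the set
  -- `X′` meant for ends and `r` the set `Y′` meant for starts.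
  record Cut (PS : List (Piece V)) (Z X′ Y′ N : List V) : Set where
    constructor cut
    field
      {s e}   : Tag V
      xs      : List V
      l p r   : V
      ys      : List V
      rest    : List (Piece V)
      perm′   : PS ↭ piece s (xs ++ l ∷ p ∷ r ∷ ys) e ∷ rest
      p∈      : p ∈ N
      p∉      : p ∉ Z
      l∉      : l ∉ X′
      r∉      : r ∉ Y′

  module _ (F-unique : Unique F₀) (F-all : ∀ v → v ∈ F₀) where

    flat-unique : ∀ {PS lost} → Inv PS lost → Unique (flat PS)
    flat-unique {PS} I = unique-++ˡ (flat PS) (Unique-↭ (↭-sym (perm I)) F-unique)

    flat-all : ∀ {PS} → Inv PS [] → ∀ v → v ∈ flat PS
    flat-all {PS} I v = subst (v ∈_) (++-identityʳ (flat PS)) (∈-resp-↭ (↭-sym (perm I)) (F-all v))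

    -- Five prunings of `N`: each element of `Z`, each element of `X′` as predecessor, each element
    -- of `Y′` as successor, and each piece twice, through the first and last element of its body,
    -- rules out at most one `p`. Since `Z` contains all joint vertices, a survivor lies strictly
    -- inside a body.
    choose : ∀ {PS} → Inv PS [] → (Z X′ Y′ N : List V) → (∀ {v} → v ∈ L → v ∈ Z) → Unique N →
             length Z + (length X′ + (length Y′ + (length PS + length PS))) < length N → Cut PS Z X′ Y′ N
    choose {PS} I Z X′ Y′ N L⊆Z uN lt
      with prune _≡_ _≟_ Z (λ { _ refl refl → refl }) N uN
    ... | N₁ , u₁ , s₁ , l₁ , a₁
      -- Adjacency is taken in the concatenation of all pieces, where neighbours are unique; the
      -- accidental pairs at the seams do no harm.
      with prune (λ p t → Con t p (flat PS)) (λ p t → con? _≟_ t p (flat PS)) X′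
             (λ {u} {v} {t} _ c d → con-succ-unique (flat PS) {t} (flat-unique I) (con-++ˡ _ c) (con-++ˡ _ d)) N₁ u₁
    ... | N₂ , u₂ , s₂ , l₂ , a₂
      with prune (λ p t → Con p t (flat PS)) (λ p t → con? _≟_ p t (flat PS)) Y′
             (λ {u} {v} {t} _ c d → con-pred-unique {z = t} (flat PS) (flat-unique I) (later c) (later d)) N₂ u₂
    ... | N₃ , u₃ , s₃ , l₃ , a₃
      with prune (λ p P → Head p (body P)) (λ p P → head? _≟_ p (body P)) PS
             (λ _ → head-unique) N₃ u₃
    ... | N₄ , u₄ , s₄ , l₄ , a₄
      with prune (λ p P → Last p (body P)) (λ p P → lastD? _≟_ p (body P)) PS
             (λ _ → last-unique) N₄ u₄
    ... | [] , u₅ , s₅ , l₅ , a₅ = ⊥-elim (<⇒≱ lt (≤-trans l₁ (+-monoʳ-≤ (length Z)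
            (≤-trans l₂ (+-monoʳ-≤ (length X′) (≤-trans l₃ (+-monoʳ-≤ (length Y′)
              (≤-trans l₄ (+-monoʳ-≤ (length PS) (≤-trans l₅ (≤-reflexive (+-identityʳ _))))))))))))
    ... | p ∷ _ , u₅ , s₅ , l₅ , a₅ = result
      where
      p∉Z : p ∉ Z
      p∉Z i = a₁ (s₂ (s₃ (s₄ (s₅ (here refl))))) i refl
      result : Cut PS Z X′ Y′ N
      result with ∈-concatMap full PS (flat-all I p)
      ... | P@(piece s b e) , P∈ , p∈P with tag⊆L I P∈ p∈P
      ... | inj₁ j = ⊥-elim (p∉Z (L⊆Z j))
      ... | inj₂ j with ∈-∃++ j | extract P∈
      ... | [] , _ , refl | _ = ⊥-elim (a₄ (s₅ (here refl)) P∈ first)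
      ... | x ∷ xs , [] , refl | _ = ⊥-elim (a₅ (here refl) P∈ (last-∷ʳ (x ∷ xs)))
      ... | x ∷ xs , r ∷ ys , refl | rest , pm with last-snoc (proj₂ (last? x xs))
      ... | xs′ , eq = cut xs′ l p r ys rest (subst (λ z → PS ↭ piece s z e ∷ rest) eq′ pm)
              (s₁ (s₂ (s₃ (s₄ (s₅ (here refl)))))) p∉Z
              (λ i → a₂ (s₃ (s₄ (s₅ (here refl)))) i (con-flat P∈ (con-body P (subst (Con l p) (sym eq′) (con-++ʳ xs′ now)))))
              (λ i → a₃ (s₄ (s₅ (here refl))) i (con-flat P∈ (con-body P (con-++ʳ (x ∷ xs) now))))
        where
        l = proj₁ (last? x xs)
        eq′ : (x ∷ xs) ++ p ∷ r ∷ ys ≡ xs′ ++ l ∷ p ∷ r ∷ ys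
        eq′ = trans (cong (_++ p ∷ r ∷ ys) eq) (++-assoc xs′ _ _)

    record Split (PS : List (Piece V)) (Z X′ Y′ N : List V) : Set where
      constructor splitted
      field
        {p l r}  : V
        PS′      : List (Piece V)
        inv′     : Inv PS′ (p ∷ [])
        ends-↭   : ends PS′ ↭ l ∷ ends PS
        starts-↭ : starts PS′ ↭ r ∷ starts PS
        length-≡ : length PS′ ≡ suc (length PS)
        joints-≤ : joints₂ PS ≤ suc (joints₂ PS′)
        p∈       : p ∈ N
        p∉       : p ∉ Z
        l∉       : l ∉ X′
        r∉       : r ∉ Y′

    split : ∀ {PS Z X′ Y′ N} → (∀ {v} → v ∈ L → cx v ∈ Z × cy v ∈ Z) → Inv PS [] → Cut PS Z X′ Y′ N →
            Split PS Z X′ Y′ N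
    split {PS} {Z} cov I (cut {s} {e} xs l p r ys rest pm p∈ p∉ l∉ r∉) =
      splitted (piece s (xs ∷ʳ l) (G l) ∷ piece (G r) (r ∷ ys) e ∷ rest)
        (inv-split xs l p r ys (λ i → ne (proj₁ (cov i)) , ne (proj₂ (cov i))) (inv-↭ pm I))
        (prep l (concatMap-↭ (free ∘ en) (↭-sym pm)))
        (↭-trans (shift r (free s) (starts rest)) (prep r (concatMap-↭ (free ∘ st) (↭-sym pm))))
        (sym (cong suc (↭-length pm)))
        (≤-trans (≤-reflexive (↭-length (concatMap-↭ joint₂ pm))) (jl s e))
        p∈ p∉ l∉ r∉
      where
      ne : ∀ {v} → v ∈ Z → p ≢ v
      ne i refl = p∉ i
      jl : ∀ s e → joints₂ (piece s (xs ++ l ∷ p ∷ r ∷ ys) e ∷ rest) ≤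
                   suc (joints₂ (piece s (xs ∷ʳ l) (G l) ∷ piece (G r) (r ∷ ys) e ∷ rest))
      jl (J _) (J _) = ≤-refl
      jl (J _) (G _) = n≤1+n _
      jl (G _) _ = n≤1+n _

    record Grown (PS : List (Piece V)) (e s : List V) : Set where
      constructor grown
      field
        PS′      : List (Piece V)
        inv′     : Inv PS′ []
        ends-↭   : ends PS′ ↭ e
        starts-↭ : starts PS′ ↭ s
        length-≡ : length PS′ ≡ suc (length PS)
        joints-≤ : joints₂ PS ≤ suc (joints₂ PS′)

    joints-en : ∀ {s b b′ v w} PS → joints₂ (piece s b (G v) ∷ PS) ≡ joints₂ (piece s b′ (G w) ∷ PS)
    joints-en {G _} PS = refl
    joints-en {J _} PS = refl

    -- The end `w` is covered up by `p`, and the cut leaves `l` as a second new end, so one end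
    -- becomes two. `X′` also stands in the place of `Z` because `p` itself becomes an end.
    end-step : ∀ {PS X′ Y′ N w es} → (∀ {v} → v ∈ L → cx v ∈ X′ × cy v ∈ X′) → Inv PS [] →
               Cut PS X′ X′ Y′ N → (∀ {p} → p ∈ N → R w p) → ends PS ↭ w ∷ es →
               ∃[ p ] ∃[ l ] ∃[ r ] Grown PS (p ∷ l ∷ es) (r ∷ starts PS) × p ∉ X′ × l ∉ X′ × r ∉ Y′
    end-step {PS} {w = w} {es} cov I c arcs pm
      with split cov I c
    ... | splitted {p} {l} {r} PS₁ I₁ e₁ s₁ len j₁ p∈ p∉ l∉ r∉
      with ∈-concatMap (free ∘ en) PS₁ (∈-resp-↭ (↭-sym (↭-trans e₁ (prep l pm))) (there (here refl)))
    ... | piece s b (G .w) , Q∈ , here refl with extract Q∈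
    ... | QS , qm = p , l , r , grown (piece s (b ∷ʳ p) (G p) ∷ QS)
            (inv-append (arcs p∈) (inv-↭ qm I₁))
            (prep p (drop-∷ (↭-trans (concatMap-↭ (free ∘ en) (↭-sym qm))
                      (↭-trans e₁ (↭-trans (prep l pm) (swap l w ↭-refl))))))
            (↭-trans (concatMap-↭ (free ∘ st) (↭-sym qm)) s₁)
            (trans (sym (↭-length qm)) len)
            (≤-trans j₁ (s≤s (≤-reflexive (trans (↭-length (concatMap-↭ joint₂ qm)) (joints-en {s} {b} {b ∷ʳ p} QS)))))
          , p∉ , l∉ , r∉

    start-step : ∀ {PS X′ Y′ N u ss} → (∀ {v} → v ∈ L → cx v ∈ Y′ × cy v ∈ Y′) → Inv PS [] →
               Cut PS Y′ X′ Y′ N → (∀ {p} → p ∈ N → R p u) → starts PS ↭ u ∷ ss →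
               ∃[ p ] ∃[ l ] ∃[ r ] Grown PS (l ∷ ends PS) (p ∷ r ∷ ss) × p ∉ Y′ × l ∉ X′ × r ∉ Y′
    start-step {PS} {u = u} {ss} cov I c arcs pm
      with split cov I c
    ... | splitted {p} {l} {r} PS₁ I₁ e₁ s₁ len j₁ p∈ p∉ l∉ r∉
      with ∈-concatMap (free ∘ st) PS₁ (∈-resp-↭ (↭-sym (↭-trans s₁ (prep r pm))) (there (here refl)))
    ... | piece (G .u) b e , Q∈ , here refl with extract Q∈
    ... | QS , qm = p , l , r , grown (piece (G p) (p ∷ b) e ∷ QS)
            (inv-prepend (arcs p∈) (inv-↭ qm I₁))
            (↭-trans (concatMap-↭ (free ∘ en) (↭-sym qm)) e₁)
            (prep p (drop-∷ (↭-trans (concatMap-↭ (free ∘ st) (↭-sym qm))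
                      (↭-trans s₁ (↭-trans (prep r pm) (swap r u ↭-refl))))))
            (trans (sym (↭-length qm)) len)
            (≤-trans j₁ (s≤s (≤-reflexive (↭-length (concatMap-↭ joint₂ qm)))))
          , p∉ , l∉ , r∉

    record Stage (PS : List (Piece V)) (X′ Y′ e s : List V) (a b t : ℕ) : Set where
      constructor stage
      field
        PS′       : List (Piece V)
        inv′      : Inv PS′ []
        es ss     : List V
        ends-↭    : ends PS′ ↭ es ++ e
        starts-↭  : starts PS′ ↭ ss ++ s
        es∉       : All (_∉ X′) es
        ss∉       : All (_∉ Y′) ss
        es-length : length es ≡ a
        ss-length : length ss ≡ b
        length-≡  : length PS′ ≡ t + length PS
        joints-≤  : joints₂ PS ≤ t + joints₂ PS′

    private
      K-bound : ∀ {t q K} → suc (t + q) ≤ K → ∀ x y z → x + (y + (z + (q + q))) ≤ x + (y + (z + (K + K)))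
      K-bound {t} {q} le x y z = +-monoʳ-≤ x (+-monoʳ-≤ y (+-monoʳ-≤ z (+-mono-≤ q≤K q≤K)))
        where q≤K = ≤-trans (m≤n+m q (suc t)) le

    end-stage : ∀ {X′ Y′ K} (N : V → List V) → (∀ w → Unique (N w)) → (∀ {w p} → p ∈ N w → R w p) →
      (∀ {v} → v ∈ L → v ∈ X′ × cx v ∈ X′ × cy v ∈ X′) →
      ∀ todo {PS done} → Inv PS [] → ends PS ↭ todo ++ done → length todo + length PS ≤ K →
      (∀ {w} → w ∈ todo → length X′ + (length X′ + (length Y′ + (K + K))) < length (N w)) →
      Stage PS X′ Y′ done (starts PS) (length todo + length todo) (length todo) (length todo)
    end-stage N uN aN cov [] {PS} I pm _ _ = stage PS I [] [] pm ↭-refl [] [] refl refl refl ≤-refl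
    end-stage {X′} {Y′} {K} N uN aN cov (w ∷ todo) {PS} {done} I pm bound deg
      with choose I X′ X′ Y′ (N w) (proj₁ ∘ cov) (uN w)
             (≤-trans (s≤s (K-bound {length todo} {length PS} bound (length X′) (length X′) (length Y′))) (deg (here refl)))
    ... | c with end-step (proj₂ ∘ cov) I c aN pm
    ... | p , l , r , grown PS₁ I₁ e₁ s₁ len₁ j₁ , p∉ , l∉ , r∉
      with end-stage {K = K} N uN aN cov todo {PS₁} {p ∷ l ∷ done} I₁
             (↭-trans e₁ (bag 4 (λ p l t d → p ⊕ l ⊕ t ⊕ d ⊜ t ⊕ p ⊕ l ⊕ d) ↭-refl [ p ]ₗ [ l ]ₗ todo done))
             (≤-trans (≤-reflexive (trans (cong (length todo +_) len₁) (+-suc (length todo) (length PS)))) bound)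
             (deg ∘ there)
    ... | stage PS₂ I₂ es ss e₂ s₂ es∉ ss∉ el sl len₂ j₂ =
      stage PS₂ I₂ (p ∷ l ∷ es) (r ∷ ss)
        (↭-trans e₂ (bag 4 (λ p l t d → t ⊕ p ⊕ l ⊕ d ⊜ p ⊕ l ⊕ t ⊕ d) ↭-refl [ p ]ₗ [ l ]ₗ es done))
        (↭-trans s₂ (↭-trans (++⁺ˡ ss s₁) (bag 3 (λ a b c → a ⊕ b ⊕ c ⊜ b ⊕ a ⊕ c) ↭-refl ss [ r ]ₗ (starts PS))))
        (p∉ ∷ l∉ ∷ es∉) (r∉ ∷ ss∉)
        (cong suc (trans (cong suc el) (sym (+-suc (length todo) (length todo))))) (cong suc sl)
        (trans len₂ (trans (cong (length todo +_) len₁) (+-suc (length todo) _)))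
        (≤-trans j₁ (s≤s j₂))

    start-stage : ∀ {X′ Y′ K} (N : V → List V) → (∀ w → Unique (N w)) → (∀ {w p} → p ∈ N w → R p w) →
      (∀ {v} → v ∈ L → v ∈ Y′ × cx v ∈ Y′ × cy v ∈ Y′) →
      ∀ todo {PS done} → Inv PS [] → starts PS ↭ todo ++ done → length todo + length PS ≤ K →
      (∀ {w} → w ∈ todo → length Y′ + (length X′ + (length Y′ + (K + K))) < length (N w)) →
      Stage PS X′ Y′ (ends PS) done (length todo) (length todo + length todo) (length todo)
    start-stage N uN aN cov [] {PS} I pm _ _ = stage PS I [] [] ↭-refl pm [] [] refl refl refl ≤-refl
    start-stage {X′} {Y′} {K} N uN aN cov (w ∷ todo) {PS} {done} I pm bound deg
      with choose I Y′ X′ Y′ (N w) (proj₁ ∘ cov) (uN w)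
             (≤-trans (s≤s (K-bound {length todo} {length PS} bound (length Y′) (length X′) (length Y′))) (deg (here refl)))
    ... | c with start-step (proj₂ ∘ cov) I c aN pm
    ... | p , l , r , grown PS₁ I₁ e₁ s₁ len₁ j₁ , p∉ , l∉ , r∉
      with start-stage {K = K} N uN aN cov todo {PS₁} {p ∷ r ∷ done} I₁
             (↭-trans s₁ (bag 4 (λ p l t d → p ⊕ l ⊕ t ⊕ d ⊜ t ⊕ p ⊕ l ⊕ d) ↭-refl [ p ]ₗ [ r ]ₗ todo done))
             (≤-trans (≤-reflexive (trans (cong (length todo +_) len₁) (+-suc (length todo) (length PS)))) bound)
             (deg ∘ there)
    ... | stage PS₂ I₂ es ss e₂ s₂ es∉ ss∉ el sl len₂ j₂ =
      stage PS₂ I₂ (l ∷ es) (p ∷ r ∷ ss)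
        (↭-trans e₂ (↭-trans (++⁺ˡ es e₁) (bag 3 (λ a b c → a ⊕ b ⊕ c ⊜ b ⊕ a ⊕ c) ↭-refl es [ l ]ₗ (ends PS))))
        (↭-trans s₂ (bag 4 (λ p l t d → t ⊕ p ⊕ l ⊕ d ⊜ p ⊕ l ⊕ t ⊕ d) ↭-refl [ p ]ₗ [ r ]ₗ ss done))
        (l∉ ∷ es∉) (p∉ ∷ r∉ ∷ ss∉)
        (cong suc el) (cong suc (trans (cong suc sl) (sym (+-suc (length todo) (length todo)))))
        (trans len₂ (trans (cong (length todo +_) len₁) (+-suc (length todo) _)))
        (≤-trans j₁ (s≤s j₂))

  -- From `x` the path jumps to some `a` in `A` and follows `A` from there on; the part `α` before
  -- `a` is skipped and becomes lost.
  inv-enter : ∀ {s b₁ x A b₂ e PS lost} → x ∉ X → Inv (piece s b₁ (G x) ∷ piece (J A) b₂ e ∷ PS) lost →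
              ∃[ b ] ∃[ α ] Inv (piece s b e ∷ PS) (α ++ lost) × All (_∈ L) α
  inv-enter {s} {b₁} {x} {A} {b₂} {e} {PS} {lost} x∉ (inv (ok p₁ s₁ e₁ ∷ ok p₂ (dom , A⊆) e₂ ∷ os) q c)
    with find (dom x∉)
  ... | a , a∈ , xa with ∈-∃++ a∈
  ... | α , β , refl = b , α , inv (ok is-path (start s s₁) (end e e₂) ∷ os)
      (↭-trans (bag 9 (λ s b₁ a β b₂ e α fl lo → ((s ⊕ (b₁ ⊕ (a ⊕ β) ⊕ b₂) ⊕ e) ⊕ fl) ⊕ α ⊕ lo ⊜
          ((s ⊕ b₁ ⊕ ∅) ⊕ ((α ⊕ a ⊕ β) ⊕ b₂ ⊕ e) ⊕ fl) ⊕ lo) ↭-refl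
          (tagList s) b₁ [ a ]ₗ β b₂ (tagList e) α (flat PS) lost) q)
      (cov ∘ c) , All.tabulate (λ i → A⊆ (∈-++⁺ˡ i))
    where
    b = b₁ ++ (a ∷ β) ++ b₂
    S = tagList s
    start : ∀ s → StartOK s b₁ → StartOK s b
    start (G v) o = head-++ _ o
    start (J _) o = o
    end : ∀ e → EndOK e b₂ → EndOK e b
    end (G v) o = last-++ b₁ (last-++ (a ∷ β) o)
    end (J _) o = o
    is-path : IsPath R (S ++ b ++ tagList e)
    is-path c = path-++ (S ++ b₁) (subst (λ z → IsPath R (S ++ z)) (++-identityʳ b₁) p₁)
               (λ {u} {v} d → p₂ (subst (Con u v) (sym (++-assoc α _ _)) (con-++ʳ α d)))
               (λ { {u} la first → subst (λ z → R z a) (last-unique (last-++ S e₁) la) xa })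
               (subst (Con _ _) eq c)
      where
      eq : S ++ b ++ tagList e ≡ (S ++ b₁) ++ (a ∷ β) ++ b₂ ++ tagList e
      eq = trans (cong (S ++_) (trans (++-assoc b₁ _ _) (cong (b₁ ++_) (++-assoc (a ∷ β) _ _)))) (sym (++-assoc S _ _))
    cov : ∀ {v} → Covers (piece s b₁ (G x) ∷ piece (J A) b₂ e ∷ PS) v → Covers (piece s b e ∷ PS) v
    cov (here c) = here (con-++ˡ _ c)
    cov (there (here c)) = here (con-++ʳ b₁ (con-++ʳ (a ∷ β) c))
    cov (there (there c)) = there c

  inv-leave : ∀ {s b₁ B u b₂ e PS lost} → u ∉ Y → Inv (piece s b₁ (J B) ∷ piece (G u) b₂ e ∷ PS) lost →
              ∃[ b ] ∃[ γ ] Inv (piece s b e ∷ PS) (γ ++ lost) × All (_∈ L) γ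
  inv-leave {s} {b₁} {B} {u} {b₂} {e} {PS} {lost} u∉ (inv (ok p₁ s₁ (dom , B⊆) ∷ ok p₂ s₂ e₂ ∷ os) q c)
    with find (dom u∉)
  ... | a , a∈ , au with ∈-∃++ a∈
  ... | β , γ , refl = b , γ , inv (ok is-path (start s s₁) (end e e₂) ∷ os)
      (↭-trans (bag 9 (λ s b₁ β a b₂ e γ fl lo → ((s ⊕ (b₁ ⊕ (β ⊕ a) ⊕ b₂) ⊕ e) ⊕ fl) ⊕ γ ⊕ lo ⊜
          ((s ⊕ b₁ ⊕ (β ⊕ a ⊕ γ)) ⊕ (b₂ ⊕ e) ⊕ fl) ⊕ lo) ↭-refl
          (tagList s) b₁ β [ a ]ₗ b₂ (tagList e) γ (flat PS) lost) q)
      (cov ∘ c) , All.tabulate (λ i → B⊆ (∈-++⁺ʳ β (there i)))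
    where
    b = b₁ ++ (β ∷ʳ a) ++ b₂
    S = tagList s
    start : ∀ s → StartOK s b₁ → StartOK s b
    start (G v) o = head-++ _ o
    start (J _) o = o
    end : ∀ e → EndOK e b₂ → EndOK e b
    end (G v) o = last-++ b₁ (last-++ (β ∷ʳ a) o)
    end (J _) o = o
    is-path : IsPath R (S ++ b ++ tagList e)
    is-path c = path-++ (S ++ b₁ ++ β ∷ʳ a)
               (λ {u} {v} d → p₁ (subst (Con u v) eq₁ (con-++ˡ γ d)))
               p₂
               (λ { la h → edge (last-∷ʳ⁻ (S ++ b₁ ++ β) (subst (Last _) eq₂ la)) (head-unique h (head-++ (tagList e) s₂)) })
               (subst (Con _ _) eq c)
      where
      edge : ∀ {v w} → v ≡ a → w ≡ u → R v w
      edge refl refl = au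
      eq₁ : (S ++ b₁ ++ β ∷ʳ a) ++ γ ≡ S ++ b₁ ++ β ++ a ∷ γ
      eq₁ = trans (++-assoc S _ _) (cong (S ++_) (trans (++-assoc b₁ _ _) (cong (b₁ ++_) (++-assoc β _ _))))
      eq₂ : S ++ b₁ ++ β ∷ʳ a ≡ (S ++ b₁ ++ β) ∷ʳ a
      eq₂ = sym (trans (++-assoc S _ _) (cong (S ++_) (++-assoc b₁ _ _)))
      eq : S ++ b ++ tagList e ≡ (S ++ b₁ ++ β ∷ʳ a) ++ b₂ ++ tagList e
      eq = trans (cong (S ++_) (trans (++-assoc b₁ _ _) (trans (cong (b₁ ++_) (++-assoc (β ∷ʳ a) _ _)) (sym (++-assoc b₁ _ _))))) (sym (++-assoc S _ _))
    cov : ∀ {v} → Covers (piece s b₁ (J B) ∷ piece (G u) b₂ e ∷ PS) v → Covers (piece s b e ∷ PS) v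
    cov (here c) = here (con-++ˡ _ c)
    cov (there (here c)) = here (con-++ʳ b₁ (con-++ʳ (β ∷ʳ a) c))
    cov (there (there c)) = there c

  record CyclePlus (lost : List V) : Set where
    constructor cyclePlus
    field
      z    : V
      zs   : List V
      perm : (z ∷ zs) ++ lost ↭ F₀
      is-path : IsPath R (z ∷ zs ∷ʳ z)
      covs : ∀ {v} → v ∈ L → Con (cx v) (cy v) (z ∷ zs)

  inv-close : ∀ {A b x lost} → x ∉ X → Inv (piece (J A) b (G x) ∷ []) lost →
              ∃[ α ] CyclePlus (α ++ lost) × All (_∈ L) α
  inv-close {A} {b} {x} {lost} x∉ (inv (ok p (dom , A⊆) e ∷ []) q c)
    with find (dom x∉)
  ... | a , a∈ , xa with ∈-∃++ a∈
  ... | α , β , refl = α , cyclePlus a (β ++ b)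
      (↭-trans (bag 5 (λ a β b α lo → (a ⊕ β ⊕ b) ⊕ α ⊕ lo ⊜
          (((α ⊕ a ⊕ β) ⊕ b ⊕ ∅) ⊕ ∅) ⊕ lo) ↭-refl [ a ]ₗ β b α lost) q)
      (path-++ (a ∷ β ++ b) (λ {u} {v} d → p (subst (Con u v) eq (con-++ʳ α d))) (λ { (later ()) })
        (λ { {u} la first → subst (λ z → R z a) (last-unique (last-++ (a ∷ β) e) la) xa }))
      (cov ∘ c) , All.tabulate (λ i → A⊆ (∈-++⁺ˡ i))
    where
    eq : α ++ a ∷ β ++ b ≡ (α ++ a ∷ β) ++ b ++ []
    eq = trans (sym (++-assoc α _ _)) (cong ((α ++ a ∷ β) ++_) (sym (++-identityʳ b)))
    cov : ∀ {v} → Covers (piece (J _) b (G x) ∷ []) v → Con (cx v) (cy v) (a ∷ β ++ b)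
    cov (here c) = con-++ʳ (a ∷ β) c

  -- Placing `v` between `x` and `y` destroys only the pair that starts at `x`, hence the condition
  -- `u ≢ x`. The tail `t` carries along the repeated vertex that closes a cycle.
  con-insert : ∀ {x y z : V} {zs} (v : V) → Con x y (z ∷ zs) → ∃[ zs′ ] v ∷ z ∷ zs ↭ z ∷ zs′ ×
    (∀ {u w : V} t → Con u w (z ∷ zs′ ++ t) → Con u w (z ∷ zs ++ t) ⊎ (u ≡ x × w ≡ v) ⊎ (u ≡ v × w ≡ y)) ×
    (∀ {u w : V} → u ≢ x → Con u w (z ∷ zs) → Con u w (z ∷ zs′))
  con-insert {x} {y} v (now {r}) = v ∷ y ∷ r , swap v x ↭-refl ,
    (λ { t now → inj₂ (inj₁ (refl , refl)) ; t (later now) → inj₂ (inj₂ (refl , refl)) ; t (later (later c)) → inj₁ (later c) }) ,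
    (λ { ne now → ⊥-elim (ne refl) ; ne (later c) → later (later c) })
  con-insert {z = z} {z₁ ∷ zs} v (later c) with con-insert v c
  ... | zs′ , p , f , g = z₁ ∷ zs′ , ↭-trans (swap v z ↭-refl) (prep z p) ,
    (λ { t now → inj₁ now ; t (later c) → lift (f t c) }) ,
    (λ { ne now → now ; ne (later c) → later (g ne c) })
    where
    lift : ∀ {u w t P} → Con u w (z₁ ∷ zs ++ t) ⊎ P → Con u w (z ∷ z₁ ∷ zs ++ t) ⊎ P
    lift (inj₁ c) = inj₁ (later c)
    lift (inj₂ p) = inj₂ p

  -- Distinct skipped vertices have covering arcs with distinct sources, so putting one back breaks
  -- no covering arc that is still needed.
  insert-lost : (∀ {v} → v ∈ L → R (cx v) v × R v (cy v)) → (∀ {u v} → u ∈ L → v ∈ L → cx u ≡ cx v → u ≡ v) →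
    ∀ lost → All (_∈ L) lost → Unique lost → ∀ {z zs} → (z ∷ zs) ++ lost ↭ F₀ → IsPath R (z ∷ zs ∷ʳ z) →
    (∀ {v} → v ∈ lost → Con (cx v) (cy v) (z ∷ zs)) → ∃[ ys ] z ∷ ys ↭ F₀ × IsPath R (z ∷ ys ∷ʳ z)
  insert-lost tri inj [] _ _ {z} {zs} q p c = zs , subst (_↭ F₀) (++-identityʳ (z ∷ zs)) q , p
  insert-lost tri inj (v ∷ lost) (v∈ ∷ l∈) (v≢ ∷ u) {z} {zs} q p c with con-insert v (c (here refl))
  ... | zs′ , q′ , f , g = insert-lost tri inj lost l∈ u
      (↭-trans (++⁺ʳ lost (↭-sym q′)) (↭-trans (↭-sym (shift v (z ∷ zs) lost)) q))
      (λ d → R-arc (f (z ∷ []) d))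
      (λ {w} i → g (λ e → All.lookup v≢ i (sym (inj (All.lookup l∈ i) v∈ e))) (c (there i)))
    where
    R-arc : ∀ {u w} → Con u w (z ∷ zs ∷ʳ z) ⊎ (u ≡ cx v × w ≡ v) ⊎ (u ≡ v × w ≡ cy v) → R u w
    R-arc (inj₁ d) = p d
    R-arc (inj₂ (inj₁ (refl , refl))) = proj₁ (tri v∈)
    R-arc (inj₂ (inj₂ (refl , refl))) = proj₂ (tri v∈)

-- Joining the pieces to one cycle

module Assembly {V : Set} (_≟_ : DecidableEquality V) (R : V → V → Set)
  (F₀ L X Y : List V) (cx cy : V → V) where

  open Pieces _≟_ R F₀ L X Y cx cy

  jj : List V × List V × List V → Piece V
  jj (A , b , B) = piece (J A) b (J B)

  jg : List V × List V × Σ V (_∉ X) → Piece V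
  jg (A , b , x , _) = piece (J A) b (G x)

  gj : Σ V (_∉ Y) × List V × List V → Piece V
  gj ((u , _) , b , B) = piece (G u) b (J B)

  gg : Σ V (_∉ Y) × List V × Σ V (_∉ X) → Piece V
  gg ((u , _) , b , x , _) = piece (G u) b (G x)

  record Sorted (PS : List (Piece V)) : Set where
    constructor sorted
    field
      jjs : List (List V × List V × List V)
      jgs : List (List V × List V × Σ V (_∉ X))
      gjs : List (Σ V (_∉ Y) × List V × List V)
      ggs : List (Σ V (_∉ Y) × List V × Σ V (_∉ X))
      perm     : PS ↭ map jj jjs ++ map jg jgs ++ map gj gjs ++ map gg ggs
      pieces-≡ : length PS ≡ (length jjs + length jgs) + (length gjs + length ggs)
      starts-≡ : length (starts PS) ≡ length gjs + length ggs
      ends-≡   : length (ends PS) ≡ length jgs + length ggs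
      joints-≡ : joints₂ PS ≡ length jjs

  sort : ∀ PS → All (_∉ Y) (starts PS) → All (_∉ X) (ends PS) → Sorted PS
  sort [] _ _ = sorted [] [] [] [] ↭-refl refl refl refl refl
  sort (piece (J A) b (J B) ∷ PS) s e with sort PS s e
  ... | sorted a₁ a₂ a₃ a₄ p n ns ne nj =
    sorted ((A , b , B) ∷ a₁) a₂ a₃ a₄ (prep _ p) (cong suc n) ns ne (cong suc nj)
  sort (piece (J A) b (G x) ∷ PS) s (x∉ ∷ e) with sort PS s e
  ... | sorted a₁ a₂ a₃ a₄ p n ns ne nj =
    sorted a₁ ((A , b , x , x∉) ∷ a₂) a₃ a₄
      (↭-trans (prep _ p) (↭-sym (shift _ (map jj a₁) _)))
      (trans (cong suc n) (cong (_+ (length a₃ + length a₄)) (sym (+-suc (length a₁) (length a₂)))))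
      ns (cong suc ne) nj
  sort (piece (G u) b (J B) ∷ PS) (u∉ ∷ s) e with sort PS s e
  ... | sorted a₁ a₂ a₃ a₄ p n ns ne nj =
    sorted a₁ a₂ (((u , u∉) , b , B) ∷ a₃) a₄
      (↭-trans (prep _ p) (bag 5 (λ q a b c d → q ⊕ a ⊕ b ⊕ c ⊕ d ⊜ a ⊕ b ⊕ q ⊕ c ⊕ d) ↭-refl
         [ piece (G u) b (J B) ]ₗ (map jj a₁) (map jg a₂) (map gj a₃) (map gg a₄)))
      (trans (cong suc n) (sym (+-suc (length a₁ + length a₂) _)))
      (cong suc ns) ne nj
  sort (piece (G u) b (G x) ∷ PS) (u∉ ∷ s) (x∉ ∷ e) with sort PS s e
  ... | sorted a₁ a₂ a₃ a₄ p n ns ne nj =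
    sorted a₁ a₂ a₃ (((u , u∉) , b , x , x∉) ∷ a₄)
      (↭-trans (prep _ p) (bag 5 (λ q a b c d → q ⊕ a ⊕ b ⊕ c ⊕ d ⊜ a ⊕ b ⊕ c ⊕ q ⊕ d) ↭-refl
         [ piece (G u) b (G x) ]ₗ (map jj a₁) (map jg a₂) (map gj a₃) (map gg a₄)))
      (trans (cong suc n) (trans (sym (+-suc (length a₁ + length a₂) _)) (cong (length a₁ + length a₂ +_) (sym (+-suc (length a₃) _)))))
      (trans (cong suc ns) (sym (+-suc (length a₃) _))) (trans (cong suc ne) (sym (+-suc (length a₂) _))) nj

  State : List (Piece V) → Set
  State PS = ∃[ lost ] Inv PS lost × All (_∈ L) lost

  state-↭ : ∀ {PS PS′} → PS ↭ PS′ → State PS → State PS′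
  state-↭ p (lost , I , l) = lost , inv-↭ p I , l

  enter : ∀ {s b₁ x A b₂ e PS} → x ∉ X → State (piece s b₁ (G x) ∷ piece (J A) b₂ e ∷ PS) →
          ∃[ b ] State (piece s b e ∷ PS)
  enter x∉ (lost , I , l) with inv-enter x∉ I
  ... | b , α , I′ , α∈ = b , α ++ lost , I′ , AllP.++⁺ α∈ l

  leave : ∀ {s b₁ B u b₂ e PS} → u ∉ Y → State (piece s b₁ (J B) ∷ piece (G u) b₂ e ∷ PS) →
          ∃[ b ] State (piece s b e ∷ PS)
  leave u∉ (lost , I , l) with inv-leave u∉ I
  ... | b , α , I′ , α∈ = b , α ++ lost , I′ , AllP.++⁺ α∈ l

  -- A piece with a joint in front and a free end is put before the accumulated piece, whose front
  -- joint it enters; the result again has joints on both sides.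
  absorb-jgs : ∀ jgs {acc PS} → State (jj acc ∷ map jg jgs ++ PS) → ∃[ acc′ ] State (jj acc′ ∷ PS)
  absorb-jgs [] S = _ , S
  absorb-jgs ((A , b , x , x∉) ∷ jgs) {A′ , b′ , B′} S with enter x∉ (state-↭ (swap _ _ ↭-refl) S)
  ... | b″ , S′ = absorb-jgs jgs {A , b″ , B′} S′

  absorb-gjs : ∀ gjs {acc PS} → State (jj acc ∷ map gj gjs ++ PS) → ∃[ acc′ ] State (jj acc′ ∷ PS)
  absorb-gjs [] S = _ , S
  absorb-gjs (((u , u∉) , b , B) ∷ gjs) {A′ , b′ , B′} S with leave u∉ S
  ... | b″ , S′ = absorb-gjs gjs {A′ , b″ , B} S′

  -- Joints can be connected only to free ends, so a piece with two free ends must be followed by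
  -- one with two joints; equal numbers are therefore what is required.
  interleave : ∀ jjs ggs {acc PS} → length jjs ≡ length ggs → State (jj acc ∷ map jj jjs ++ map gg ggs ++ PS) →
               ∃[ acc′ ] State (jj acc′ ∷ PS)
  interleave [] [] _ S = _ , S
  interleave ((A , b , B) ∷ jjs) (((u , u∉) , b₂ , x , x∉) ∷ ggs) {A′ , b′ , B′} eq S
    with leave u∉ (state-↭ (prep _ (shift _ (jj (A , b , B) ∷ map jj jjs) (map gg ggs ++ _))) S)
  ... | b″ , S′ with enter x∉ S′
  ... | b‴ , S″ = interleave jjs ggs {A′ , b‴ , B} (suc-injective eq) S″

  -- Among 2q pieces with q free starts and q free ends, those with two joints are as many as those
  -- with two free ends. One of the former serves as the seed; one of the latter is kept until last
  -- and closes the cycle by entering the front joint.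
  assemble : ∀ {PS q} → Inv PS [] → All (_∉ Y) (starts PS) → All (_∉ X) (ends PS) →
    length PS ≡ q + q → length (starts PS) ≡ q → length (ends PS) ≡ q → 1 ≤ joints₂ PS →
    ∃[ lost ] CyclePlus lost × All (_∈ L) lost
  assemble {PS} {q} I s∉ e∉ np ns ne nj with sort PS s∉ e∉
  ... | sorted [] _ _ _ _ _ _ _ j = ⊥-elim (<⇒≱ nj (≤-reflexive j))
  ... | sorted (acc ∷ jjs) jgs gjs ggs p n s e j = go ggs eq (state-↭ p ([] , I , []))
    where
    jj+jg : suc (length jjs) + length jgs ≡ q
    jj+jg = +-cancelʳ-≡ q _ _ (trans (cong (suc (length jjs) + length jgs +_) (trans (sym ns) s)) (trans (sym n) np))
    eq : suc (length jjs) ≡ length ggs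
    eq = +-cancelʳ-≡ (length jgs) _ _ (trans jj+jg (trans (sym ne) (trans e (+-comm (length jgs) _))))
    go : ∀ ggs → suc (length jjs) ≡ length ggs →
         State (jj acc ∷ map jj jjs ++ map jg jgs ++ map gj gjs ++ map gg ggs) →
         ∃[ lost ] CyclePlus lost × All (_∈ L) lost
    go (((u , u∉) , b , x , x∉) ∷ ggs) eq S
      with absorb-jgs jgs {acc} {map gj gjs ++ map jj jjs ++ map gg ggs ++ gg ((u , u∉) , b , x , x∉) ∷ []}
             (state-↭ (prep _ (bag 5 (λ a b c d g → a ⊕ b ⊕ c ⊕ g ⊕ d ⊜ b ⊕ c ⊕ a ⊕ d ⊕ g) ↭-refl
               (map jj jjs) (map jg jgs) (map gj gjs) (map gg ggs) [ _ ]ₗ)) S)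
    ... | acc₁ , S₁ with absorb-gjs gjs {acc₁} S₁
    ... | acc₂ , S₂ with interleave jjs ggs {acc₂} (suc-injective eq) S₂
    ... | acc₃ , S₃ with leave u∉ S₃
    ... | b₄ , lost , I₄ , l∈ with inv-close x∉ I₄
    ... | α , C , α∈ = α ++ lost , C , AllP.++⁺ α∈ l∈

-- One Hamilton cycle avoiding few forbidden arcs

module Cover {V : Set} (_≟_ : DecidableEquality V) (R : V → V → Set) (d : ℕ) (nb : V → List V)
  (nb-length : ∀ v → length (nb v) ≤ d)
  (comparable : ∀ {u v} → u ≢ v → u ∉ nb v → R u v ⊎ R v u) where

  toL : V × List V → List V
  toL (q , qs) = q ∷ qs

  -- `v` goes in front of the first vertex that it is found to dominate, or to the end. The last
  -- clause carries the induction: either possible head is an out-neighbour of the vertex before it.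
  insert-vertex : ∀ v q qs → IsPath R (q ∷ qs) → (∀ {u} → u ∈ q ∷ qs → R u v ⊎ R v u) →
    ∃[ q′ ] ∃[ qs′ ] IsPath R (q′ ∷ qs′) × v ∷ q ∷ qs ↭ q′ ∷ qs′ × (q′ ≡ q ⊎ q′ ≡ v)
  insert-vertex v q qs p c with c (here refl)
  ... | inj₂ vq = v , q ∷ qs , (λ { now → vq ; (later d) → p d }) , ↭-refl , inj₂ refl
  insert-vertex v q [] p c | inj₁ qv =
    q , v ∷ [] , (λ { now → qv ; (later (later ())) }) , swap v q ↭-refl , inj₁ refl
  insert-vertex v q (r ∷ qs) p c | inj₁ qv with insert-vertex v r qs (p ∘ later) (c ∘ there)
  ... | q′ , qs′ , p′ , pm , h = q , q′ ∷ qs′ , (λ { now → hd h ; (later d) → p′ d }) ,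
        ↭-trans (swap v q ↭-refl) (prep q pm) , inj₁ refl
    where
    hd : ∀ {x} → x ≡ r ⊎ x ≡ v → R q x
    hd (inj₁ refl) = p now
    hd (inj₂ refl) = qv

  -- The paths are disjoint, so an element of `B` met on a rejected path lies on no other path: each
  -- rejection uses up one element of `B`, and there are more paths than elements.
  free-path : ∀ Qs (B : List V) → Unique (concatMap toL Qs) → length B < length Qs →
    ∃[ Q ] Q ∈ Qs × (∀ {u} → u ∈ toL Q → u ∉ B)
  free-path (Q ∷ Qs) B uq lt with any? (λ u → mem? _≟_ u B) (toL Q)
  ... | no n = Q , here refl , λ {u} i j → n (lose′ i j)
    where
    lose′ : ∀ {u xs} → u ∈ xs → u ∈ B → Any (_∈ B) xs
    lose′ (here refl) j = here j
    lose′ (there i) j = there (lose′ i j)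
  ... | yes a with find a
  ... | b , b∈Q , b∈B with extract b∈B
  ... | B′ , pm with free-path Qs B′ (unique-++ʳ (toL Q) uq)
                       (≤-pred (≤-trans (≤-reflexive (cong suc (sym (↭-length pm)))) lt))
  ... | Q′ , Q′∈ , dis = Q′ , there Q′∈ , λ {u} i j → inB i (∈-resp-↭ pm j)
    where
    inB : ∀ {u} → u ∈ toL Q′ → u ∉ b ∷ B′
    inB i (here refl) = unique-disjoint (toL Q) uq b∈Q (∈-concatMap⁺ toL Q′∈ i)
    inB i (there j) = dis i j

  private
    absorb : ∀ {v q qs q′ qs′ Qs Qr out} → Qs ↭ (q , qs) ∷ Qr → v ∷ q ∷ qs ↭ q′ ∷ qs′ →
             concatMap toL Qs ++ v ∷ out ↭ (q′ ∷ qs′ ++ concatMap toL Qr) ++ out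
    absorb {v} {q} {qs} {Qr = Qr} {out} pm pm′ = ↭-trans (++⁺ʳ (v ∷ out) (concatMap-↭ toL pm))
      (↭-trans (bag 4 (λ q r v o → (q ⊕ r) ⊕ v ⊕ o ⊜ ((v ⊕ q) ⊕ r) ⊕ o) ↭-refl (q ∷ qs) (concatMap toL Qr) [ v ]ₗ out)
        (++⁺ʳ out (++⁺ʳ (concatMap toL Qr) pm′)))

    singletons : ∀ as → concatMap toL (map (_, []) as) ≡ as
    singletons [] = refl
    singletons (a ∷ as) = cong (a ∷_) (singletons as)

  cover : ∀ out Qs → All (λ Q → IsPath R (toL Q)) Qs → length Qs ≡ suc d → Unique (concatMap toL Qs ++ out) →
    ∃[ Qs′ ] All (λ Q → IsPath R (toL Q)) Qs′ × length Qs′ ≡ suc d × concatMap toL Qs′ ↭ concatMap toL Qs ++ out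
  cover [] Qs ps l u = Qs , ps , l , ↭-reflexive (sym (++-identityʳ _))
  cover (v ∷ out) Qs ps l u
    with free-path Qs (nb v) (unique-++ˡ _ u) (≤-trans (s≤s (nb-length v)) (≤-reflexive (sym l)))
  ... | (q , qs) , Q∈ , dis with extract Q∈
  ... | Qr , pm with All-resp-↭ pm ps
  ... | p ∷ pr with insert-vertex v q qs p (λ {u′} i → comparable (λ { refl →
                      unique-disjoint (concatMap toL Qs) u (∈-concatMap⁺ toL Q∈ i) (here refl) }) (dis i))
  ... | q′ , qs′ , p′ , pm′ , _
    with cover out ((q′ , qs′) ∷ Qr) (p′ ∷ pr) (trans (sym (↭-length pm)) l) (Unique-↭ (absorb pm pm′) u)
  ... | Qs″ , p″ , l″ , pm″ = Qs″ , p″ , l″ , ↭-trans pm″ (↭-sym (absorb pm pm′))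

  cover-exactly : ∀ out → Unique out → suc d ≤ length out →
    ∃[ Qs ] All (λ Q → IsPath R (toL Q)) Qs × length Qs ≡ suc d × concatMap toL Qs ↭ out
  cover-exactly out u le with cut-off (suc d) out le
    where
    cut-off : ∀ m (xs : List V) → m ≤ length xs → ∃[ as ] ∃[ bs ] xs ≡ as ++ bs × length as ≡ m
    cut-off zero xs _ = [] , xs , refl , refl
    cut-off (suc m) (x ∷ xs) (s≤s le) with cut-off m xs le
    ... | as , bs , refl , l = x ∷ as , bs , refl , cong suc l
  ... | as , bs , refl , l with cover bs (map (_, []) as) (paths as) (trans (length-map (_, []) as) l)
                                     (subst (λ z → Unique (z ++ bs)) (sym (singletons as)) u)
    where
    paths : ∀ as → All (λ Q → IsPath R (toL Q)) (map (_, []) as)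
    paths [] = []
    paths (a ∷ as) = (λ { (later ()) }) ∷ paths as
  ... | Qs , p , l′ , pm = Qs , p , l′ , ↭-trans pm (↭-reflexive (cong (_++ bs) (singletons as)))

module OneCycle {V : Set} (_≟_ : DecidableEquality V) (R : V → V → Set) (R? : ∀ u v → Dec (R u v))
  (d : ℕ) (nb : V → List V) (nb-length : ∀ v → length (nb v) ≤ d)
  (comparable : ∀ {u v} → u ≢ v → u ∉ nb v → R u v ⊎ R v u)
  (F₀ L X Y : List V) (cx cy : V → V)
  (F-unique : Unique F₀) (F-all : ∀ v → v ∈ F₀) where

  open Cover _≟_ R d nb nb-length comparable
  open Pieces _≟_ R F₀ L X Y cx cy
  open Assembly _≟_ R F₀ L X Y cx cy

  outs ins : V → List V
  outs w = filter (R? w) F₀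
  ins w = filter (λ u → R? u w) F₀

  -- The state between two rounds. `j` counts the cuts made so far, each of which spoils at most one
  -- piece with two joints.
  record Level (PS₀ : List (Piece V)) (a b : ℕ) (X′ Y′ : List V) (p j : ℕ) : Set where
    constructor level
    field
      PS : List (Piece V)
      inv′ : Inv PS []
      ends-length : length (ends PS) ≡ a
      starts-length : length (starts PS) ≡ b
      ends∉ : All (_∉ X′) (ends PS)
      starts∉ : All (_∉ Y′) (starts PS)
      length-≡ : length PS ≡ p
      joints-≤ : joints₂ PS₀ ≤ j + joints₂ PS

  private
    len-++ : ∀ {xs} ys zs {a b} → xs ↭ ys ++ zs → length {A = V} ys ≡ a → length zs ≡ b → length xs ≡ a + b
    len-++ ys zs pm refl refl = trans (↭-length pm) (length-++ ys)

  end-level : ∀ {PS₀ a b X₀ X′ Y′ p j K} → Level PS₀ a b X₀ Y′ p j →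
    (∀ {v} → v ∈ L → v ∈ X′ × cx v ∈ X′ × cy v ∈ X′) → a + p ≤ K →
    (∀ {w} → w ∉ X₀ → length X′ + (length X′ + (length Y′ + (K + K))) < length (outs w)) →
    Level PS₀ (a + a) (a + b) X′ Y′ (a + p) (j + a)
  end-level {j = j} (level PS I refl refl e∉ s∉ refl jn) cov bound deg
    with end-stage F-unique F-all outs (λ w → Uniq.filter⁺ (R? w) F-unique) (λ {w} i → proj₂ (∈-filter⁻ (R? w) {xs = F₀} i))
           cov (ends PS) {done = []} I (↭-reflexive (sym (++-identityʳ _))) bound (λ i → deg (All.lookup e∉ i))
  ... | stage PS′ I′ es ss e s es∉ ss∉ el sl len jn′ = level PS′ I′
        (trans (len-++ es [] e el refl) (+-identityʳ _)) (len-++ ss (starts PS) s sl refl)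
        (All-resp-↭ (↭-sym e) (AllP.++⁺ es∉ [])) (All-resp-↭ (↭-sym s) (AllP.++⁺ ss∉ s∉)) len
        (≤-trans jn (≤-trans (+-monoʳ-≤ j jn′) (≤-reflexive (sym (+-assoc j _ _)))))

  start-level : ∀ {PS₀ a b Y₀ X′ Y′ p j K} → Level PS₀ a b X′ Y₀ p j →
    (∀ {v} → v ∈ L → v ∈ Y′ × cx v ∈ Y′ × cy v ∈ Y′) → b + p ≤ K →
    (∀ {w} → w ∉ Y₀ → length Y′ + (length X′ + (length Y′ + (K + K))) < length (ins w)) →
    Level PS₀ (b + a) (b + b) X′ Y′ (b + p) (j + b)
  start-level {j = j} (level PS I refl refl e∉ s∉ refl jn) cov bound deg
    with start-stage F-unique F-all ins (λ w → Uniq.filter⁺ (λ u → R? u w) F-unique) (λ {w} i → proj₂ (∈-filter⁻ (λ u → R? u w) {xs = F₀} i))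
           cov (starts PS) {done = []} I (↭-reflexive (sym (++-identityʳ _))) bound (λ i → deg (All.lookup s∉ i))
  ... | stage PS′ I′ es ss e s es∉ ss∉ el sl len jn′ = level PS′ I′
        (len-++ es (ends PS) e el refl) (trans (len-++ ss [] s sl refl) (+-identityʳ _))
        (All-resp-↭ (↭-sym e) (AllP.++⁺ es∉ e∉)) (All-resp-↭ (↭-sym s) (AllP.++⁺ ss∉ [])) len
        (≤-trans jn (≤-trans (+-monoʳ-≤ j jn′) (≤-reflexive (sym (+-assoc j _ _)))))

  -- `m` paths and 16m strands make 17m pieces. The rounds treat m, 2m, 4m and 8m ends or starts,
  -- one cut for each, which gives 32m = `K` pieces with 16m ends and 16m starts.
  m m₂ m₄ m₈ m₁₆ K : ℕ
  m = suc d
  m₂ = m + m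
  m₄ = m₂ + m₂
  m₈ = m₄ + m₄
  m₁₆ = m₈ + m₈
  K = m₁₆ + m₁₆

  -- The last two rounds treat the side with the smaller exceptional set first.
  record Degrees (W : List V) : Set where
    field
      out-W : ∀ w → length W + (length W + (length W + (K + K))) < length (outs w)
      in-W  : ∀ w → length W + (length W + (length W + (K + K))) < length (ins w)
      out-in : ((∀ {w} → w ∉ W → length X + (length X + (length W + (K + K))) < length (outs w)) ×
                (∀ {w} → w ∉ W → length Y + (length X + (length Y + (K + K))) < length (ins w))) ⊎
               ((∀ {w} → w ∉ W → length Y + (length W + (length Y + (K + K))) < length (ins w)) ×
                (∀ {w} → w ∉ W → length X + (length X + (length Y + (K + K))) < length (outs w)))

  four-levels : ∀ {PS₀} W → Degrees W → (∀ {v} → v ∈ L → v ∈ W × cx v ∈ W × cy v ∈ W) →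
    (∀ {v} → v ∈ W → v ∈ X) → (∀ {v} → v ∈ W → v ∈ Y) →
    Level PS₀ m m [] [] (m + m₁₆) 0 → Level PS₀ m₁₆ m₁₆ X Y K (m + m₂ + m₄ + m₈)
  four-levels {PS₀} W D cov W⊆X W⊆Y l₀ = go out-in
    where
    open Degrees D
    covX : ∀ {v} → v ∈ L → v ∈ X × cx v ∈ X × cy v ∈ X
    covX i with cov i
    ... | a , b , c = W⊆X a , W⊆X b , W⊆X c
    covY : ∀ {v} → v ∈ L → v ∈ Y × cx v ∈ Y × cy v ∈ Y
    covY i with cov i
    ... | a , b , c = W⊆Y a , W⊆Y b , W⊆Y c
    final : m₈ + (m₄ + (m₂ + (m + (m + m₁₆)))) ≡ K
    final = trans (cong (λ z → m₈ + (m₄ + (m₂ + z))) (dbl m)) (trans (cong (λ z → m₈ + (m₄ + z)) (dbl m₂))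
              (trans (cong (m₈ +_) (dbl m₄)) (dbl m₈)))
      where
      dbl : ∀ a → a + (a + m₁₆) ≡ (a + a) + m₁₆
      dbl a = sym (+-assoc a a m₁₆)
    b₃ : m₄ + (m₂ + (m + (m + m₁₆))) ≤ K
    b₃ = ≤-trans (m≤n+m _ m₈) (≤-reflexive final)
    b₂ : m₂ + (m + (m + m₁₆)) ≤ K
    b₂ = ≤-trans (m≤n+m _ m₄) b₃
    b₁ : m + (m + m₁₆) ≤ K
    b₁ = ≤-trans (m≤n+m _ m₂) b₂
    l₁ : Level PS₀ m₂ m₂ W [] (m + (m + m₁₆)) m
    l₁ = end-level l₀ cov b₁ λ {w} _ → ≤-trans (s≤s (+-monoʳ-≤ (length W) (+-monoʳ-≤ (length W) (m≤n+m _ (length W))))) (out-W w)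
    l₂ : Level PS₀ m₄ m₄ W W (m₂ + (m + (m + m₁₆))) (m + m₂)
    l₂ = start-level l₁ cov b₂ λ {w} _ → in-W w
    recast : ∀ {p j} → Level PS₀ m₁₆ m₁₆ X Y p j → p ≡ K → Level PS₀ m₁₆ m₁₆ X Y K j
    recast l refl = l
    go : _ → Level PS₀ m₁₆ m₁₆ X Y K (m + m₂ + m₄ + m₈)
    go (inj₁ (e , s)) = recast (start-level (end-level l₂ covX b₃ e) covY (≤-reflexive final) s) final
    go (inj₂ (s , e)) = recast (end-level (start-level l₂ covY b₃ s) covX (≤-reflexive final) e) final

  module _ (us : List (List V × List V × List V)) (us-ok : All Ok (map jj us))
    (out : List V) (us-perm : flat (map jj us) ++ out ↭ F₀) (us-length : length us ≡ m₁₆)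
    (out-length : m ≤ length out)
    (us-covs : ∀ {v} → v ∈ L → Covers (map jj us) v)
    (tri : ∀ {v} → v ∈ L → R (cx v) v × R v (cy v))
    (cx-injective : ∀ {u v} → u ∈ L → v ∈ L → cx u ≡ cx v → u ≡ v)
    (W : List V) (degrees : Degrees W) (cov∈W : ∀ {v} → v ∈ L → v ∈ W × cx v ∈ W × cy v ∈ W)
    (W⊆X : ∀ {v} → v ∈ W → v ∈ X) (W⊆Y : ∀ {v} → v ∈ W → v ∈ Y)
    where

    loose : V × List V → Piece V
    loose (q , qs) = piece (G q) (q ∷ qs) (G (proj₁ (last? q qs)))

    private
      loose-ok : ∀ Qs → All (λ Q → IsPath R (toL Q)) Qs → All Ok (map loose Qs)
      loose-ok [] [] = []
      loose-ok ((q , qs) ∷ Qs) (p ∷ ps) =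
        ok (subst (IsPath R) (sym (++-identityʳ (q ∷ qs))) p) first (proj₂ (last? q qs)) ∷ loose-ok Qs ps

      loose-flat : ∀ Qs → flat (map loose Qs) ≡ concatMap toL Qs
      loose-flat [] = refl
      loose-flat ((q , qs) ∷ Qs) rewrite ++-identityʳ qs = cong (λ z → q ∷ qs ++ z) (loose-flat Qs)

      loose-ends : ∀ Qs us → length (ends (map loose Qs ++ map jj us)) ≡ length Qs
      loose-ends [] [] = refl
      loose-ends [] (u ∷ us) = loose-ends [] us
      loose-ends (Q ∷ Qs) us = cong suc (loose-ends Qs us)

      loose-starts : ∀ Qs us → length (starts (map loose Qs ++ map jj us)) ≡ length Qs
      loose-starts [] [] = refl
      loose-starts [] (u ∷ us) = loose-starts [] us
      loose-starts (Q ∷ Qs) us = cong suc (loose-starts Qs us)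

      loose-joints : ∀ Qs us → joints₂ (map loose Qs ++ map jj us) ≡ length us
      loose-joints [] [] = refl
      loose-joints [] (u ∷ us) = cong suc (loose-joints [] us)
      loose-joints (Q ∷ Qs) us = loose-joints Qs us

      flat-++ : ∀ PS QS → flat (PS ++ QS) ≡ flat PS ++ flat QS
      flat-++ [] QS = refl
      flat-++ (P ∷ PS) QS = trans (cong (full P ++_) (flat-++ PS QS)) (sym (++-assoc (full P) (flat PS) (flat QS)))

      weaken : ∀ Qs {QS v} → Covers QS v → Covers (map loose Qs ++ QS) v
      weaken [] c = c
      weaken (Q ∷ Qs) c = there (weaken Qs c)

      out-unique : Unique out
      out-unique = unique-++ʳ (flat (map jj us)) (Unique-↭ (↭-sym us-perm) F-unique)

    one-cycle : ∃[ z ] ∃[ zs ] z ∷ zs ↭ F₀ × IsPath R (z ∷ zs ∷ʳ z)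
    one-cycle with cover-exactly out out-unique out-length
    ... | Qs , ps , lQ , pm = finish (four-levels W degrees cov∈W W⊆X W⊆Y start)
      where
      PS₀ = map loose Qs ++ map jj us
      start : Level PS₀ m m [] [] (m + m₁₆) 0
      start = level PS₀
        (inv (AllP.++⁺ (loose-ok Qs ps) us-ok)
          (↭-trans (↭-reflexive (trans (++-identityʳ (flat PS₀)) (trans (flat-++ (map loose Qs) (map jj us)) (cong (_++ flat (map jj us)) (loose-flat Qs)))))
            (↭-trans (++-comm (concatMap toL Qs) (flat (map jj us))) (↭-trans (++⁺ˡ (flat (map jj us)) pm) us-perm)))
          (λ i → weaken Qs (us-covs i)))
        (trans (loose-ends Qs us) lQ) (trans (loose-starts Qs us) lQ)
        (All.tabulate λ _ ()) (All.tabulate λ _ ())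
        (trans (length-++ (map loose Qs)) (cong₂ _+_
          (trans (length-map loose Qs) lQ) (trans (length-map jj us) us-length)))
        ≤-refl
      finish : Level PS₀ m₁₆ m₁₆ X Y K (m + m₂ + m₄ + m₈) →
               ∃[ z ] ∃[ zs ] z ∷ zs ↭ F₀ × IsPath R (z ∷ zs ∷ʳ z)
      finish (level PS I el sl e∉ s∉ len jn) with assemble I s∉ e∉ len sl el j≥1
        where
        16≡ : m₁₆ ≡ (m + m₂ + m₄ + m₈) + m
        16≡ = sym (arith m m₂ m₄ m₈)
          where
          arith : ∀ a b c d → (a + b + c + d) + a ≡ (a + a) + b + c + d
          arith = solve-∀
        -- At most 15m of the 16m strands have been cut.
        j≥1 : 1 ≤ joints₂ PS
        j≥1 = ≤-trans (s≤s z≤n) (+-cancelˡ-≤ (m + m₂ + m₄ + m₈) m (joints₂ PS)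
          (≤-trans (≤-reflexive (trans (sym 16≡) (trans (sym us-length) (sym (loose-joints Qs us))))) jn))
      ... | lost , cyclePlus z zs q p c , lost∈ with insert-lost tri cx-injective lost lost∈
              (unique-++ʳ (z ∷ zs) (Unique-↭ (↭-sym q) F-unique)) q p (λ i → c (All.lookup lost∈ i))
      ... | ys , q′ , p′ = z , ys , q′ , p′

-- Dominating sets

module _ {V : Set} where

  total : (V → ℕ) → List V → ℕ
  total f [] = 0
  total f (x ∷ xs) = f x + total f xs

  total-mono : ∀ {f g : V → ℕ} xs → (∀ {x} → x ∈ xs → f x ≤ g x) → total f xs ≤ total g xs
  total-mono [] h = z≤n
  total-mono (x ∷ xs) h = +-mono-≤ (h (here refl)) (total-mono xs (h ∘ there))

  module _ (T : V → V → Set) (T? : ∀ u v → Dec (T u v)) where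

    outdeg indeg : List V → V → ℕ
    outdeg S v = length (filter (T? v) S)
    indeg S v = length (filter (λ u → T? u v) S)

    handshake : ∀ xs ys → total (outdeg ys) xs ≡ total (indeg xs) ys
    handshake [] ys = sym (zeros ys)
      where
      zeros : ∀ ys → total (λ _ → 0) ys ≡ 0
      zeros [] = refl
      zeros (y ∷ ys) = zeros ys
    handshake (x ∷ xs) ys = trans (cong (outdeg ys x +_) (handshake xs ys)) (row ys)
      where
      rotate : ∀ a b c → a + (b + c) ≡ b + (a + c)
      rotate = solve-∀
      row : ∀ ys → outdeg ys x + total (indeg xs) ys ≡ total (indeg (x ∷ xs)) ys
      row [] = refl
      row (y ∷ ys) with T? x y
      ... | yes t = cong suc (trans (rotate (outdeg ys x) (indeg xs y) _) (cong (indeg xs y +_) (row ys)))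
      ... | no ¬t = trans (rotate (outdeg ys x) (indeg xs y) _) (cong (indeg xs y +_) (row ys))

    module _ (asym : ∀ {u v} → T u v → ¬ T v u) where

      out+in : ∀ v S → outdeg S v + indeg S v ≤ length S
      out+in v [] = z≤n
      out+in v (x ∷ S) with T? v x | T? x v
      ... | yes p | yes q = ⊥-elim (asym p q)
      ... | yes p | no _ = s≤s (out+in v S)
      ... | no _ | yes q = ≤-trans (≤-reflexive (+-suc _ _)) (s≤s (out+in v S))
      ... | no _ | no _ = ≤-trans (out+in v S) (n≤1+n _)

      -- Otherwise every vertex of `S` would have larger out-degree than in-degree within `S`,
      -- against `handshake`.
      low-outdegree : ∀ x xs → let S = x ∷ xs in ∃[ a ] a ∈ S × outdeg S a + outdeg S a ≤ length S
      low-outdegree x xs with any? (λ a → (outdeg (x ∷ xs) a + outdeg (x ∷ xs) a) ≤? length (x ∷ xs)) (x ∷ xs)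
      ... | yes p = find p
      ... | no np = ⊥-elim (<⇒≱ (n<1+n (total (indeg S) S)) (≤-trans big (≤-reflexive (handshake S S))))
        where
        S = x ∷ xs
        more : ∀ {a} → a ∈ S → suc (indeg S a) ≤ outdeg S a
        more {a} i = +-cancelˡ-≤ (outdeg S a) _ _ (≤-trans (≤-reflexive (+-suc _ _))
          (≤-trans (s≤s (out+in a S)) (≰⇒> (λ le → np (lose i le)))))
        big : suc (total (indeg S) S) ≤ total (outdeg S) S
        big = ≤-trans (s≤s (+-monoʳ-≤ (indeg S x) (total-mono xs (λ i → <⇒≤ (more (there i))))))
                      (+-monoˡ-≤ (total (outdeg S) xs) (more (here refl)))

  minimum : (f : V → ℕ) → ∀ x xs → ∃[ a ] a ∈ x ∷ xs × (∀ {v} → v ∈ x ∷ xs → f a ≤ f v)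
  minimum f x [] = x , here refl , λ { (here refl) → ≤-refl }
  minimum f x (y ∷ xs) with minimum f y xs
  ... | a , a∈ , h with ≤-total (f x) (f a)
  ... | inj₁ le = x , here refl , λ { (here refl) → ≤-refl ; (there i) → ≤-trans le (h i) }
  ... | inj₂ ge = a , there a∈ , λ { (here refl) → ge ; (there i) → h i }

record IsTournament {V : Set} (T : V → V → Set) : Set where
  field
    T?     : ∀ u v → Dec (T u v)
    asym   : ∀ {u v} → T u v → ¬ T v u
    either : ∀ {u v} → u ≢ v → T u v ⊎ T v u

reversed : ∀ {V : Set} {T : V → V → Set} → IsTournament T → IsTournament (flip T)
reversed t = record { T? = flip T? ; asym = asym ; either = λ ne → swap⊎ (either ne) }
  where
  open IsTournament t
  swap⊎ : ∀ {A B : Set} → A ⊎ B → B ⊎ A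
  swap⊎ (inj₁ a) = inj₂ a
  swap⊎ (inj₂ b) = inj₁ b

path-reverse : ∀ {V : Set} {T : V → V → Set} xs → IsPath (flip T) xs → IsPath T (reverse xs)
path-reverse xs p c = p (subst (Con _ _) (reverse-involutive xs) (con-flip c))

module Dominate {V : Set} (_≟_ : DecidableEquality V) {T : V → V → Set} (tour : IsTournament T)
  (F₀ : List V) (F-unique : Unique F₀) (F-all : ∀ v → v ∈ F₀) where

  open IsTournament tour

  -- A vertex `a` of low out-degree in `S` is dominated by all of `S` except itself and its
  -- out-neighbourhood, to which the search passes; each passage at least halves the set. Later
  -- vertices are out-neighbours of all earlier ones, so `A` is a path.
  dominate : ∀ c S → Unique S → ∃[ A ] ∃[ rest ] IsPath T A × Unique A × (∀ {v} → v ∈ A → v ∈ S) × length A ≤ c ×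
    length rest * 2 ^ c ≤ length S × (∀ {v} → v ∈ S → v ∈ A ⊎ v ∈ rest ⊎ Any (T v) A)
  dominate zero S u = [] , S , (λ ()) , [] , (λ ()) , z≤n , ≤-reflexive (*-identityʳ _) , λ i → inj₂ (inj₁ i)
  dominate (suc c) [] u = [] , [] , (λ ()) , [] , (λ ()) , z≤n , z≤n , λ ()
  dominate (suc c) S@(x ∷ xs) u with low-outdegree T T? asym x xs
  ... | a , a∈ , half with dominate c (filter (T? a) S) (Uniq.filter⁺ (T? a) u)
  ... | A , rest , p , uA , A⊆ , lA , lr , dom =
      a ∷ A , rest , is-path , All.tabulate (λ { i refl → asym (aA i) (aA i) }) ∷ uA , sub , s≤s lA , size , dom′
    where
    aA : ∀ {v} → v ∈ A → T a v
    aA i = proj₂ (∈-filter⁻ (T? a) {xs = S} (A⊆ i))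
    is-path : IsPath T (a ∷ A)
    is-path now = aA (here refl)
    is-path (later c) = p c
    sub : ∀ {v} → v ∈ a ∷ A → v ∈ S
    sub (here refl) = a∈
    sub (there i) = proj₁ (∈-filter⁻ (T? a) {xs = S} (A⊆ i))
    size : length rest * 2 ^ suc c ≤ length S
    size = ≤-trans (≤-reflexive (double (length rest) (2 ^ c))) (≤-trans (+-mono-≤ lr lr) half)
      where
      double : ∀ r t → r * (t + (t + 0)) ≡ r * t + r * t
      double = solve-∀
    dom′ : ∀ {v} → v ∈ S → v ∈ a ∷ A ⊎ v ∈ rest ⊎ Any (T v) (a ∷ A)
    dom′ {v} i with v ≟ a
    ... | yes refl = inj₁ (here refl)
    ... | no ne with either ne
    ... | inj₁ va = inj₂ (inj₂ (here va))
    ... | inj₂ av with dom (∈-filter⁺ (T? a) i av)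
    ... | inj₁ j = inj₁ (there j)
    ... | inj₂ (inj₁ j) = inj₂ (inj₁ j)
    ... | inj₂ (inj₂ j) = inj₂ (inj₂ (there j))

  record InDominating (c : ℕ) (W : List V) : Set where
    field
      a₁ : V
      A rest : List V
      is-path     : IsPath T (a₁ ∷ A)
      unique   : Unique (a₁ ∷ A)
      disjoint : ∀ {v} → v ∈ a₁ ∷ A → v ∉ W
      size     : length (a₁ ∷ A) ≤ suc c
      rest-size : ∀ {v} → v ∉ W → length rest * 2 ^ c ≤ outdeg T T? F₀ v
      dominated : ∀ {v} → v ∉ W → v ∉ a₁ ∷ A → v ∈ rest ⊎ Any (T v) (a₁ ∷ A)

  -- The halving takes place inside the out-neighbourhood of a vertex of least out-degree outside
  -- `W`. This turns a bound relative to the initial set into one relative to the out-degree of any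
  -- vertex outside `W`.
  in-dominating : ∀ c W → length W < length F₀ → InDominating c W
  in-dominating c W lt = build (filter ∉W? F₀) refl
    where
    ∉W? = λ v → ¬? (mem? _≟_ v W)
    build : ∀ U → U ≡ filter ∉W? F₀ → InDominating c W
    build [] e = ⊥-elim (f (pick _≟_ F₀ W F-unique lt))
      where
      f : ∃[ v ] v ∈ F₀ × v ∉ W → ⊥
      f (v , i , v∉) with subst (v ∈_) (sym e) (∈-filter⁺ ∉W? i v∉)
      ... | ()
    build (u ∷ us) e with minimum (outdeg T T? F₀) u us
    ... | a , a∈ , least with dominate c (filter ∉W? (filter (T? a) F₀)) (Uniq.filter⁺ ∉W? (Uniq.filter⁺ (T? a) F-unique))
    ... | A , rest , p , uA , A⊆ , lA , lr , dom = record
      { a₁ = a ; A = A ; rest = rest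
      ; is-path = λ { now → aA (here refl) ; (later c) → p c }
      ; unique = All.tabulate (λ { i refl → asym (aA i) (aA i) }) ∷ uA
      ; disjoint = λ { (here refl) → proj₂ (∈-filter⁻ ∉W? {xs = F₀} (subst (a ∈_) e a∈))
                     ; (there i) → proj₂ (∈-filter⁻ ∉W? {xs = filter (T? a) F₀} (A⊆ i)) }
      ; size = s≤s lA
      ; rest-size = λ {v} v∉ → ≤-trans lr (≤-trans (length-filter ∉W? (filter (T? a) F₀))
          (least (subst (v ∈_) (sym e) (∈-filter⁺ ∉W? (F-all v) v∉))))
      ; dominated = dominated
      }
      where
      aA : ∀ {v} → v ∈ A → T a v
      aA i = proj₂ (∈-filter⁻ (T? a) {xs = F₀} (proj₁ (∈-filter⁻ ∉W? {xs = filter (T? a) F₀} (A⊆ i))))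
      dominated : ∀ {v} → v ∉ W → v ∉ a ∷ A → v ∈ rest ⊎ Any (T v) (a ∷ A)
      dominated {v} v∉W v∉A with either {v} {a} (λ { refl → v∉A (here refl) })
      ... | inj₁ va = inj₂ (here va)
      ... | inj₂ av with dom (∈-filter⁺ ∉W? (∈-filter⁺ (T? a) (F-all v) av) v∉W)
      ... | inj₁ j = ⊥-elim (v∉A (there j))
      ... | inj₂ (inj₁ j) = inj₁ j
      ... | inj₂ (inj₂ j) = inj₂ (there j)

-- P o W must be stable under enlarging W: it records what is known about o once W has been used up.
greedy : ∀ {V Obj : Set} (vs : Obj → List V) (P : Obj → List V → Set) →
  (∀ {o W W′} → (∀ {v} → v ∈ W → v ∈ W′) → P o W → P o W′) → ∀ s K →
  (∀ W → Unique W → length W ≤ K → ∃[ o ] Unique (vs o ++ W) × P o (vs o ++ W) × length (vs o) ≤ s) →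
  ∀ N → N * s ≤ K → ∃[ os ] length os ≡ N × Unique (concatMap vs os) × All (λ o → P o (concatMap vs os)) os ×
                            length (concatMap vs os) ≤ N * s
greedy vs P mono s K ch zero le = [] , refl , [] , [] , z≤n
greedy vs P mono s K ch (suc N) le with greedy vs P mono s K ch N (≤-trans (m≤n+m _ s) le)
... | os , l , u , ps , b with ch (concatMap vs os) u (≤-trans b (≤-trans (m≤n+m _ s) le))
... | o , u′ , p , b′ = o ∷ os , cong suc l , u′ , p ∷ All.map (mono (∈-++⁺ʳ (vs o))) ps ,
      ≤-trans (≤-reflexive (length-++ (vs o))) (+-mono-≤ b′ b)

-- restA and restB contain the vertices that A fails to in-dominate and B fails to out-dominate.
record JointPair (V : Set) : Set where
  constructor jointPair
  field
    A₀ : List V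
    a b : V
    B₀ : List V
    restA restB : List V

  A B vs : List V
  A = A₀ ∷ʳ a
  B = b ∷ B₀
  vs = A ++ B

module ChooseJoints {V : Set} (_≟_ : DecidableEquality V) {T : V → V → Set} (tour : IsTournament T)
  (F₀ : List V) (F-unique : Unique F₀) (F-all : ∀ v → v ∈ F₀) (c : ℕ) where

  open IsTournament tour
  module D⁺ = Dominate _≟_ tour F₀ F-unique F-all
  module D⁻ = Dominate _≟_ (reversed tour) F₀ F-unique F-all

  record GoodJoint (o : JointPair V) (W : List V) : Set where
    open JointPair o
    field
      size  : length vs ≤ suc c + suc c
      pathA : IsPath T A
      pathB : IsPath T B
      sizeA : ∀ {v} → v ∉ W → length restA * 2 ^ c ≤ outdeg T T? F₀ v
      sizeB : ∀ {v} → v ∉ W → length restB * 2 ^ c ≤ indeg T T? F₀ v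
      domA  : ∀ {v} → v ∉ W → v ∈ restA ⊎ Any (T v) A
      domB  : ∀ {v} → v ∉ W → v ∈ restB ⊎ Any (λ b → T b v) B

  good-mono : ∀ {o W W′} → (∀ {v} → v ∈ W → v ∈ W′) → GoodJoint o W → GoodJoint o W′
  good-mono s g = record
    { size = size ; pathA = pathA ; pathB = pathB ; sizeA = λ n → sizeA (n ∘ s) ; sizeB = λ n → sizeB (n ∘ s)
    ; domA = λ n → domA (n ∘ s) ; domB = λ n → domB (n ∘ s) }
    where open GoodJoint g

  -- `B` is found in the reversed tournament, with the vertices of `A` added to the used ones; read
  -- backwards, the list obtained is a path of the given tournament.
  choose-joint : ∀ W → Unique W → suc c + length W < length F₀ →
    ∃[ o ] Unique (JointPair.vs o ++ W) × GoodJoint o (JointPair.vs o ++ W) × length (JointPair.vs o) ≤ suc c + suc c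
  choose-joint W uW lt
    with D⁺.in-dominating c W (≤-trans (s≤s (m≤n+m _ (suc c))) lt)
  ... | I₁ with D⁻.in-dominating c (D⁺.InDominating.a₁ I₁ ∷ D⁺.InDominating.A I₁ ++ W)
                  (≤-trans (s≤s (≤-trans (≤-reflexive (length-++ (D⁺.InDominating.a₁ I₁ ∷ D⁺.InDominating.A I₁)))
                                         (+-monoˡ-≤ (length W) (D⁺.InDominating.size I₁)))) lt)
  ... | I₂ = build (last-snoc (proj₂ (last? I₁.a₁ I₁.A))) (last-snoc (proj₂ (last? I₂.a₁ I₂.A)))
    where
    module I₁ = D⁺.InDominating I₁
    module I₂ = D⁻.InDominating I₂
    A₁ = I₁.a₁ ∷ I₁.A
    A₂ = I₂.a₁ ∷ I₂.A
    build : ∃[ xs ] A₁ ≡ xs ∷ʳ _ → ∃[ ys ] A₂ ≡ ys ∷ʳ _ → _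
    build (xs , e₁) (ys , e₂) = o , unique′ , good , size′
      where
      o = jointPair xs (proj₁ (last? I₁.a₁ I₁.A)) (proj₁ (last? I₂.a₁ I₂.A)) (reverse ys) I₁.rest I₂.rest
      open JointPair o
      eqB : B ≡ reverse A₂
      eqB = sym (trans (cong reverse e₂) (reverse-++ ys _))
      B↭ : B ↭ A₂
      B↭ = ↭-trans (↭-reflexive eqB) (↭-reverse A₂)
      vs↭ : A₂ ++ (A₁ ++ W) ↭ vs ++ W
      vs↭ = ↭-trans (bag 3 (λ a b w → b ⊕ a ⊕ w ⊜ (a ⊕ b) ⊕ w) ↭-refl A₁ A₂ W)
              (++⁺ʳ W (++⁺ (↭-reflexive e₁) (↭-sym B↭)))
      unique₁ : Unique (A₁ ++ W)
      unique₁ = unique-++ I₁.unique uW I₁.disjoint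
      unique′ : Unique (vs ++ W)
      unique′ = Unique-↭ vs↭ (unique-++ I₂.unique unique₁ I₂.disjoint)
      size′ : length vs ≤ suc c + suc c
      size′ = ≤-trans (≤-reflexive (length-++ A)) (+-mono-≤ (≤-trans (≤-reflexive (cong length (sym e₁))) I₁.size)
                (≤-trans (≤-reflexive (↭-length B↭)) I₂.size))
      in₁ : ∀ {v} → v ∉ vs ++ W → v ∉ A₁ ++ W
      in₁ n i = n (∈-resp-↭ vs↭ (∈-++⁺ʳ A₂ i))
      conv : ∀ {P : V → Set} → Any P A₂ → Any P B
      conv = Any-resp-↭ (↭-sym B↭)
      good : GoodJoint o (vs ++ W)
      good = record
        { size = size′
        ; pathA = subst (IsPath T) e₁ I₁.is-path
        ; pathB = subst (IsPath T) (sym eqB) (path-reverse A₂ I₂.is-path)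
        ; sizeA = λ n → I₁.rest-size (λ i → in₁ n (∈-++⁺ʳ A₁ i))
        ; sizeB = λ n → I₂.rest-size (in₁ n)
        ; domA = λ n → [ inj₁ , (λ q → inj₂ (subst (Any _) e₁ q)) ]′
                   (I₁.dominated (λ i → in₁ n (∈-++⁺ʳ A₁ i)) (λ i → in₁ n (∈-++⁺ˡ i)))
        ; domB = λ n → [ inj₁ , inj₂ ∘ conv ]′
                   (I₂.dominated (in₁ n) (λ i → n (∈-resp-↭ vs↭ (∈-++⁺ˡ i))))
        }

  choose-joints : ∀ N → suc c + N * (suc c + suc c) < length F₀ →
    ∃[ os ] length os ≡ N × Unique (concatMap JointPair.vs os) ×
            All (λ o → GoodJoint o (concatMap JointPair.vs os)) os ×
            length (concatMap JointPair.vs os) ≤ N * (suc c + suc c)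
  choose-joints N lt = greedy JointPair.vs GoodJoint good-mono (suc c + suc c) (N * (suc c + suc c))
    (λ W u le → choose-joint W u (≤-trans (s≤s (+-monoʳ-≤ (suc c) le)) lt)) N ≤-refl

-- Linking

ends₂ : ∀ {V : Set} → V × V → List V
ends₂ (x , y) = x ∷ y ∷ []

unique-concatMap⁻ : ∀ {A V : Set} (f : A → List V) xs → Unique (concatMap f xs) → ∀ i j {v} →
  v ∈ f (lookup xs i) → v ∈ f (lookup xs j) → i ≡ j
unique-concatMap⁻ f (x ∷ xs) u fzero fzero p q = refl
unique-concatMap⁻ f (x ∷ xs) u fzero (fsuc j) p q =
  ⊥-elim (unique-disjoint (f x) u p (∈-concatMap⁺ f (∈-lookup {xs = xs} j) q))
unique-concatMap⁻ f (x ∷ xs) u (fsuc i) fzero p q =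
  ⊥-elim (unique-disjoint (f x) u q (∈-concatMap⁺ f (∈-lookup {xs = xs} i) p))
unique-concatMap⁻ f (x ∷ xs) u (fsuc i) (fsuc j) p q = cong fsuc (unique-concatMap⁻ f xs (unique-++ʳ (f x) u) i j p q)

unique-concatMap-at : ∀ {A V : Set} (f : A → List V) xs → Unique (concatMap f xs) → ∀ {x} → x ∈ xs → Unique (f x)
unique-concatMap-at f (x ∷ xs) u (here refl) = unique-++ˡ (f x) u
unique-concatMap-at f (x ∷ xs) u (there i) = unique-concatMap-at f xs (unique-++ʳ (f x) u) i

unique-concatMap : ∀ {A V : Set} (f : A → List V) xs → Unique xs → (∀ {x} → x ∈ xs → Unique (f x)) →
  (∀ {x y v} → x ∈ xs → y ∈ xs → v ∈ f x → v ∈ f y → x ≡ y) → Unique (concatMap f xs)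
unique-concatMap f [] _ _ _ = []
unique-concatMap f (x ∷ xs) (px ∷ u) uf d = unique-++ (uf (here refl))
  (unique-concatMap f xs u (uf ∘ there) (λ i j → d (there i) (there j)))
  λ {v} i j → dis i (∈-concatMap f xs j)
  where
  dis : ∀ {v} → v ∈ f x → ∃[ y ] y ∈ xs × v ∈ f y → ⊥
  dis i (y , k , l) = All.lookup px k (d (here refl) (there k) i l)

pair-up : ∀ {V : Set} j (xs : List V) → length xs ≡ j + j → ∃[ qs ] length qs ≡ j × concatMap ends₂ qs ≡ xs
pair-up zero [] e = [] , refl , refl
pair-up (suc j) (x ∷ y ∷ xs) e with pair-up j xs (suc-injective (trans (suc-injective e) (+-suc j j)))
... | qs , l , refl = (x , y) ∷ qs , cong suc l , refl
pair-up (suc j) (x ∷ []) e with trans (suc-injective e) (+-suc j j)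
... | ()

length-ends₂ : ∀ {V : Set} (ps : List (V × V)) → length (concatMap ends₂ ps) ≡ length ps + length ps
length-ends₂ [] = refl
length-ends₂ (p ∷ ps) = cong suc (trans (cong suc (length-ends₂ ps)) (sym (+-suc _ _)))

module Linking {n : ℕ} (T : Tournament n) where

  V = Fin n

  _⇒_ : V → V → Set
  u ⇒ v = arc T u v ≡ true

  tour : IsTournament _⇒_
  tour = record { T? = λ u v → arc T u v Bool.≟ true ; asym = asym′ ; either = λ ne → e (oriented T _ _ ne) }
    where
    e : ∀ {u v} → (arc T u v ≡ true × arc T v u ≡ false) ⊎ (arc T v u ≡ true × arc T u v ≡ false) → u ⇒ v ⊎ v ⇒ u
    e (inj₁ (p , _)) = inj₁ p
    e (inj₂ (p , _)) = inj₂ p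
    asym′ : ∀ {u v} → u ⇒ v → ¬ v ⇒ u
    asym′ {u} {v} p q with u Fin.≟ v
    ... | yes refl with trans (sym p) (irreflexive T u)
    ... | ()
    asym′ {u} {v} p q | no ne with oriented T u v ne
    ... | inj₁ (_ , f) with trans (sym q) f
    ... | ()
    asym′ {u} {v} p q | no ne | inj₂ (_ , f) with trans (sym p) f
    ... | ()

  F₀ : List V
  F₀ = allFin n

  F-unique : Unique F₀
  F-unique = Uniq.allFin⁺ n

  F-all : ∀ v → v ∈ F₀
  F-all = ∈-allFin

  F-length : length F₀ ≡ n
  F-length = length-tabulate {n = n} id

  fill : ∀ k (Z : List V) → Unique Z → k + length Z ≤ n → ∃[ E ] length E ≡ k × Unique (E ++ Z)
  fill zero Z u le = [] , refl , u
  fill (suc k) Z u le with fill k Z u (≤-trans (n≤1+n _) le)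
  ... | E , l , uE with pick Fin._≟_ F₀ (E ++ Z) F-unique
          (≤-trans (s≤s (≤-reflexive (trans (length-++ E) (cong (_+ length Z) l)))) (≤-trans le (≤-reflexive (sym F-length))))
  ... | v , _ , v∉ = v ∷ E , cong suc l , All.tabulate (λ { i refl → v∉ i }) ∷ uE

  walk-vertices : ∀ {x y} (w : Walk T x y) → ∃[ r ] vertices w ≡ x ∷ r × Last y (x ∷ r) × IsPath _⇒_ (x ∷ r)
  walk-vertices [ x ] = [] , refl , sole , λ { (later ()) }
  walk-vertices (step x a w) with walk-vertices w
  ... | r , e , l , p = vertices w , refl , later (subst (Last _) (sym e) l) , go e p
    where
    go : ∀ {xs} → xs ≡ _ ∷ r → IsPath _⇒_ (_ ∷ r) → IsPath _⇒_ (x ∷ xs)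
    go refl p now = a
    go refl p (later c) = p c

  record Interior {x y} (P : Path T x y) : Set where
    constructor interior
    field
      mid   : List V
      shape : vertices (walk P) ≡ x ∷ mid ∷ʳ y
      ⇒path : IsPath _⇒_ (x ∷ mid ∷ʳ y)

  interior-of : ∀ {x y} (P : Path T x y) → x ≢ y → Interior P
  interior-of {x} {y} P ne with walk-vertices (walk P)
  ... | [] , e , sole , p = ⊥-elim (ne refl)
  ... | [] , e , later () , p
  ... | z ∷ r , e , later l , p with last-snoc l
  ... | m , e′ = interior m (trans e (cong (x ∷_) e′)) (subst (λ z → IsPath _⇒_ (x ∷ z)) e′ p)

  -- Links have distinct sources, so the source alone can index the interiors. The interior comes
  -- last, which makes `laid` with empty interiors agree definitionally with `ends₂`.
  laid : (V → List V) → V × V → List V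
  laid mid (x , y) = x ∷ y ∷ mid x

  link-all : ∀ (ps : List (V × V)) → Linked T (length ps) → Unique (concatMap ends₂ ps) →
    ∃[ mid ] Unique (concatMap (laid mid) ps) × (∀ {x y} → (x , y) ∈ ps → IsPath _⇒_ (x ∷ mid x ∷ʳ y))
  link-all ps (_ , link) u = mid , unique′ , λ i → paths (∈-index i)
    where
    I = Fin (length ps)
    xs ys : I → V
    xs i = proj₁ (lookup ps i)
    ys i = proj₂ (lookup ps i)
    x-inj : Injective _≡_ _≡_ xs
    x-inj {i} {j} e = unique-concatMap⁻ ends₂ ps u i j (here refl) (here e)
    y-inj : Injective _≡_ _≡_ ys
    y-inj {i} {j} e = unique-concatMap⁻ ends₂ ps u i j (there (here refl)) (there (here e))
    xi≢yi : ∀ i → xs i ≢ ys i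
    xi≢yi i with unique-concatMap-at ends₂ ps u (∈-lookup i)
    ... | (ne ∷ _) ∷ _ = ne
    x≢y : ∀ i j → xs i ≢ ys j
    x≢y i j e with unique-concatMap⁻ ends₂ ps u i j (here refl) (there (here e))
    ... | refl = xi≢yi i e
    L = link xs ys x-inj y-inj x≢y
    P = proj₁ L
    int : ∀ i → Interior (P i)
    int i = interior-of (P i) (xi≢yi i)
    mid : V → List V
    mid v with Fin.any? (λ i → v Fin.≟ xs i)
    ... | yes (i , _) = Interior.mid (int i)
    -- A placeholder at vertices that are the source of no link.
    ... | no _ = []
    mid-xs : ∀ i → mid (xs i) ≡ Interior.mid (int i)
    mid-xs i with Fin.any? (λ j → xs i Fin.≟ xs j)
    ... | yes (j , e) = cong (Interior.mid ∘ int) (sym (x-inj e))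
    ... | no n = ⊥-elim (n (i , refl))
    ∈-index : ∀ {p} {ps : List (V × V)} → p ∈ ps → ∃[ i ] p ≡ lookup ps i
    ∈-index (here e) = fzero , e
    ∈-index (there i) with ∈-index i
    ... | j , e = fsuc j , e
    paths : ∀ {x y} → ∃[ i ] (x , y) ≡ lookup ps i → IsPath _⇒_ (x ∷ mid x ∷ʳ y)
    paths (i , refl) = subst (λ z → IsPath _⇒_ (xs i ∷ z ∷ʳ ys i)) (sym (mid-xs i)) (Interior.⇒path (int i))
    laid↭ : ∀ i → vertices (walk (P i)) ↭ laid mid (lookup ps i)
    laid↭ i = ↭-trans (↭-reflexive (trans (Interior.shape (int i)) (cong (λ z → xs i ∷ z ∷ʳ ys i) (sym (mid-xs i)))))
             (prep (xs i) (++-comm (mid (xs i)) (ys i ∷ [])))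
    unique′ : Unique (concatMap (laid mid) ps)
    unique′ = subst Unique eq (unique-concatMap (laid mid ∘ lookup ps) (allFin (length ps)) (Uniq.allFin⁺ _)
        (λ {i} _ → Unique-↭ (laid↭ i) (distinct (P i)))
        (λ {i} {j} {v} _ _ p q → proj₂ L i j v (∈-resp-↭ (↭-sym (laid↭ i)) p) (∈-resp-↭ (↭-sym (laid↭ j)) q)))
      where
      eq : concatMap (laid mid ∘ lookup ps) (allFin (length ps)) ≡ concatMap (laid mid) ps
      eq = trans (sym (concatMap-map (laid mid) (lookup ps) (allFin (length ps))))
             (cong (concatMap (laid mid)) (trans (map-tabulate id (lookup ps)) (tabulate-lookup ps)))

  Links : List (V × V) → List V → Set
  Links ps W = ∃[ mid ] Unique (concatMap (laid mid) ps ++ W) ×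
                        (∀ {x y} → (x , y) ∈ ps → IsPath _⇒_ (x ∷ mid x ∷ʳ y))

  -- Every vertex of `W` is an end of a link in `qs`, and those links are disjoint from the links in
  -- `ps`.
  drop-links : ∀ ps qs W E → concatMap ends₂ qs ≡ W ++ E → Unique (concatMap ends₂ ps ++ W) →
    ∃[ mid ] Unique (concatMap (laid mid) (ps ++ qs)) × (∀ {x y} → (x , y) ∈ ps ++ qs → IsPath _⇒_ (x ∷ mid x ∷ʳ y)) →
    Links ps W
  drop-links ps qs W E eq u (mid , u′ , paths) = mid ,
        unique-++ (unique-++ˡ (concatMap (laid mid) ps) u″) (unique-++ʳ (concatMap ends₂ ps) u)
          (λ i j → unique-disjoint (concatMap (laid mid) ps) u″ i (W⊆ j)) ,
        λ i → paths (∈-++⁺ˡ i)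
    where
    u″ : Unique (concatMap (laid mid) ps ++ concatMap (laid mid) qs)
    u″ = subst Unique (concatMap-++ (laid mid) ps qs) u′
    W⊆ : ∀ {v} → v ∈ W → v ∈ concatMap (laid mid) qs
    W⊆ {v} i with ∈-concatMap ends₂ qs (subst (v ∈_) (sym eq) (∈-++⁺ˡ i))
    ... | q , q∈ , here e = ∈-concatMap⁺ (laid mid) q∈ (here e)
    ... | q , q∈ , there (here e) = ∈-concatMap⁺ (laid mid) q∈ (there (here e))

  link-filled : ∀ {ℓ} → Linked T ℓ → ∀ ps W t E → length ps + length W + t ≡ ℓ →
    length E ≡ length W + (t + t) → Unique (E ++ concatMap ends₂ ps ++ W) →
    ∃[ qs ] length qs ≡ length W + t × concatMap ends₂ qs ≡ W ++ E → Links ps W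
  link-filled lk ps W t E refl lE uE (qs , lq , eq) =
    drop-links ps qs W E eq (unique-++ʳ E uE) (link-all (ps ++ qs)
      (subst (Linked T) (trans (+-assoc (length ps) _ t) (sym (trans (length-++ ps) (cong (length ps +_) lq)))) lk)
      (subst Unique (sym (trans (concatMap-++ ends₂ ps qs) (cong (concatMap ends₂ ps ++_) eq)))
        (Unique-↭ (bag 3 (λ e p w → e ⊕ p ⊕ w ⊜ p ⊕ w ⊕ e) ↭-refl E (concatMap ends₂ ps) W) uE)))

  -- Linked speaks about exactly ℓ pairs, so W is used up by pairing its vertices with each other and with
  -- arbitrary further vertices.
  link-avoiding : ∀ {ℓ} → Linked T ℓ → (ps : List (V × V)) (W : List V) → Unique (concatMap ends₂ ps ++ W) →
    length ps + length W ≤ ℓ → Links ps W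
  link-avoiding {ℓ} lk ps W u le = slack (m≤n⇒∃[o]m+o≡n le)
    where
    slack : ∃[ t ] length ps + length W + t ≡ ℓ → Links ps W
    slack (t , eq) = filled (fill (length W + (t + t)) (concatMap ends₂ ps ++ W) u (≤-trans (≤-reflexive total-length) (proj₁ lk)))
      where
      arith : ∀ p w t → w + (t + t) + (p + p + w) ≡ (p + w + t) + (p + w + t)
      arith = solve-∀
      arith′ : ∀ w t → w + (w + (t + t)) ≡ (w + t) + (w + t)
      arith′ = solve-∀
      total-length : length W + (t + t) + length (concatMap ends₂ ps ++ W) ≡ ℓ + ℓ
      total-length = trans (cong (length W + (t + t) +_) (trans (length-++ (concatMap ends₂ ps)) (cong (_+ length W) (length-ends₂ ps))))
           (trans (arith (length ps) (length W) t) (cong₂ _+_ eq eq))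
      filled : ∃[ E ] length E ≡ length W + (t + t) × Unique (E ++ concatMap ends₂ ps ++ W) → Links ps W
      filled (E , lE , uE) = link-filled lk ps W t E eq lE uE (pair-up (length W + t) (W ++ E)
        (trans (length-++ W) (trans (cong (length W +_) lE) (arith′ (length W) t))))

-- Minimum degrees and covering arcs

module Covering {n : ℕ} (T : Tournament n) {ℓ : ℕ} (linked : Linked T ℓ) (ℓ≥1 : 1 ≤ ℓ) where

  open Linking T
  open IsTournament tour

  outs ins : V → List V
  outs v = filter (T? v) F₀
  ins v = filter (λ u → T? u v) F₀

  outs⇒ : ∀ {v u} → u ∈ outs v → v ⇒ u
  outs⇒ {v} i = proj₂ (∈-filter⁻ (T? v) {xs = F₀} i)

  ins⇒ : ∀ {v u} → u ∈ ins v → u ⇒ v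
  ins⇒ {v} i = proj₂ (∈-filter⁻ (λ u → T? u v) {xs = F₀} i)

  fresh : ∀ v (N : List V) → length N < ℓ → ∃[ y ] y ∉ v ∷ N
  fresh v N lt with pick Fin._≟_ F₀ (v ∷ N) F-unique
    (≤-trans (s≤s lt) (≤-trans (+-monoˡ-≤ ℓ ℓ≥1) (≤-trans (proj₁ linked) (≤-reflexive (sym F-length)))))
  ... | y , _ , n = y , n

  -- If fewer than ℓ vertices formed the out-neighbourhood `N` of `v`, there would be a path from
  -- `v` to some `y` outside `N` with interior avoiding `N`; but the vertex after `v` on it is an
  -- out-neighbour, and it is either `y` or interior.
  min-out : ∀ v → ℓ ≤ length (outs v)
  min-out v with ℓ ≤? length (outs v)
  ... | yes le = le
  ... | no nle = ⊥-elim (contra (fresh v (outs v) (≰⇒> nle)))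
    where
    N = outs v
    contra : ∃[ y ] y ∉ v ∷ N → ⊥
    contra (y , y∉) = refute (link-avoiding linked ((v , y) ∷ []) N
        (((λ { refl → y∉ (here refl) }) ∷ All.tabulate (λ { i refl → asym (outs⇒ i) (outs⇒ i) }))
          ∷ All.tabulate (λ { i refl → y∉ (there i) }) ∷ Uniq.filter⁺ (T? v) F-unique) (≰⇒> nle))
      where
      refute : Links ((v , y) ∷ []) N → ⊥
      refute (mid , u , p) = go (mid v) u (p (here refl))
        where
        go : ∀ m → Unique ((v ∷ y ∷ m ++ []) ++ N) → IsPath _⇒_ (v ∷ m ∷ʳ y) → ⊥
        go [] u p = y∉ (there (∈-filter⁺ (T? v) (F-all y) (p now)))
        go (z ∷ m) u p = unique-disjoint (v ∷ y ∷ z ∷ m ++ []) u (there (there (here refl)))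
                           (∈-filter⁺ (T? v) (F-all z) (p now))

  min-in : ∀ v → ℓ ≤ length (ins v)
  min-in v with ℓ ≤? length (ins v)
  ... | yes le = le
  ... | no nle = ⊥-elim (contra (fresh v (ins v) (≰⇒> nle)))
    where
    N = ins v
    contra : ∃[ y ] y ∉ v ∷ N → ⊥
    contra (y , y∉) = refute (link-avoiding linked ((y , v) ∷ []) N
        (((λ { refl → y∉ (here refl) }) ∷ All.tabulate (λ { i refl → y∉ (there i) }))
          ∷ All.tabulate (λ { i refl → asym (ins⇒ i) (ins⇒ i) }) ∷ Uniq.filter⁺ (λ u → T? u v) F-unique) (≰⇒> nle))
      where
      refute : Links ((y , v) ∷ []) N → ⊥
      refute (mid , u , p) = go (last? y (mid y))
        where
        in-laid : ∀ {z} → z ∈ y ∷ mid y → z ∈ y ∷ v ∷ mid y ++ []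
        in-laid (here e) = here e
        in-laid (there i) = there (there (∈-++⁺ˡ i))
        go : ∃[ z ] Last z (y ∷ mid y) → ⊥
        go (z , l) = unique-disjoint (y ∷ v ∷ mid y ++ []) u (in-laid (last∈ l))
          (∈-filter⁺ (λ u → T? u v) (F-all z) (p (here refl) (con-++ᵐ l first)))

  -- N⁻(v) and N⁺(v) partition the other vertices, so a path from the former to the latter crosses over.
  turning-arc : ∀ {v t} x r → (∀ {u} → u ∈ x ∷ r → u ≢ v) → x ⇒ v → Last t (x ∷ r) → v ⇒ t →
    ∃[ u ] ∃[ w ] Con u w (x ∷ r) × u ⇒ v × v ⇒ w
  turning-arc x [] ne xv sole vt = ⊥-elim (asym xv vt)
  turning-arc x (z ∷ r) ne xv (later l) vt with either (ne (there (here refl)))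
  ... | inj₂ vz = x , z , now , xv , vz
  ... | inj₁ zv with turning-arc z r (ne ∘ there) zv l vt
  ... | u , w , c , uv , vw = u , w , later c , uv , vw

  CoverArc : V → V × V → Set
  CoverArc v (x , y) = x ⇒ v × v ⇒ y × x ⇒ y

  -- The minimum degrees give an in-neighbour and an out-neighbour of `v` outside `W`. A path
  -- between them that avoids `W` also misses `v`, as `v` lies in `W`; the arc on which it changes
  -- from in- to out-neighbours is the one wanted.
  cover-arc : ∀ v W → v ∈ W → Unique W → length W < ℓ → ∃[ p ] CoverArc v p × Unique (ends₂ p ++ W)
  cover-arc v W v∈ uW lt = go (pick Fin._≟_ (ins v) W (Uniq.filter⁺ (λ u → T? u v) F-unique) (≤-trans lt (min-in v)))
                              (pick Fin._≟_ (outs v) W (Uniq.filter⁺ (T? v) F-unique) (≤-trans lt (min-out v)))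
    where
    go : ∃[ s ] s ∈ ins v × s ∉ W → ∃[ t ] t ∈ outs v × t ∉ W → ∃[ p ] CoverArc v p × Unique (ends₂ p ++ W)
    go (s , s∈ , s∉) (t , t∈ , t∉) = route (link-avoiding linked ((s , t) ∷ []) W
        (((λ { refl → asym (ins⇒ s∈) (outs⇒ t∈) }) ∷ All.tabulate (λ { i refl → s∉ i }))
          ∷ All.tabulate (λ { i refl → t∉ i }) ∷ uW) lt)
      where
      route : Links ((s , t) ∷ []) W → ∃[ p ] CoverArc v p × Unique (ends₂ p ++ W)
      route (mid , u , p) = turn (turning-arc s (mid s ∷ʳ t) (λ { i refl → avoid i v∈ }) (ins⇒ s∈) (last-∷ʳ (s ∷ mid s)) (outs⇒ t∈))
        where
        laid∈ : ∀ {w} → w ∈ s ∷ mid s ∷ʳ t → w ∈ s ∷ t ∷ mid s ++ []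
        laid∈ (here e) = here e
        laid∈ (there i) = [ (λ j → there (there (∈-++⁺ˡ j))) , (λ { (here e) → there (here e) }) ]′ (∈-++⁻ (mid s) i)
        avoid : ∀ {w} → w ∈ s ∷ mid s ∷ʳ t → w ∉ W
        avoid i = unique-disjoint (s ∷ t ∷ mid s ++ []) u (laid∈ i)
        turn : ∃[ x ] ∃[ y ] Con x y (s ∷ mid s ∷ʳ t) × x ⇒ v × v ⇒ y → ∃[ p ] CoverArc v p × Unique (ends₂ p ++ W)
        turn (x , y , c , xv , vy) = (x , y) , (xv , vy , xy) ,
            ((λ { refl → asym xy xy }) ∷ All.tabulate (λ { i refl → avoid (con∈ˡ c) i }))
            ∷ All.tabulate (λ { i refl → avoid (con∈ c) i }) ∷ uW
          where
          xy : x ⇒ y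
          xy = p (here refl) c

  CoverArcs : List V → List V → Set
  CoverArcs L ks = ∃[ f ] Unique (concatMap (ends₂ ∘ f) ks ++ L) × (∀ {v} → v ∈ ks → CoverArc v (f v))

  update : (V → V × V) → V → V × V → V → V × V
  update f k p j with j Fin.≟ k
  ... | yes _ = p
  ... | no _ = f j

  update-at : ∀ f k p → update f k p k ≡ p
  update-at f k p with k Fin.≟ k
  ... | yes _ = refl
  ... | no n = ⊥-elim (n refl)

  update-else : ∀ f k p {j} → j ≢ k → update f k p j ≡ f j
  update-else f k p {j} ne with j Fin.≟ k
  ... | yes e = ⊥-elim (ne e)
  ... | no _ = refl

  length-ends₂∘ : ∀ (f : V → V × V) ks → length (concatMap (ends₂ ∘ f) ks) ≡ length ks + length ks
  length-ends₂∘ f [] = refl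
  length-ends₂∘ f (k ∷ ks) = cong suc (trans (cong suc (length-ends₂∘ f ks)) (sym (+-suc _ _)))

  -- One vertex after another, avoiding the arcs found before. `ks` is kept apart from `L` so that
  -- the induction can run over `ks` while all of `L` stays reserved.
  cover-arcs : ∀ L ks → Unique L → Unique ks → (∀ {v} → v ∈ ks → v ∈ L) → length ks + length ks + length L < ℓ →
    CoverArcs L ks
  -- The pair (v , v) is a placeholder at vertices without a chosen arc.
  cover-arcs L [] uL _ _ _ = (λ v → v , v) , uL , λ ()
  cover-arcs L (k ∷ ks) uL (k∉ ∷ uk) sub lt = extend (cover-arcs L ks uL uk (sub ∘ there) smaller)
    where
    smaller : length ks + length ks + length L < ℓ
    smaller = ≤-trans (s≤s (+-monoˡ-≤ (length L) (+-mono-≤ (n≤1+n (length ks)) (n≤1+n (length ks))))) lt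
    extend : CoverArcs L ks → CoverArcs L (k ∷ ks)
    extend (f , u , cov) = add (cover-arc k (concatMap (ends₂ ∘ f) ks ++ L) (∈-++⁺ʳ _ (sub (here refl))) u
        (≤-trans (s≤s (≤-reflexive (trans (length-++ (concatMap (ends₂ ∘ f) ks)) (cong (_+ length L) (length-ends₂∘ f ks))))) smaller))
      where
      add : ∃[ p ] CoverArc k p × Unique (ends₂ p ++ concatMap (ends₂ ∘ f) ks ++ L) → CoverArcs L (k ∷ ks)
      add (p , cp , up) = f′ , subst (λ z → Unique (z ++ L)) (sym (cong₂ _++_ (cong ends₂ (update-at f k p)) (same ks id))) up , cov′
        where
        f′ = update f k p
        f′j : ∀ {j} → j ∈ ks → f′ j ≡ f j
        f′j i = update-else f k p λ { refl → All.lookup k∉ i refl }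
        same : ∀ js → (∀ {j} → j ∈ js → j ∈ ks) → concatMap (ends₂ ∘ f′) js ≡ concatMap (ends₂ ∘ f) js
        same [] s = refl
        same (j ∷ js) s = cong₂ _++_ (cong ends₂ (f′j (s (here refl)))) (same js (s ∘ there))
        cov′ : ∀ {v} → v ∈ k ∷ ks → CoverArc v (f′ v)
        cov′ (here refl) = subst (CoverArc k) (sym (update-at f k p)) cp
        cov′ (there i) = subst (CoverArc _) (sym (f′j i)) (cov i)

concatMap-↭-cong : ∀ {A B : Set} {f g : A → List B} → (∀ x → f x ↭ g x) → ∀ xs → concatMap f xs ↭ concatMap g xs
concatMap-↭-cong h [] = ↭-refl
concatMap-↭-cong h (x ∷ xs) = ++⁺ (h x) (concatMap-↭-cong h xs)

concatMap-zip : ∀ {A B : Set} (f g : A → List B) xs → concatMap (λ x → f x ++ g x) xs ↭ concatMap f xs ++ concatMap g xs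
concatMap-zip f g [] = ↭-refl
concatMap-zip f g (x ∷ xs) = ↭-trans (++⁺ˡ (f x ++ g x) (concatMap-zip f g xs))
  (bag 4 (λ a b c d → (a ⊕ b) ⊕ c ⊕ d ⊜ (a ⊕ c) ⊕ b ⊕ d) ↭-refl (f x) (g x) (concatMap f xs) (concatMap g xs))

concatMap-concatMap : ∀ {A B C : Set} (h : B → List C) (g : A → List B) xs →
  concatMap h (concatMap g xs) ≡ concatMap (concatMap h ∘ g) xs
concatMap-concatMap h g [] = refl
concatMap-concatMap h g (x ∷ xs) = trans (concatMap-++ h (g x) (concatMap g xs)) (cong (concatMap h (g x) ++_) (concatMap-concatMap h g xs))

length-concatMap-≤ : ∀ {A B C : Set} (f : A → List B) (g : A → List C) → (∀ x → length (f x) ≤ length (g x)) →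
  ∀ xs → length (concatMap f xs) ≤ length (concatMap g xs)
length-concatMap-≤ f g h [] = z≤n
length-concatMap-≤ f g h (x ∷ xs) = ≤-trans (≤-reflexive (length-++ (f x)))
  (≤-trans (+-mono-≤ (h x) (length-concatMap-≤ f g h xs)) (≤-reflexive (sym (length-++ (g x)))))

path-glue : ∀ {V : Set} {R : V → V → Set} xs {a ys} → IsPath R (xs ∷ʳ a) → IsPath R (a ∷ ys) → IsPath R (xs ++ a ∷ ys)
path-glue {R = R} xs {a} {ys} p q c = path-++ (xs ∷ʳ a) p (λ d → q (later d))
  (λ l h → subst (λ z → R z _) (sym (last-∷ʳ⁻ xs l)) (q (hd h))) (subst (Con _ _) (sym (++-assoc xs (a ∷ []) ys)) c)
  where
  hd : ∀ {v} → Head v ys → Con a v (a ∷ ys)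
  hd first = now

-- Strands

module Chains {n : ℕ} (T : Tournament n) (cov : Fin n → Fin n × Fin n) where

  open Linking T
  open JointPair using (vs; A; B)

  cx cy : V → V
  cx = proj₁ ∘ cov
  cy = proj₂ ∘ cov

  -- A strand passes from `a` through the covering arcs of all vertices of `ks` in turn and on to
  -- `b`. The links are the gaps between these arcs, and all of them are filled by one application
  -- of linkedness.
  chain-links : V → List V → V → List (V × V)
  chain-links a [] b = (a , b) ∷ []
  chain-links a (v ∷ ks) b = (a , cx v) ∷ chain-links (cy v) ks b

  chain : (V → List V) → V → List V → List V
  chain mid a [] = mid a
  chain mid a (v ∷ ks) = mid a ++ cx v ∷ cy v ∷ chain mid (cy v) ks

  links : JointPair V → List (V × V)
  links o = chain-links (JointPair.a o) (vs o) (JointPair.b o)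

  -- The joint vertices that are no end of a link; the links have to be told to avoid them.
  others : JointPair V → List V
  others o = JointPair.A₀ o ++ JointPair.B₀ o

  inner : (V → List V) → JointPair V → List V
  inner mid o = chain mid (JointPair.a o) (vs o)

  whole : (V → List V) → JointPair V → List V
  whole mid o = A o ++ inner mid o ++ B o

  chain-↭ : ∀ mid a ks b → concatMap (laid mid) (chain-links a ks b) ↭ a ∷ chain mid a ks ∷ʳ b
  chain-↭ mid a [] b = bag 3 (λ a b m → (a ⊕ b ⊕ m) ⊕ ∅ ⊜ a ⊕ m ⊕ b) ↭-refl [ a ]ₗ [ b ]ₗ (mid a)
  chain-↭ mid a (v ∷ ks) b = ↭-trans (++⁺ˡ (a ∷ cx v ∷ mid a) (chain-↭ mid (cy v) ks b))
    (bag 6 (λ a x m y c b → (a ⊕ x ⊕ m) ⊕ y ⊕ c ⊕ b ⊜ a ⊕ (m ⊕ x ⊕ y ⊕ c) ⊕ b) ↭-refl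
      [ a ]ₗ [ cx v ]ₗ (mid a) [ cy v ]ₗ (chain mid (cy v) ks) [ b ]ₗ)

  whole-↭ : ∀ mid o → concatMap (laid mid) (links o) ++ others o ↭ whole mid o
  whole-↭ mid o@(jointPair A₀ a b B₀ _ _) = ↭-trans (++⁺ʳ (others o) (chain-↭ mid a (vs o) b))
    (bag 5 (λ A₀ a b B₀ c → (a ⊕ c ⊕ b) ⊕ A₀ ⊕ B₀ ⊜ (A₀ ⊕ a) ⊕ c ⊕ b ⊕ B₀) ↭-refl A₀ [ a ]ₗ [ b ]ₗ B₀ (inner mid o))

  chain-empty : ∀ a ks → chain (λ _ → []) a ks ≡ concatMap (ends₂ ∘ cov) ks
  chain-empty a [] = refl
  chain-empty a (v ∷ ks) = cong (λ z → cx v ∷ cy v ∷ z) (chain-empty (cy v) ks)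

  all-↭ : ∀ mid os → concatMap (laid mid) (concatMap links os) ++ concatMap others os ↭ concatMap (whole mid) os
  all-↭ mid os = ↭-trans (↭-reflexive (cong (_++ concatMap others os) (concatMap-concatMap (laid mid) links os)))
    (↭-trans (↭-sym (concatMap-zip (concatMap (laid mid) ∘ links) others os)) (concatMap-↭-cong (whole-↭ mid) os))

  -- With empty interiors the strands consist of the joints and the covering arcs, whose
  -- distinctness is known before linking; this yields the distinctness that the linking asks for.
  bare-↭ : ∀ os → concatMap (ends₂ ∘ cov) (concatMap vs os) ++ concatMap vs os ↭ concatMap (whole (λ _ → [])) os
  bare-↭ os = ↭-trans (↭-reflexive (cong (_++ concatMap vs os) (concatMap-concatMap (ends₂ ∘ cov) vs os)))
    (↭-trans (↭-sym (concatMap-zip (concatMap (ends₂ ∘ cov) ∘ vs) vs os)) (concatMap-↭-cong one os))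
    where
    one : ∀ o → concatMap (ends₂ ∘ cov) (vs o) ++ vs o ↭ whole (λ _ → []) o
    one o = ↭-trans (bag 3 (λ c a b → c ⊕ a ⊕ b ⊜ a ⊕ c ⊕ b) ↭-refl (concatMap (ends₂ ∘ cov) (vs o)) (A o) (B o))
      (↭-reflexive (cong (λ z → A o ++ z ++ B o) (sym (chain-empty (JointPair.a o) (vs o)))))

  length-links : ∀ os → length (concatMap links os) ≤ length os + length (concatMap vs os)
  length-links [] = z≤n
  length-links (o ∷ os) = ≤-trans (≤-reflexive (trans (length-++ (links o)) (cong (_+ length (concatMap links os)) (len (JointPair.a o) (vs o)))))
    (≤-trans (+-monoʳ-≤ (suc (length (vs o))) (length-links os))
      (≤-reflexive (trans (arith (length (vs o)) (length os) (length (concatMap vs os)))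
        (cong (suc (length os) +_) (sym (length-++ (vs o)))))))
    where
    len : ∀ a ks → length (chain-links a ks (JointPair.b o)) ≡ suc (length ks)
    len a [] = refl
    len a (v ∷ ks) = cong suc (len (cy v) ks)
    arith : ∀ x y z → suc x + (y + z) ≡ suc y + (x + z)
    arith = solve-∀

  length-others : ∀ os → length (concatMap others os) ≤ length (concatMap vs os)
  length-others = length-concatMap-≤ others vs λ { (jointPair A₀ a b B₀ _ _) →
    ≤-trans (≤-reflexive (length-++ A₀)) (≤-trans (+-mono-≤ (≤-trans (m≤m+n _ 1) (≤-reflexive (sym (length-++ A₀)))) (n≤1+n _))
      (≤-reflexive (sym (length-++ (A₀ ∷ʳ a))))) }

  link-joints : ∀ {ℓ} → Linked T ℓ → ∀ os → Unique (concatMap (ends₂ ∘ cov) (concatMap vs os) ++ concatMap vs os) →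
    length os + length (concatMap vs os) + length (concatMap vs os) ≤ ℓ →
    ∃[ mid ] Unique (concatMap (whole mid) os) × (∀ {x y} → (x , y) ∈ concatMap links os → IsPath _⇒_ (x ∷ mid x ∷ʳ y))
  link-joints lk os u le = finish (link-avoiding lk (concatMap links os) (concatMap others os)
      (Unique-↭ (↭-trans (bare-↭ os) (↭-sym (all-↭ (λ _ → []) os))) u)
      (≤-trans (+-mono-≤ (length-links os) (length-others os)) le))
    where
    finish : Links (concatMap links os) (concatMap others os) →
      ∃[ mid ] Unique (concatMap (whole mid) os) × (∀ {x y} → (x , y) ∈ concatMap links os → IsPath _⇒_ (x ∷ mid x ∷ʳ y))
    finish (mid , u′ , p) = mid , Unique-↭ (all-↭ mid os) u′ , p

  chain-path : ∀ mid a ks b → (∀ {x y} → (x , y) ∈ chain-links a ks b → IsPath _⇒_ (x ∷ mid x ∷ʳ y)) →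
    (∀ {v} → v ∈ ks → cx v ⇒ cy v) → IsPath _⇒_ (a ∷ chain mid a ks ∷ʳ b)
  chain-path mid a [] b p q = p (here refl)
  chain-path mid a (v ∷ ks) b p q = λ c → path-glue (a ∷ mid a) (p (here refl)) tail (subst (Con _ _) eq c)
    where
    tail : IsPath _⇒_ (cx v ∷ cy v ∷ chain mid (cy v) ks ∷ʳ b)
    tail now = q (here refl)
    tail (later c) = chain-path mid (cy v) ks b (p ∘ there) (q ∘ there) c
    eq : a ∷ (mid a ++ cx v ∷ cy v ∷ chain mid (cy v) ks) ∷ʳ b ≡ (a ∷ mid a) ++ cx v ∷ cy v ∷ chain mid (cy v) ks ∷ʳ b
    eq = cong (a ∷_) (++-assoc (mid a) _ _)

  whole-path : ∀ mid o → IsPath _⇒_ (A o) → IsPath _⇒_ (B o) →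
    (∀ {x y} → (x , y) ∈ links o → IsPath _⇒_ (x ∷ mid x ∷ʳ y)) → (∀ {v} → v ∈ vs o → cx v ⇒ cy v) →
    IsPath _⇒_ (whole mid o)
  whole-path mid o@(jointPair A₀ a b B₀ _ _) pA pB p q = λ c → path-glue A₀ pA tail (subst (Con _ _) (++-assoc A₀ _ _) c)
    where
    tail : IsPath _⇒_ (a ∷ inner mid o ++ b ∷ B₀)
    tail = path-glue (a ∷ inner mid o) (chain-path mid a (vs o) b p q) pB

  chain-covers : ∀ mid a ks {v} → v ∈ ks → Con (cx v) (cy v) (chain mid a ks)
  chain-covers mid a (v ∷ ks) (here refl) = con-++ʳ (mid a) now
  chain-covers mid a (v ∷ ks) (there i) = con-++ʳ (mid a) (later (later (chain-covers mid (cy v) ks i)))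

-- Degrees and exceptional sets in one packing step

unique-↭ : ∀ {V : Set} {xs ys : List V} → Unique xs → Unique ys → (∀ {v} → v ∈ xs → v ∈ ys) → (∀ {v} → v ∈ ys → v ∈ xs) → xs ↭ ys
unique-↭ {xs = []} {[]} _ _ _ _ = ↭-refl
unique-↭ {xs = []} {y ∷ ys} _ _ _ g with g (here refl)
... | ()
unique-↭ {V} {xs = x ∷ xs} {ys} (px ∷ ux) uy f g = go (extract (f (here refl)))
  where
  go : ∃[ zs ] ys ↭ x ∷ zs → x ∷ xs ↭ ys
  go (zs , p) = ↭-trans (prep x (unique-↭ ux (uzs (Unique-↭ p uy)) sub sup)) (↭-sym p)
    where
    uzs : Unique (x ∷ zs) → Unique zs
    uzs (_ ∷ u) = u
    x∉zs : Unique (x ∷ zs) → x ∉ zs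
    x∉zs (q ∷ _) i = All.lookup q i refl
    strip : ∀ {v : V} {ws} → v ≢ x → v ∈ x ∷ ws → v ∈ ws
    strip ne (here e) = ⊥-elim (ne e)
    strip ne (there i) = i
    sub : ∀ {v} → v ∈ xs → v ∈ zs
    sub i = strip (λ { refl → All.lookup px i refl }) (∈-resp-↭ p (f (there i)))
    sup : ∀ {v} → v ∈ zs → v ∈ xs
    sup i = strip (λ { refl → x∉zs (Unique-↭ p uy) i }) (g (∈-resp-↭ (↭-sym p) (there i)))

length-concatMap-bound : ∀ {A B : Set} (f : A → List B) d xs → (∀ {x} → x ∈ xs → length (f x) ≤ d) → length (concatMap f xs) ≤ length xs * d
length-concatMap-bound f d [] h = z≤n
length-concatMap-bound f d (x ∷ xs) h = ≤-trans (≤-reflexive (length-++ (f x)))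
  (+-mono-≤ (h (here refl)) (length-concatMap-bound f d xs (h ∘ there)))

-- Written as iterated doubling in order to agree definitionally with `m₁₆`, which the four rounds
-- produce.
sixteen : ℕ → ℕ
sixteen m = let m₂ = m + m ; m₄ = m₂ + m₂ ; m₈ = m₄ + m₄ in m₈ + m₈

-- At most r arcs at each vertex belong to F.
record Forbid (V : Set) (r : ℕ) : Set₁ where
  field
    F      : V → V → Set
    F?     : ∀ u v → Dec (F u v)
    nb     : V → List V
    nb-len : ∀ v → length (nb v) ≤ r
    nbˡ    : ∀ {u v} → F u v → u ∈ nb v
    nbʳ    : ∀ {u v} → F u v → v ∈ nb u

module Step {n : ℕ} (T : Tournament n) (cov : Fin n → Fin n × Fin n) (mid : Fin n → List (Fin n))
  (W Lall : List (Fin n)) (c d s β ℓ : ℕ)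
  (W-size : length W + s * d ≤ β) where

  open Linking T
  open IsTournament tour
  open Chains T cov
  open ChooseJoints Fin._≟_ tour F₀ F-unique F-all c using (GoodJoint; module GoodJoint)
  open JointPair using (vs; A; B; restA; restB)

  K : ℕ
  K = sixteen (suc d) + sixteen (suc d)

  triple : V → List V
  triple v = cx v ∷ v ∷ cy v ∷ []

  wholes triples joints : List (JointPair V) → List V
  wholes = concatMap (whole mid)
  joints = concatMap vs
  triples g = concatMap triple (joints g)

  outside : List (JointPair V) → List V
  outside g = filter (λ v → ¬? (mem? Fin._≟_ v (wholes g))) F₀

  -- The arcs of the strands, and those needed to put skipped joint vertices back. Each kind is read
  -- off one concatenated list without repetitions, where an element has at most one predecessor and
  -- one successor; the pairs at the seams are simply included.
  Reserved : List (JointPair V) → V → V → Set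
  Reserved g u v = Con u v (wholes g) ⊎ Con u v (triples g)

  record Ready (g : List (JointPair V)) : Set where
    field
      good           : ∀ {o} → o ∈ g → GoodJoint o Lall
      wholes-unique  : Unique (wholes g)
      triples-unique : Unique (triples g)
      wholes-path    : ∀ {o} → o ∈ g → IsPath _⇒_ (whole mid o)
      arcs           : ∀ {v} → v ∈ joints g → cx v ⇒ v × v ⇒ cy v
      cx-injective   : ∀ {u v} → u ∈ joints g → v ∈ joints g → cx u ≡ cx v → u ≡ v
      special        : ∀ {v} → v ∈ joints g → v ∈ W × cx v ∈ W × cy v ∈ W
      number         : length g ≡ sixteen (suc d)
      size           : length (joints g) ≤ s
      room           : suc d ≤ length (outside g)

  module _ (Lall⊆W : ∀ {v} → v ∈ Lall → v ∈ W)
    (min-out : ∀ v → ℓ ≤ outdeg _⇒_ T? F₀ v) (min-in : ∀ v → ℓ ≤ indeg _⇒_ T? F₀ v)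
    (large-c : sixteen (suc d) * 6 ≤ 2 ^ c)
    (large-ℓ : 2 * (β + (β + (β + (K + K))) + suc d) ≤ ℓ)
    {r : ℕ} (r≤d : r ≤ d) (forb : Forbid V r)
    (g : List (JointPair V)) (ready : Ready g)
    (allowed : ∀ {u v} → Reserved g u v → ¬ Forbid.F forb u v)
    where

    open Ready ready
    open Forbid forb

    R : V → V → Set
    R u v = u ⇒ v × ¬ F u v

    R? : ∀ u v → Dec (R u v)
    R? u v with T? u v | F? u v
    ... | yes p | no q = yes (p , q)
    ... | yes p | yes q = no λ (_ , nq) → nq q
    ... | no p | _ = no λ (q , _) → p q

    comparable : ∀ {u v} → u ≢ v → u ∉ nb v → R u v ⊎ R v u
    comparable ne n with either ne
    ... | inj₁ p = inj₁ (p , λ f → n (nbˡ f))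
    ... | inj₂ p = inj₂ (p , λ f → n (nbʳ f))

    L EA EB nbA nbB X Y : List V
    L = joints g
    EA = concatMap restA g
    EB = concatMap restB g
    nbA = concatMap nb (concatMap A g)
    nbB = concatMap nb (concatMap B g)
    -- A vertex may fail to enter some `A` because it is a joint vertex, for which domination is not
    -- claimed and which lies in `W`, because the arc is forbidden, which puts it into `nbA`, or
    -- because it is undominated, which puts it into `EA`.
    X = W ++ nbA ++ EA
    Y = W ++ nbB ++ EB

    open OneCycle Fin._≟_ R R? d nb (λ v → ≤-trans (nb-len v) r≤d) comparable F₀ L X Y cx cy F-unique F-all
      using (one-cycle; Degrees; outs; ins)
    open Pieces Fin._≟_ R F₀ L X Y cx cy using (Ok; ok; flat; Covers; full)
    open Assembly Fin._≟_ R F₀ L X Y cx cy using (jj)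

    strand : JointPair V → List V × List V × List V
    strand o = A o , inner mid o , B o

    us : List (List V × List V × List V)
    us = map strand g

    whole⊆ : ∀ {o u v} g → o ∈ g → Con u v (whole mid o) → Con u v (wholes g)
    whole⊆ (o ∷ g) (here refl) c = con-++ˡ _ c
    whole⊆ (o ∷ g) (there i) c = con-++ʳ (whole mid o) (whole⊆ g i c)

    triple⊆ : ∀ {k u v} ks → k ∈ ks → Con u v (triple k) → Con u v (concatMap triple ks)
    triple⊆ (k ∷ ks) (here refl) c = con-++ˡ _ c
    triple⊆ (k ∷ ks) (there i) c = con-++ʳ (triple k) (triple⊆ ks i c)

    us-ok : All Ok (map jj us)
    us-ok = go g id
      where
      startDom : ∀ {o x} → o ∈ g → x ∉ X → Any (R x) (A o)
      startDom {o} {x} i n with GoodJoint.domA (good i) {x} (λ j → n (∈-++⁺ˡ (Lall⊆W j)))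
      ... | inj₁ e = ⊥-elim (n (∈-++⁺ʳ W (∈-++⁺ʳ nbA (∈-concatMap⁺ restA i e))))
      ... | inj₂ q with find q
      ... | a , a∈ , xa = lose a∈ (xa , λ f → n (∈-++⁺ʳ W (∈-++⁺ˡ (∈-concatMap⁺ nb (∈-concatMap⁺ A i a∈) (nbˡ f)))))
      endDom : ∀ {o x} → o ∈ g → x ∉ Y → Any (λ b → R b x) (B o)
      endDom {o} {x} i n with GoodJoint.domB (good i) {x} (λ j → n (∈-++⁺ˡ (Lall⊆W j)))
      ... | inj₁ e = ⊥-elim (n (∈-++⁺ʳ W (∈-++⁺ʳ nbB (∈-concatMap⁺ restB i e))))
      ... | inj₂ q with find q
      ... | b , b∈ , bx = lose b∈ (bx , λ f → n (∈-++⁺ʳ W (∈-++⁺ˡ (∈-concatMap⁺ nb (∈-concatMap⁺ B i b∈) (nbʳ f)))))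
      go : ∀ h → (∀ {o} → o ∈ h → o ∈ g) → All Ok (map jj (map strand h))
      go [] _ = []
      go (o ∷ h) sub = ok (λ c → wholes-path i c , allowed (inj₁ (whole⊆ g i c)))
          (startDom i , λ j → ∈-concatMap⁺ vs i (∈-++⁺ˡ j))
          (endDom i , λ j → ∈-concatMap⁺ vs i (∈-++⁺ʳ (A o) j)) ∷ go h (sub ∘ there)
        where i = sub (here refl)

    us-flat : ∀ h → flat (map jj (map strand h)) ≡ wholes h
    us-flat [] = refl
    us-flat (o ∷ h) = cong (whole mid o ++_) (us-flat h)

    us-perm : flat (map jj us) ++ outside g ↭ F₀
    us-perm = ↭-trans (↭-reflexive (cong (_++ outside g) (us-flat g)))
      (unique-↭ (unique-++ wholes-unique (Uniq.filter⁺ out? F-unique) (λ i j → proj₂ (∈-filter⁻ out? {xs = F₀} j) i))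
        F-unique (λ _ → F-all _) (λ {v} _ → back v))
      where
      out? = λ v → ¬? (mem? Fin._≟_ v (wholes g))
      back : ∀ v → v ∈ wholes g ++ outside g
      back v with mem? Fin._≟_ v (wholes g)
      ... | yes i = ∈-++⁺ˡ i
      ... | no i = ∈-++⁺ʳ (wholes g) (∈-filter⁺ out? (F-all v) i)

    us-covers : ∀ {v} → v ∈ L → Covers (map jj us) v
    us-covers {v} i = go g (∈-concatMap vs g i)
      where
      go : ∀ h → ∃[ o ] o ∈ h × v ∈ vs o → Covers (map jj (map strand h)) v
      go (o ∷ h) (_ , here refl , j) = here (chain-covers mid (JointPair.a o) (vs o) j)
      go (o ∷ h) (_ , there i , j) = there (go h (_ , i , j))

    triangle : ∀ {v} → v ∈ L → R (cx v) v × R v (cy v)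
    triangle {v} i = (proj₁ (arcs i) , allowed (inj₂ (triple⊆ L i now))) ,
                     (proj₂ (arcs i) , allowed (inj₂ (triple⊆ L i (later now))))

    out-loss : ∀ w → outdeg _⇒_ T? F₀ w ≤ length (outs w) + d
    out-loss w = ≤-trans (unique-⊆-length (Uniq.filter⁺ (T? w) F-unique) sub)
      (≤-trans (≤-reflexive (length-++ (outs w))) (+-monoʳ-≤ (length (outs w)) (≤-trans (nb-len w) r≤d)))
      where
      sub : ∀ {v} → v ∈ filter (T? w) F₀ → v ∈ outs w ++ nb w
      sub {v} i with F? w v
      ... | yes f = ∈-++⁺ʳ (outs w) (nbʳ f)
      ... | no nf = ∈-++⁺ˡ (∈-filter⁺ (R? w) (F-all v) (proj₂ (∈-filter⁻ (T? w) {xs = F₀} i) , nf))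

    in-loss : ∀ w → indeg _⇒_ T? F₀ w ≤ length (ins w) + d
    in-loss w = ≤-trans (unique-⊆-length (Uniq.filter⁺ (λ u → T? u w) F-unique) sub)
      (≤-trans (≤-reflexive (length-++ (ins w))) (+-monoʳ-≤ (length (ins w)) (≤-trans (nb-len w) r≤d)))
      where
      sub : ∀ {v} → v ∈ filter (λ u → T? u w) F₀ → v ∈ ins w ++ nb w
      sub {v} i with F? v w
      ... | yes f = ∈-++⁺ʳ (ins w) (nbˡ f)
      ... | no nf = ∈-++⁺ˡ (∈-filter⁺ (λ u → R? u w) (F-all v) (proj₂ (∈-filter⁻ (λ u → T? u w) {xs = F₀} i) , nf))

    -- Each strand contributes at most D / 2^c vertices, and 2^c is at least six times the number of
    -- strands. The factor is six because up to three copies of an exceptional set are to be paid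
    -- for with half a degree.
    rest-bound : ∀ (rest : JointPair V → List V) D → (∀ {o} → o ∈ g → length (rest o) * 2 ^ c ≤ D) →
                 length (concatMap rest g) * 6 ≤ D
    rest-bound rest D h = *-cancelˡ-≤ (sixteen (suc d)) (≤-trans (≤-reflexive (arith (sixteen (suc d)) E))
        (≤-trans (*-monoʳ-≤ E large-c) (≤-trans (go g h) (≤-reflexive (cong (_* D) number)))))
      where
      E = length (concatMap rest g)
      arith : ∀ m e → m * (e * 6) ≡ e * (m * 6)
      arith = solve-∀
      go : ∀ h → (∀ {o} → o ∈ h → length (rest o) * 2 ^ c ≤ D) → length (concatMap rest h) * 2 ^ c ≤ length h * D
      go [] _ = z≤n
      go (o ∷ h) b = ≤-trans (≤-reflexive (trans (cong (_* 2 ^ c) (length-++ (rest o))) (*-distribʳ-+ (2 ^ c) (length (rest o)) _)))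
        (+-mono-≤ (b (here refl)) (go h (b ∘ there)))

    EA-bound : ∀ {w} → w ∉ W → length EA * 6 ≤ outdeg _⇒_ T? F₀ w
    EA-bound n = rest-bound restA _ λ i → GoodJoint.sizeA (good i) (n ∘ Lall⊆W)

    EB-bound : ∀ {w} → w ∉ W → length EB * 6 ≤ indeg _⇒_ T? F₀ w
    EB-bound n = rest-bound restB _ λ i → GoodJoint.sizeB (good i) (n ∘ Lall⊆W)

    W≤β : length W ≤ β
    W≤β = ≤-trans (m≤m+n _ _) W-size

    bad-bound : ∀ (side : JointPair V → List V) → (∀ o → length (side o) ≤ length (vs o)) → ∀ E →
                length (W ++ concatMap nb (concatMap side g) ++ E) ≤ β + length E
    bad-bound side h E = ≤-trans (≤-reflexive (trans (length-++ W) (trans (cong (length W +_) (length-++ (concatMap nb (concatMap side g)))) (sym (+-assoc (length W) _ _)))))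
      (+-monoˡ-≤ (length E) (≤-trans (+-monoʳ-≤ (length W)
        (≤-trans (length-concatMap-bound nb d (concatMap side g) (λ {v} _ → ≤-trans (nb-len v) r≤d))
          (*-monoˡ-≤ d (≤-trans (length-concatMap-≤ side vs h g) size)))) W-size))

    X-bound : length X ≤ β + length EA
    X-bound = bad-bound A (λ o → ≤-trans (m≤m+n _ _) (≤-reflexive (sym (length-++ (A o))))) EA

    Y-bound : length Y ≤ β + length EB
    Y-bound = bad-bound B (λ o → ≤-trans (m≤n+m _ (length (A o))) (≤-reflexive (sym (length-++ (A o))))) EB

    -- Twice the cost, including the at most `d` forbidden arcs, splits into a fixed part, which is
    -- at most ℓ and so at most D, and a part 6e, which is at most D as well.
    budget : ∀ e D x a b c → e * 6 ≤ D → ℓ ≤ D → D ≤ x + d → a ≤ β + e → b ≤ β + e → c ≤ β + e →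
             a + (b + (c + (K + K))) < x
    budget e D x a b c e≤ ℓ≤ D≤ ha hb hc = +-cancelʳ-≤ d _ _ (≤-trans (+-monoˡ-≤ d
        (s≤s (+-mono-≤ ha (+-mono-≤ hb (+-monoˡ-≤ (K + K) hc)))))
      (≤-trans (*-cancelˡ-≤ 2 (≤-trans (≤-reflexive (arith β e (K + K) d)) (≤-trans (+-mono-≤ (≤-trans large-ℓ ℓ≤) e≤)
         (≤-reflexive (cong (D +_) (sym (+-identityʳ D))))))) D≤))
      where
      arith : ∀ β e k d → 2 * (suc ((β + e) + ((β + e) + ((β + e) + k))) + d) ≡ 2 * (β + (β + (β + k)) + suc d) + e * 6
      arith = solve-∀

    degrees : Degrees W
    degrees = record
      -- For an arbitrary `w` only the minimum degree is available, so no exceptional set can be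
      -- paid for: e = 0.
      { out-W = λ w → budget 0 _ _ _ _ _ z≤n (min-out w) (out-loss w) w₀ w₀ w₀
      ; in-W = λ w → budget 0 _ _ _ _ _ z≤n (min-in w) (in-loss w) w₀ w₀ w₀
      ; out-in = by-size (≤-total (length EA) (length EB)) }
      where
      w₀ : length W ≤ β + 0
      w₀ = ≤-trans W≤β (m≤m+n β 0)
      we : ∀ e → length W ≤ β + e
      we e = ≤-trans W≤β (m≤m+n β e)
      by-size : length EA ≤ length EB ⊎ length EB ≤ length EA → _
      -- Out-degrees control `EA` and in-degrees control `EB`. The earlier round pays for its own
      -- exceptional set only; the later one creates both ends and starts in their final state, pays
      -- for both sets and must therefore own the larger.
      by-size (inj₁ le) = inj₁
        ((λ {w} n → budget (length EA) _ _ _ _ _ (EA-bound n) (min-out w) (out-loss w) X-bound X-bound (we (length EA))) ,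
         (λ {w} n → budget (length EB) _ _ _ _ _ (EB-bound n) (min-in w) (in-loss w) Y-bound (≤-trans X-bound (+-monoʳ-≤ β le)) Y-bound))
      by-size (inj₂ le) = inj₂
        ((λ {w} n → budget (length EB) _ _ _ _ _ (EB-bound n) (min-in w) (in-loss w) Y-bound (we (length EB)) Y-bound) ,
         (λ {w} n → budget (length EA) _ _ _ _ _ (EA-bound n) (min-out w) (out-loss w) X-bound X-bound (≤-trans Y-bound (+-monoʳ-≤ β le))))

    hamilton-cycle : ∃[ z ] ∃[ zs ] z ∷ zs ↭ F₀ × IsPath R (z ∷ zs ∷ʳ z)
    hamilton-cycle = one-cycle us us-ok (outside g) us-perm (trans (length-map strand g) number) room us-covers
      triangle cx-injective W degrees special ∈-++⁺ˡ ∈-++⁺ˡ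

-- Packing the cycles

module Forbids {V : Set} (_≟_ : DecidableEquality V) (F₀ : List V) (F-all : ∀ v → v ∈ F₀) where

  the-one : (P : V → Set) → (∀ v → Dec (P v)) → (∀ {u v} → P u → P v → u ≡ v) →
            ∃[ l ] length l ≤ 1 × (∀ {u} → P u → u ∈ l)
  the-one P P? one with any? P? F₀
  ... | no n = [] , z≤n , λ {u} p → ⊥-elim (n (lose (F-all u) p))
  ... | yes q with find q
  ... | v , _ , pv = v ∷ [] , s≤s z≤n , λ p → here (one p pv)

  none : Forbid V 0
  none = record { F = λ _ _ → ⊥ ; F? = λ _ _ → no id ; nb = λ _ → [] ; nb-len = λ _ → z≤n ; nbˡ = λ () ; nbʳ = λ () }

  _∪_ : ∀ {r s} → Forbid V r → Forbid V s → Forbid V (r + s)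
  _∪_ P Q = record
    { F = λ u v → P.F u v ⊎ Q.F u v
    ; F? = λ u v → P.F? u v ⊎-dec Q.F? u v
    ; nb = λ v → P.nb v ++ Q.nb v
    ; nb-len = λ v → ≤-trans (≤-reflexive (length-++ (P.nb v))) (+-mono-≤ (P.nb-len v) (Q.nb-len v))
    ; nbˡ = λ { (inj₁ f) → ∈-++⁺ˡ (P.nbˡ f) ; (inj₂ f) → ∈-++⁺ʳ (P.nb _) (Q.nbˡ f) }
    ; nbʳ = λ { (inj₁ f) → ∈-++⁺ˡ (P.nbʳ f) ; (inj₂ f) → ∈-++⁺ʳ (P.nb _) (Q.nbʳ f) }
    }
    where
    module P = Forbid P
    module Q = Forbid Q

  consecutive : ∀ xs → (∀ {u v w} → Con u v xs → Con u w xs → v ≡ w) →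
                (∀ {u v w} → Con u w xs → Con v w xs → u ≡ v) → Forbid V 2
  consecutive xs succ pred = record
    { F = λ u v → Con u v xs
    ; F? = λ u v → con? _≟_ u v xs
    ; nb = λ v → proj₁ (before v) ++ proj₁ (after v)
    ; nb-len = λ v → ≤-trans (≤-reflexive (length-++ (proj₁ (before v)))) (+-mono-≤ (proj₁ (proj₂ (before v))) (proj₁ (proj₂ (after v))))
    ; nbˡ = λ {u} {v} c → ∈-++⁺ˡ (proj₂ (proj₂ (before v)) c)
    ; nbʳ = λ {u} {v} c → ∈-++⁺ʳ (proj₁ (before u)) (proj₂ (proj₂ (after u)) c)
    }
    where
    before = λ v → the-one (λ u → Con u v xs) (λ u → con? _≟_ u v xs) pred
    after = λ v → the-one (λ u → Con v u xs) (λ u → con? _≟_ v u xs) succ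

  of-list : ∀ xs → Unique xs → Forbid V 2
  of-list xs u = consecutive xs (λ {u′} c d → con-succ-unique xs {u′} u (con-++ˡ _ c) (con-++ˡ _ d))
                                (λ {u′} c d → con-pred-unique {z = u′} xs u (later c) (later d))

  of-cycle : ∀ z zs → Unique (z ∷ zs) → Forbid V 2
  of-cycle z zs u = consecutive (z ∷ zs ∷ʳ z) (con-succ-unique (z ∷ zs) u)
    (con-pred-unique (zs ∷ʳ z) (Unique-↭ (++-comm (z ∷ []) zs) u))

module Pack {n : ℕ} (T : Tournament n) (cov : Fin n → Fin n × Fin n) (mid : Fin n → List (Fin n))
  (W Lall : List (Fin n)) (c d s β ℓ : ℕ)
  (W-size : length W + s * d ≤ β) where

  open Linking T
  open IsTournament tour
  open Chains T cov
  open Step T cov mid W Lall c d s β ℓ W-size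
  open Forbids Fin._≟_ F₀ F-all
  open JointPair using (vs; A; B)
  open Forbid using (F)

  CycleArc : V × List V → V → V → Set
  CycleArc (z , zs) u v = Con u v (z ∷ zs ∷ʳ z)

  IsCycle : V × List V → Set
  IsCycle (z , zs) = z ∷ zs ↭ F₀ × IsPath _⇒_ (z ∷ zs ∷ʳ z)

  Apart : List (JointPair V) → List (JointPair V) → Set
  Apart g h = ∀ {v} → v ∈ wholes g → v ∉ wholes h

  -- Knowing the source is enough to separate groups: covering arcs run inside the strands, so a
  -- pair reserved for two groups would start on strands of both.
  reserved-source : ∀ g {u v} → Reserved g u v → u ∈ wholes g
  reserved-source g (inj₁ c) = con∈ˡ c
  reserved-source g {u} (inj₂ c) = go (∈-concatMap triple (joints g) (con∈ˡ c))
    where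
    whole∈ : ∀ {o w} → o ∈ g → w ∈ whole mid o → w ∈ wholes g
    whole∈ = ∈-concatMap⁺ (whole mid)
    inner∈ : ∀ {o w} → o ∈ g → w ∈ inner mid o → w ∈ wholes g
    inner∈ {o} i j = whole∈ i (∈-++⁺ʳ (A o) (∈-++⁺ˡ j))
    go : ∃[ k ] k ∈ joints g × u ∈ triple k → u ∈ wholes g
    go (k , k∈ , j) = go′ (∈-concatMap vs g k∈) j
      where
      go′ : ∃[ o ] o ∈ g × k ∈ vs o → u ∈ triple k → u ∈ wholes g
      go′ (o , o∈ , i) (here refl) = inner∈ o∈ (con∈ˡ (chain-covers mid (JointPair.a o) (vs o) i))
      go′ (o , o∈ , i) (there (there (here refl))) = inner∈ o∈ (con∈ (chain-covers mid (JointPair.a o) (vs o) i))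
      go′ (o , o∈ , i) (there (here refl)) with ∈-++⁻ (A o) i
      ... | inj₁ j = whole∈ o∈ (∈-++⁺ˡ j)
      ... | inj₂ j = whole∈ o∈ (∈-++⁺ʳ (A o) (∈-++⁺ʳ (inner mid o) j))

  -- Four per group: the list of strands and the list of triples each give a vertex at most one
  -- predecessor and one successor.
  reserve : ∀ gs → All Ready gs → Forbid V (length gs * 4)
  reserve [] [] = none
  reserve (g ∷ gs) (r ∷ rs) = (of-list (wholes g) (Ready.wholes-unique r) ∪ of-list (triples g) (Ready.triples-unique r)) ∪ reserve gs rs

  reserve-sound : ∀ gs (rs : All Ready gs) {u v} → F (reserve gs rs) u v → ∃[ g ] g ∈ gs × Reserved g u v
  reserve-sound (g ∷ gs) (r ∷ rs) (inj₁ f) = g , here refl , f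
  reserve-sound (g ∷ gs) (r ∷ rs) (inj₂ f) with reserve-sound gs rs f
  ... | h , i , q = h , there i , q

  reserve-complete : ∀ gs (rs : All Ready gs) {g u v} → g ∈ gs → Reserved g u v → F (reserve gs rs) u v
  reserve-complete (g ∷ gs) (r ∷ rs) (here refl) q = inj₁ q
  reserve-complete (g ∷ gs) (r ∷ rs) (there i) q = inj₂ (reserve-complete gs rs i q)

  module _ (Lall⊆W : ∀ {v} → v ∈ Lall → v ∈ W)
    (min-out : ∀ v → ℓ ≤ outdeg _⇒_ T? F₀ v) (min-in : ∀ v → ℓ ≤ indeg _⇒_ T? F₀ v)
    (large-c : sixteen (suc d) * 6 ≤ 2 ^ c)
    (large-ℓ : 2 * (β + (β + (β + (K + K))) + suc d) ≤ ℓ)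
    where

    Packing : ∀ {r} → List (List (JointPair V)) → Forbid V r → Set
    Packing gs forb = Σ (Fin (length gs) → V × List V) λ Z → (∀ i → IsCycle (Z i)) ×
      (∀ i {u v} → CycleArc (Z i) u v → ¬ F forb u v) ×
      (∀ i j {u v} → CycleArc (Z i) u v → CycleArc (Z j) u v → i ≡ j)

    -- Building a cycle releases the four arcs per vertex of its own reservation and adds the two of
    -- the cycle to `r`, so `r + length gs * 4` does not grow and stays within `d`. Later
    -- reservations survive since the cycle avoided them.
    pack : ∀ gs {r} (forb : Forbid V r) → r + length gs * 4 ≤ d → All Ready gs → AllPairs Apart gs →
      (∀ {g} → g ∈ gs → ∀ {u v} → Reserved g u v → ¬ F forb u v) → Packing gs forb
    pack [] forb _ _ _ _ = (λ ()) , (λ ()) , (λ ()) , (λ ())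
    pack (g ∷ gs) {r} forb le (rg ∷ rs) (ap ∷ aps) al = finish
      (hamilton-cycle Lall⊆W min-out min-in large-c large-ℓ fewer now-forbidden g rg allowed)
      where
      now-forbidden : Forbid V (r + length gs * 4)
      now-forbidden = forb ∪ reserve gs rs
      fewer : r + length gs * 4 ≤ d
      fewer = ≤-trans (+-monoʳ-≤ r (m≤n+m _ 4)) le
      allowed : ∀ {u v} → Reserved g u v → ¬ F now-forbidden u v
      allowed q (inj₁ f) = al (here refl) q f
      allowed q (inj₂ f) = clash (reserve-sound gs rs f)
        where
        clash : ∃[ h ] h ∈ gs × Reserved h _ _ → ⊥
        clash (h , i , q′) = All.lookup ap i (reserved-source g q) (reserved-source h q′)
      finish : ∃[ z ] ∃[ zs ] z ∷ zs ↭ F₀ × IsPath (λ u v → u ⇒ v × ¬ F now-forbidden u v) (z ∷ zs ∷ʳ z) → Packing (g ∷ gs) forb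
      finish (z , zs , p , arc∈R) = combine (pack gs (forb ∪ arcs) fits rs aps al′)
        where
        arcs : Forbid V 2
        arcs = of-cycle z zs (Unique-↭ (↭-sym p) F-unique)
        fits : (r + 2) + length gs * 4 ≤ d
        fits = ≤-trans (≤-reflexive (+-assoc r 2 _)) (≤-trans (+-monoʳ-≤ r (m≤n+m (2 + length gs * 4) 2)) le)
        al′ : ∀ {h} → h ∈ gs → ∀ {u v} → Reserved h u v → ¬ F (forb ∪ arcs) u v
        al′ i q (inj₁ f) = al (there i) q f
        al′ i q (inj₂ f) = proj₂ (arc∈R f) (inj₂ (reserve-complete gs rs i q))
        combine : Packing gs (forb ∪ arcs) → Packing (g ∷ gs) forb
        combine (Z , cyc , av , dis) = Z′ , cyc′ , av′ , dis′
          where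
          Z′ : Fin (suc (length gs)) → V × List V
          Z′ fzero = z , zs
          Z′ (fsuc i) = Z i
          cyc′ : ∀ i → IsCycle (Z′ i)
          cyc′ fzero = p , λ c → proj₁ (arc∈R c)
          cyc′ (fsuc i) = cyc i
          av′ : ∀ i {u v} → CycleArc (Z′ i) u v → ¬ F forb u v
          av′ fzero c f = proj₂ (arc∈R c) (inj₁ f)
          av′ (fsuc i) c f = av i c (inj₁ f)
          dis′ : ∀ i j {u v} → CycleArc (Z′ i) u v → CycleArc (Z′ j) u v → i ≡ j
          dis′ fzero fzero _ _ = refl
          dis′ fzero (fsuc j) c e = ⊥-elim (av j e (inj₂ c))
          dis′ (fsuc i) fzero c e = ⊥-elim (av i c (inj₂ e))
          dis′ (fsuc i) (fsuc j) c e = cong fsuc (dis i j c e)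

-- Closed lists as permutations

lookup-injective : ∀ {V : Set} (xs : List V) → Unique xs → ∀ i j → lookup xs i ≡ lookup xs j → i ≡ j
lookup-injective (x ∷ xs) (px ∷ u) fzero fzero e = refl
lookup-injective (x ∷ xs) (px ∷ u) fzero (fsuc j) e = ⊥-elim (All.lookup px (∈-lookup {xs = xs} j) e)
lookup-injective (x ∷ xs) (px ∷ u) (fsuc i) fzero e = ⊥-elim (All.lookup px (∈-lookup {xs = xs} i) (sym e))
lookup-injective (x ∷ xs) (px ∷ u) (fsuc i) (fsuc j) e = cong fsuc (lookup-injective xs u i j e)

con-lookup : ∀ {V : Set} (xs : List V) i j → toℕ j ≡ suc (toℕ i) → Con (lookup xs i) (lookup xs j) xs
con-lookup (x ∷ y ∷ xs) fzero (fsuc fzero) _ = now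
con-lookup (x ∷ xs) (fsuc i) (fsuc j) e = later (con-lookup xs i j (suc-injective e))

last-lookup : ∀ {V : Set} (xs : List V) i → suc (toℕ i) ≡ length xs → Last (lookup xs i) xs
last-lookup (x ∷ []) fzero _ = sole
last-lookup (x ∷ xs) (fsuc i) e = later (last-lookup xs i (suc-injective e))

module AsPermutation {n : ℕ} (z : Fin n) (zs : List (Fin n)) (perm : z ∷ zs ↭ allFin n) where

  private
    xs = z ∷ zs

    length-xs : length xs ≡ n
    length-xs = trans (↭-length perm) (length-tabulate id)

    at : Fin n → Fin n
    at i = lookup xs (cast (sym length-xs) i)

    here-at : ∀ v → v ∈ xs
    here-at v = ∈-resp-↭ (↭-sym perm) (∈-allFin v)

    place : Fin n → Fin n
    place v = cast length-xs (index (here-at v))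

    cast-cast : ∀ {a b} (e : a ≡ b) (f : b ≡ a) i → cast f (cast e i) ≡ i
    cast-cast e f i = Fin.toℕ-injective (trans (Fin.toℕ-cast f (cast e i)) (Fin.toℕ-cast e i))

    at-place : ∀ v → at (place v) ≡ v
    at-place v = trans (cong (lookup xs) (cast-cast length-xs (sym length-xs) _)) (sym (lookup-index (here-at v)))

    place-at : ∀ i → place (at i) ≡ i
    place-at i = trans (cong (cast length-xs) (lookup-injective xs (Unique-↭ (↭-sym perm) (Uniq.allFin⁺ n)) _ _
      (sym (lookup-index (here-at (at i)))))) (cast-cast (sym length-xs) length-xs i)

  σ : Permutation′ n
  σ = permutation at place at-place place-at

  toℕ-next : ∀ {m} (i : Fin (suc m)) → toℕ (next i) ≡ suc (toℕ i) % suc m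
  toℕ-next {m} i = Fin.toℕ-fromℕ< (m%n<n (suc (toℕ i)) (suc m))

  next-case : ∀ {m} (i : Fin m) → toℕ (next i) ≡ suc (toℕ i) ⊎ (suc (toℕ i) ≡ m × toℕ (next i) ≡ 0)
  next-case {suc m} i with m≤n⇒m<n∨m≡n (Fin.toℕ<n i)
  ... | inj₁ lt = inj₁ (trans (toℕ-next i) (m<n⇒m%n≡m lt))
  ... | inj₂ eq = inj₂ (eq , trans (toℕ-next i) (trans (cong (_% suc m) eq) (n%n≡0 (suc m))))

  σ-arc : ∀ i → Con (σ ⟨$⟩ʳ i) (σ ⟨$⟩ʳ next i) (z ∷ zs ∷ʳ z)
  σ-arc i with next-case i
  ... | inj₁ e = con-++ˡ (z ∷ []) (con-lookup xs _ _ (trans (Fin.toℕ-cast _ (next i)) (trans e (cong suc (sym (Fin.toℕ-cast _ i))))))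
  ... | inj₂ (e , e′) = con-++ᵐ (last-lookup xs _ (trans (cong suc (Fin.toℕ-cast _ i)) (trans e (sym length-xs))))
        (head (cast (sym length-xs) (next i)) (trans (Fin.toℕ-cast _ (next i)) e′))
    where
    head : ∀ j → toℕ j ≡ 0 → Head (lookup xs j) (z ∷ [])
    head fzero _ = first

-- Logarithms and constants

binary-log : ∀ k → ∃[ l ] suc k ≤ 2 ^ l × 2 ^ l ≤ suc k + suc k
binary-log zero = 0 , s≤s z≤n , s≤s z≤n
binary-log (suc k) = go (binary-log k)
  where
  go : ∃[ l ] suc k ≤ 2 ^ l × 2 ^ l ≤ suc k + suc k → ∃[ l ] suc (suc k) ≤ 2 ^ l × 2 ^ l ≤ suc (suc k) + suc (suc k)
  go (l , lo , hi) with suc (suc k) ≤? 2 ^ l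
  ... | yes le = l , le , ≤-trans hi (+-mono-≤ (n≤1+n (suc k)) (n≤1+n (suc k)))
  ... | no nle = suc l ,
        ≤-trans (≤-trans (m≤n+m (suc (suc k)) k) (≤-reflexive (arith k))) (+-mono-≤ lo (≤-trans lo (≤-reflexive (sym (+-identityʳ (2 ^ l)))))) ,
        +-mono-≤ le′ (≤-trans (≤-reflexive (+-identityʳ (2 ^ l))) le′)
    where
    arith : ∀ k → k + suc (suc k) ≡ suc k + suc k
    arith = solve-∀
    le′ : 2 ^ l ≤ suc (suc k)
    le′ = ≤-trans (≤-pred (≰⇒> nle)) (n≤1+n (suc k))

2^-reflects-≤ : ∀ a b → 2 ^ a ≤ 2 ^ b → a ≤ b
2^-reflects-≤ a b le with a ≤? b
... | yes p = p
... | no np = ⊥-elim (<⇒≱ (^-monoʳ-< 2 (s≤s (s≤s z≤n)) (≰⇒> np)) le)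

-- Since 2 ^ l ≤ 2 k ≤ k ^ 2, one has 2 ^ (l + 10) ≤ k ^ 12.
exponent-bound : ∀ Q k l ℓ → 2 ≤ k → 2 ^ l ≤ k + k → k ^ ((12 * Q) * (k * k)) ≤ 2 ^ ℓ → (Q * (k * k)) * (l + 10) ≤ ℓ
exponent-bound Q k l ℓ k≥2 hi hyp = 2^-reflects-≤ _ ℓ (≤-trans (≤-reflexive (trans (cong (2 ^_) (*-comm E (l + 10))) (sym (^-*-assoc 2 (l + 10) E))))
    (≤-trans (^-monoˡ-≤ E base) (≤-trans (≤-reflexive (trans (^-*-assoc k 12 E) (cong (k ^_) (sym (*-assoc 12 Q (k * k)))))) hyp)))
  where
  E = Q * (k * k)
  base : 2 ^ (l + 10) ≤ k ^ 12
  base = ≤-trans (≤-reflexive (^-distribˡ-+-* 2 l 10)) (≤-trans (*-mono-≤ (≤-trans hi square) (^-monoˡ-≤ 10 k≥2))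
           (≤-reflexive (sym (^-distribˡ-+-* k 2 10))))
    where
    square : k + k ≤ k ^ 2
    square = ≤-trans (≤-reflexive (double k)) (≤-trans (*-monoˡ-≤ k k≥2) (≤-reflexive (cong (k *_) (sym (*-identityʳ k)))))
      where
      double : ∀ k → k + k ≡ 2 * k
      double = solve-∀

-- 16 (4k + 1) = 64k + 16, and 16 ≤ 8k.
sixteen-bound : ∀ k → 2 ≤ k → sixteen (suc (k * 4)) ≤ 72 * k
sixteen-bound k k≥2 = ≤-trans (≤-reflexive (trans (sixteen≡ (suc (k * 4))) (expand k)))
    (≤-trans (+-monoˡ-≤ (64 * k) (*-monoʳ-≤ 8 k≥2)) (≤-reflexive (sym (*-distribʳ-+ k 8 64))))
  where
  sixteen≡ : ∀ m → sixteen m ≡ 16 * m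
  sixteen≡ m = trans (twice m₈) (trans (cong (2 *_) (trans (twice m₄) (cong (2 *_) (trans (twice m₂) (cong (2 *_) (twice m)))))) (fold m))
    where
    m₂ m₄ m₈ : ℕ
    m₂ = m + m
    m₄ = m₂ + m₂
    m₈ = m₄ + m₄
    twice : ∀ a → a + a ≡ 2 * a
    twice = solve-∀
    fold : ∀ m → 2 * (2 * (2 * (2 * m))) ≡ 16 * m
    fold = solve-∀
  expand : ∀ k → 16 * suc (k * 4) ≡ 16 + 64 * k
  expand = solve-∀

sixteen-≥ : ∀ m → m ≤ sixteen m
sixteen-≥ m = ≤-trans (m≤m+n m m) (≤-trans (m≤m+n _ _) (≤-trans (m≤m+n _ _) (m≤m+n _ _)))

record Numbers (k ℓ : ℕ) : Set where
  field
    c       : ℕ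
    large-c : sixteen (suc (k * 4)) * 6 ≤ 2 ^ c
    -- The factor behind 52 bounds the number of joint vertices on all strands. In units of it the
    -- degree count needs 2 (3 · 7 + 4 + 1) = 52: three times `β`, twice the number of pieces, and d
    -- + 1.
    large-ℓ : 52 * (k * sixteen (suc (k * 4)) * (suc c + suc c)) ≤ ℓ

numbers : ∀ k ℓ → 2 ≤ k → k ^ ((12 * (52 * (72 * 2))) * (k * k)) ≤ 2 ^ ℓ → Numbers k ℓ
numbers k@(suc k′) ℓ k≥2 hyp = go (binary-log k′)
  where
  M = sixteen (suc (k * 4))
  M≤ = sixteen-bound k k≥2
  arith : ∀ a b k x → a * (k * (b * k) * (x + x)) ≡ (a * (b * 2)) * (k * k) * x
  arith = solve-∀
  go : ∃[ l ] k ≤ 2 ^ l × 2 ^ l ≤ k + k → Numbers k ℓ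
  go (l , lo , hi) = record
    -- Six times the at most 72k strands of a cycle is 432k, below 512k ≤ 2^(l + 9).
    { c = l + 9
    ; large-c = ≤-trans (*-monoˡ-≤ 6 M≤) (≤-trans (≤-reflexive (trans (cong (_* 6) (*-comm 72 k)) (*-assoc k 72 6)))
        (≤-trans (*-mono-≤ lo (m≤m+n 432 80)) (≤-reflexive (sym (^-distribˡ-+-* 2 l 9)))))
    ; large-ℓ = ≤-trans (*-monoʳ-≤ 52 (*-monoˡ-≤ (suc (l + 9) + suc (l + 9)) (*-monoʳ-≤ k M≤)))
        (≤-trans (≤-reflexive (trans (cong (λ x → 52 * (k * (72 * k) * (x + x))) (sym (+-suc l 9))) (arith 52 72 k (l + 10))))
          (exponent-bound (52 * (72 * 2)) k l ℓ k≥2 hi hyp))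
    }

-- Reservations for all cycles, and conclusion

concatMap-concat : ∀ {A B : Set} (h : A → List B) xss → concatMap h (concat xss) ≡ concatMap (concatMap h) xss
concatMap-concat h [] = refl
concatMap-concat h (xs ∷ xss) = trans (concatMap-++ h xs (concat xss)) (cong (concatMap h xs ++_) (concatMap-concat h xss))

chop : ∀ {A : Set} k M (xs : List A) → length xs ≡ k * M →
       ∃[ xss ] length xss ≡ k × All (λ ys → length ys ≡ M) xss × concat xss ≡ xs
chop zero M [] _ = [] , refl , [] , refl
chop {A} (suc k) M xs e = go (prefix M xs e)
  where
  prefix : ∀ M {r} (xs : List A) → length xs ≡ M + r → ∃[ as ] ∃[ bs ] xs ≡ as ++ bs × length as ≡ M × length bs ≡ r
  prefix zero xs e = [] , xs , refl , refl , e
  prefix (suc M) (x ∷ xs) e with prefix M xs (suc-injective e)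
  ... | as , bs , refl , p , q = x ∷ as , bs , refl , cong suc p , q
  go : ∃[ as ] ∃[ bs ] xs ≡ as ++ bs × length as ≡ M × length bs ≡ k * M → _
  go (as , bs , refl , p , q) with chop k M bs q
  ... | xss , a , b , c = as ∷ xss , cong suc a , p ∷ b , cong (as ++_) c

unique-concatMap-apart : ∀ {A V : Set} (f : A → List V) xs → Unique (concatMap f xs) →
  AllPairs (λ x y → ∀ {v} → v ∈ f x → v ∉ f y) xs
unique-concatMap-apart f [] _ = []
unique-concatMap-apart f (x ∷ xs) u =
  All.tabulate (λ {y} i j l → unique-disjoint (f x) u j (∈-concatMap⁺ f i l)) ∷ unique-concatMap-apart f xs (unique-++ʳ (f x) u)

unique-concatMap-inj : ∀ {A V : Set} (f : A → List V) xs → Unique (concatMap f xs) → ∀ {x y v} →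
  x ∈ xs → y ∈ xs → v ∈ f x → v ∈ f y → x ≡ y
unique-concatMap-inj f (z ∷ xs) u (here refl) (here refl) p q = refl
unique-concatMap-inj f (z ∷ xs) u (here refl) (there j) p q = ⊥-elim (unique-disjoint (f z) u p (∈-concatMap⁺ f j q))
unique-concatMap-inj f (z ∷ xs) u (there i) (here refl) p q = ⊥-elim (unique-disjoint (f z) u q (∈-concatMap⁺ f i p))
unique-concatMap-inj f (z ∷ xs) u (there i) (there j) p q = unique-concatMap-inj f xs (unique-++ʳ (f z) u) i j p q

another : ∀ {A : Set} {P : A → A → Set} (xs : List A) → (∀ {x y} → P x y → P y x) → AllPairs P xs → 2 ≤ length xs →
          ∀ {x} → x ∈ xs → ∃[ y ] y ∈ xs × P x y
another (x ∷ []) sy _ (s≤s ())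
another (x ∷ y ∷ xs) sy ((p ∷ _) ∷ _) _ (here refl) = y , there (here refl) , p
another (x ∷ y ∷ xs) sy (ps ∷ _) _ (there i) = x , here refl , sy (All.lookup ps i)

length-concatMap-≥ : ∀ {A B : Set} (f : A → List B) → (∀ x → 1 ≤ length (f x)) → ∀ xs → length xs ≤ length (concatMap f xs)
length-concatMap-≥ f h [] = z≤n
length-concatMap-≥ f h (x ∷ xs) = ≤-trans (+-mono-≤ (h x) (length-concatMap-≥ f h xs)) (≤-reflexive (sym (length-++ (f x))))

module Final {k : ℕ} (k≥2 : 2 ≤ k) {n : ℕ} (T : Tournament n) {ℓ : ℕ} (linked : Linked T ℓ) (num : Numbers k ℓ) where

  open Numbers num
  open Linking T
  open IsTournament tour
  open ChooseJoints Fin._≟_ tour F₀ F-unique F-all c using (GoodJoint; module GoodJoint; choose-joints)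
  open JointPair using (vs; A; B)

  d M s₁ N U β : ℕ
  d = k * 4
  M = sixteen (suc d)
  s₁ = suc c + suc c
  N = k * M
  U = N * s₁
  -- At most 3U for `W`, which has three vertices for each joint vertex, and 4U for the forbidden
  -- neighbours of the joints of one group, because M s₁ · 4k = 4U.
  β = 7 * U

  private
    1≤k : 1 ≤ k
    1≤k = ≤-trans (s≤s z≤n) k≥2
    m≤M : suc d ≤ M
    m≤M = sixteen-≥ (suc d)
    M≤N : M ≤ N
    M≤N = ≤-trans (≤-reflexive (sym (*-identityˡ M))) (*-monoˡ-≤ M 1≤k)
    N≤U : N ≤ U
    N≤U = ≤-trans (≤-reflexive (sym (*-identityʳ N))) (*-monoʳ-≤ N (s≤s z≤n))
    M≤U : M ≤ U
    M≤U = ≤-trans M≤N N≤U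
    1≤U : 1 ≤ U
    1≤U = ≤-trans (s≤s z≤n) (≤-trans m≤M M≤U)
    s₁≤U : s₁ ≤ U
    s₁≤U = ≤-trans (≤-reflexive (sym (*-identityˡ s₁))) (*-monoˡ-≤ s₁ (≤-trans (s≤s z≤n) (≤-trans m≤M M≤N)))

    4U≤ℓ : (U + U) + (U + U) ≤ ℓ
    4U≤ℓ = ≤-trans (≤-trans (m≤m+n _ (48 * U)) (≤-reflexive (arith U))) large-ℓ
      where
      arith : ∀ u → (u + u) + (u + u) + 48 * u ≡ 52 * u
      arith = solve-∀

    3U<ℓ : U + U + U < ℓ
    3U<ℓ = ≤-trans (+-mono-≤ 1≤U ≤-refl) (≤-trans (≤-reflexive (arith U)) 4U≤ℓ)
      where
      arith : ∀ u → u + (u + u + u) ≡ (u + u) + (u + u)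
      arith = solve-∀

    ℓ≥1 : 1 ≤ ℓ
    ℓ≥1 = ≤-trans (s≤s z≤n) 3U<ℓ

    enough-vertices : suc c + U < length F₀
    enough-vertices = ≤-trans (s≤s (≤-trans (+-monoˡ-≤ U (≤-trans (m≤m+n (suc c) (suc c)) s₁≤U)) (m≤m+n (U + U) U)))
      (≤-trans 3U<ℓ (≤-trans (m≤m+n ℓ ℓ) (≤-trans (proj₁ linked) (≤-reflexive (sym F-length)))))

    budget-ok : 2 * (β + (β + (β + ((M + M) + (M + M)))) + suc d) ≤ ℓ
    budget-ok = ≤-trans (*-monoʳ-≤ 2 (+-mono-≤ (+-monoʳ-≤ β (+-monoʳ-≤ β (+-monoʳ-≤ β (+-mono-≤ (+-mono-≤ M≤U M≤U) (+-mono-≤ M≤U M≤U)))))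
        (≤-trans m≤M M≤U))) (≤-trans (≤-reflexive (arith U)) large-ℓ)
      where
      arith : ∀ u → 2 * (7 * u + (7 * u + (7 * u + ((u + u) + (u + u)))) + u) ≡ 52 * u
      arith = solve-∀

  open Covering T linked ℓ≥1 using (min-out; min-in; CoverArc; CoverArcs; cover-arcs)

  Joints : Set
  Joints = ∃[ os ] length os ≡ N × Unique (concatMap vs os) × All (λ o → GoodJoint o (concatMap vs os)) os ×
                   length (concatMap vs os) ≤ U

  module Assembled (os : List (JointPair V)) (os-length : length os ≡ N) (L-unique : Unique (concatMap vs os))
    (os-good : All (λ o → GoodJoint o (concatMap vs os)) os) (L-size : length (concatMap vs os) ≤ U)
    (cov : V → V × V) (cov-unique : Unique (concatMap (ends₂ ∘ cov) (concatMap vs os) ++ concatMap vs os))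
    (cov-arc : ∀ {v} → v ∈ concatMap vs os → CoverArc v (cov v))
    (mid : V → List V) (whole-unique : Unique (concatMap (Chains.whole T cov mid) os))
    (mid-path : ∀ {x y} → (x , y) ∈ concatMap (Chains.links T cov) os → IsPath _⇒_ (x ∷ mid x ∷ʳ y))
    (gs : List (List (JointPair V))) (gs-length : length gs ≡ k) (gs-lengths : All (λ g → length g ≡ M) gs)
    (gs-concat : concat gs ≡ os)
    where

    open Chains T cov

    L W : List V
    L = concatMap vs os
    W = L ++ concatMap (ends₂ ∘ cov) L

    s : ℕ
    s = M * s₁

    private
      ends-length : ∀ ks → length (concatMap (ends₂ ∘ cov) ks) ≡ length ks + length ks
      ends-length [] = refl
      ends-length (k ∷ ks) = cong suc (trans (cong suc (ends-length ks)) (sym (+-suc _ _)))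

    W-size : length W + s * d ≤ β
    W-size = ≤-trans (+-mono-≤ (≤-trans (≤-reflexive (trans (length-++ L) (cong (length L +_) (ends-length L)))) (+-mono-≤ L-size (+-mono-≤ L-size L-size)))
               (≤-reflexive (four k M s₁))) (≤-reflexive (seven U))
      where
      four : ∀ k m s → m * s * (k * 4) ≡ 4 * (k * m * s)
      four = solve-∀
      seven : ∀ u → u + (u + u) + 4 * u ≡ 7 * u
      seven = solve-∀

    open Step T cov mid W L c d s β ℓ W-size using (Ready; wholes; joints; triples; triple; outside; Reserved)
    open Pack T cov mid W L c d s β ℓ W-size using (pack; Packing; Apart; CycleArc; IsCycle)

    in-os : ∀ {g o} → g ∈ gs → o ∈ g → o ∈ os
    in-os g∈ o∈ = subst (_ ∈_) gs-concat (∈-concat⁺′ o∈ g∈)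

    spread : ∀ {B : Set} (h : JointPair V → List B) → concatMap h os ≡ concatMap (concatMap h) gs
    spread h = trans (cong (concatMap h) (sym gs-concat)) (concatMap-concat h gs)

    wholes-unique : Unique (concatMap wholes gs)
    wholes-unique = subst Unique (spread (whole mid)) whole-unique

    apart : AllPairs Apart gs
    apart = unique-concatMap-apart wholes gs wholes-unique

    triple-unique : Unique (concatMap triple L)
    triple-unique = Unique-↭ (↭-sym (↭-trans (concatMap-↭-cong shape L)
        (↭-trans (concatMap-zip (ends₂ ∘ cov) (_∷ []) L) (++⁺ˡ (concatMap (ends₂ ∘ cov) L) (↭-reflexive (singles L)))))) cov-unique
      where
      shape : ∀ v → triple v ↭ ends₂ (cov v) ++ v ∷ []
      shape v = prep (cx v) (swap v (cy v) ↭-refl)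
      singles : ∀ (ks : List V) → concatMap (_∷ []) ks ≡ ks
      singles [] = refl
      singles (k ∷ ks) = cong (k ∷_) (singles ks)

    triples-unique : Unique (concatMap triples gs)
    triples-unique = subst Unique eq triple-unique
      where
      eq : concatMap triple L ≡ concatMap triples gs
      eq = trans (concatMap-concatMap triple vs os) (trans (spread (concatMap triple ∘ vs))
             (concatMap-cong (λ g → sym (concatMap-concatMap triple vs g)) gs))

    joints⊆L : ∀ {g v} → g ∈ gs → v ∈ joints g → v ∈ L
    joints⊆L {v = v} g∈ i = go (∈-concatMap vs _ i)
      where
      go : ∃[ o ] o ∈ _ × v ∈ vs o → v ∈ L
      go (o , o∈ , j) = ∈-concatMap⁺ vs (in-os g∈ o∈) j

    ready : ∀ {g} → g ∈ gs → Ready g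
    ready {g} g∈ = record
      { good = λ i → All.lookup os-good (in-os g∈ i)
      ; wholes-unique = unique-concatMap-at wholes gs wholes-unique g∈
      ; triples-unique = unique-concatMap-at triples gs triples-unique g∈
      ; wholes-path = λ {o} i → whole-path mid o (GoodJoint.pathA (All.lookup os-good (in-os g∈ i)))
          (GoodJoint.pathB (All.lookup os-good (in-os g∈ i))) (λ j → mid-path (∈-concatMap⁺ links (in-os g∈ i) j))
          (λ j → proj₂ (proj₂ (cov-arc (∈-concatMap⁺ vs (in-os g∈ i) j))))
      ; arcs = λ i → proj₁ (cov-arc (joints⊆L g∈ i)) , proj₁ (proj₂ (cov-arc (joints⊆L g∈ i)))
      ; cx-injective = λ i j e → unique-concatMap-inj triple L triple-unique (joints⊆L g∈ i) (joints⊆L g∈ j) (here refl) (here e)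
      ; special = λ i → ∈-++⁺ˡ (joints⊆L g∈ i) ,
          ∈-++⁺ʳ L (∈-concatMap⁺ (ends₂ ∘ cov) (joints⊆L g∈ i) (here refl)) ,
          ∈-++⁺ʳ L (∈-concatMap⁺ (ends₂ ∘ cov) (joints⊆L g∈ i) (there (here refl)))
      ; number = All.lookup gs-lengths g∈
      ; size = ≤-trans (length-concatMap-bound vs s₁ g (λ i → GoodJoint.size (All.lookup os-good (in-os g∈ i))))
                 (≤-reflexive (cong (_* s₁) (All.lookup gs-lengths g∈)))
      ; room = room (another {P = Apart} gs (λ p i j → p j i) apart (≤-trans k≥2 (≤-reflexive (sym gs-length))) g∈)
      }
      where
      -- Since k ≥ 2 there is another group, and each of its M ≥ d + 1 strands supplies a vertex off
      -- the strands of `g`.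
      room : ∃[ h ] h ∈ gs × Apart g h → suc d ≤ length (outside g)
      room (h , h∈ , ap) = ≤-trans (≤-trans m≤M (≤-reflexive (sym (All.lookup gs-lengths h∈))))
        (≤-trans (length-concatMap-≥ (whole mid) nonempty h)
          (unique-⊆-length (unique-concatMap-at wholes gs wholes-unique h∈)
            (λ {v} i → ∈-filter⁺ (λ v → ¬? (mem? Fin._≟_ v (wholes g))) (F-all v) (λ j → ap j i))))
        where
        nonempty : ∀ o → 1 ≤ length (whole mid o)
        nonempty (jointPair [] _ _ _ _ _) = s≤s z≤n
        nonempty (jointPair (_ ∷ _) _ _ _ _ _) = s≤s z≤n

    packing : Packing ∈-++⁺ˡ min-out min-in large-c budget-ok gs (Forbids.none Fin._≟_ F₀ F-all)
    packing = pack ∈-++⁺ˡ min-out min-in large-c budget-ok gs (Forbids.none Fin._≟_ F₀ F-all)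
      (≤-reflexive (cong (_* 4) gs-length)) (All.tabulate ready) apart (λ _ _ ())

    hamilton-cycles : HasEdgeDisjointHamCycles T k
    hamilton-cycles = subst (HasEdgeDisjointHamCycles T) gs-length (go packing)
      where
      go : Packing ∈-++⁺ˡ min-out min-in large-c budget-ok gs (Forbids.none Fin._≟_ F₀ F-all) → HasEdgeDisjointHamCycles T (length gs)
      go (Z , cyc , _ , disjoint) = (λ i → σ i) ,
          (λ i j → proj₂ (cyc i) (σ-arc i j)) ,
          (λ i j a b e → disjoint i j (σ-arc i a) (subst (λ p → CycleArc (Z j) (proj₁ p) (proj₂ p)) (sym e) (σ-arc j b)))
        where
        σ = λ i → AsPermutation.σ (proj₁ (Z i)) (proj₂ (Z i)) (proj₁ (cyc i))
        σ-arc = λ i → AsPermutation.σ-arc (proj₁ (Z i)) (proj₂ (Z i)) (proj₁ (cyc i))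

  result : HasEdgeDisjointHamCycles T k
  result = with-joints (choose-joints N enough-vertices)
    where
    with-joints : Joints → HasEdgeDisjointHamCycles T k
    with-joints (os , os-length , L-unique , os-good , L-size) = with-cover (cover-arcs L L L-unique L-unique id
        (≤-trans (s≤s (+-mono-≤ (+-mono-≤ L-size L-size) L-size)) 3U<ℓ))
      where
      L = concatMap vs os
      with-cover : CoverArcs L L → HasEdgeDisjointHamCycles T k
      with-cover (cov , cov-unique , cov-arc) = with-links (link-joints linked os cov-unique
          (≤-trans (+-mono-≤ (+-mono-≤ (≤-trans (≤-reflexive os-length) N≤U) L-size) L-size) (<⇒≤ 3U<ℓ)))
        where
        open Chains T cov
        with-links : ∃[ mid ] Unique (concatMap (whole mid) os) × (∀ {x y} → (x , y) ∈ concatMap links os → IsPath _⇒_ (x ∷ mid x ∷ʳ y)) →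
                     HasEdgeDisjointHamCycles T k
        with-links (mid , whole-unique , mid-path) = with-groups (chop k M os os-length)
          where
          with-groups : ∃[ gs ] length gs ≡ k × All (λ g → length g ≡ M) gs × concat gs ≡ os → HasEdgeDisjointHamCycles T k
          with-groups (gs , gs-length , gs-lengths , gs-concat) =
            Assembled.hamilton-cycles os os-length L-unique os-good L-size cov cov-unique cov-arc mid whole-unique mid-path
              gs gs-length gs-lengths gs-concat

-- The inequality between powers says (p / q) k² log k ≤ ℓ without real numbers, so p / q plays the
-- part of C'.
theorem1p2 : Σ ℕ λ p → Σ ℕ λ q → (1 ≤ p) × (1 ≤ q) ×
    (∀ (k : ℕ) → 2 ≤ k → ∀ (n : ℕ) (T : Tournament n) (ℓ : ℕ) →
    k ^ (p * (k * k)) ≤ 2 ^ (q * ℓ) → Linked T ℓ →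
    HasEdgeDisjointHamCycles T k)
-- ℓ must reach 52 · k · 72k · 2(c + 1) with c + 1 = l + 10, and l + 10 ≤ 12 log k.
theorem1p2 = 12 * (52 * (72 * 2)) , 1 , s≤s z≤n , s≤s z≤n , λ k k≥2 n T ℓ hyp linked →
  Final.result k≥2 T linked (numbers k ℓ k≥2 (subst (λ e → k ^ ((12 * (52 * (72 * 2))) * (k * k)) ≤ 2 ^ e) (*-identityˡ ℓ) hyp))
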